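{- Let $\mathcal C$ be a branch decomposition rooted at $C$ of width at most $w$, and let $m=|C|$ be the number of edges in the root cluster $C$. Then the output $\mathcal C'=\textsc{Balance}(\mathcal C)$ is a branch decomposition rooted at $C$ of width at most $2w$, and, for every edge $e\in C$, there exist at most $3\log_2 m+1$ clusters $D\in\mathcal C'$ such that $e\in D$. Moreover, there exist linear-time implementations of $\textsc{Balance}$ and $\textsc{Complete}$.
   Context: Fix a finite graph. A branch decomposition rooted at a nonempty set $C$ of edges of the graph (the root cluster) is a maximal family of mutually noncrossing nonempty subsets of $C$ (noncrossing: disjoint or nested); its members are called clusters. Under inclusion the clusters form a rooted binary tree with root $C$, whose leaves are the singletons $\{e\}$, $e\in C$, and in which each non-leaf cluster is the disjoint union of its two children (which are siblings of each other). Algorithmically a branch decomposition is represented by this tree. The boundary $\partial D$ of a cluster $D$ is the set of vertices $v$ of the graph such that $D$ contains a proper nonempty subset of the edges of the graph incident to $v$. The width of a branch decomposition is the maximum of $|\partial D|$ over its clusters $D$. $\textsc{Balance}(\mathcal C)$: the input is a branch decomposition $\mathcal C$ with root cluster $C$. If $|C|=1$, return $\mathcal C$. Otherwise let $H_1\subsetneq H_2\subsetneq\cdots\subsetneq H_k=C$ be a heavy path, that is, a maximal ascending chain of clusters of $\mathcal C$ (running from a leaf to the root, each $H_i$ being a child of $H_{i+1}$) such that for all $i\in\{1,\dots,k-1\}$ the sibling $H_{i+1}-H_i$ of $H_i$ satisfies $|H_{i+1}-H_i|\le|H_i|$. Let $C_1'=H_1$ and, for $i\in\{2,\dots,k\}$,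 $C_i'=H_i-H_{i-1}$. For $i\in\{1,\dots,k\}$ let $\mathcal C_i'=\textsc{Balance}(\{D\in\mathcal C : D\subseteq C_i'\})$. Return $\mathcal C'=\textsc{Complete}(\mathcal C_1',\dots,\mathcal C_k')$. $\textsc{Complete}(\mathcal C_1',\dots,\mathcal C_k')$: the input consists of branch decompositions $\mathcal C_i'$ with pairwise disjoint root clusters $C_i'$; the output is a branch decomposition $\mathcal C'\supseteq\mathcal C_1'\cup\dots\cup\mathcal C_k'$ with root cluster $C_1'\cup\dots\cup C_k'$. Let $m_i=|C_i'|$ and $m=m_1+\dots+m_k$. Find (via binary search) the least index $j$ with $m_1+\dots+m_j>m/2$. If $j>1$, let $\mathcal A=\textsc{Complete}(\mathcal C_1',\dots,\mathcal C_{j-1}')$ and $\mathcal B=\mathcal A\cup\{C_1'\cup\dots\cup C_j'\}\cup\mathcal C_j'$; otherwise let $\mathcal B=\mathcal C_j'$. If $j<k$, let $\mathcal E=\textsc{Complete}(\mathcal C_{j+1}',\dots,\mathcal C_k')$ and $\mathcal C'=\mathcal B\cup\{C_1'\cup\dots\cup C_k'\}\cup\mathcal E$; otherwise let $\mathcal C'=\mathcal B$. Return $\mathcal C'$. -}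

module Defs where

open import Data.Fin.Base using (Fin; toℕ)
open import Data.Fin.Properties using () renaming (_≟_ to _≟ᶠ_)
open import Data.Fin.Subset
  using (Subset; _∈_; _⊆_; _⊂_; _∩_; _∪_; _─_; ⋃; ⁅_⁆; ∣_∣; Nonempty; Empty)
open import Data.Fin.Subset.Properties using (_∈?_; _⊆?_; _⊂?_; nonempty?)
import Data.Bool.Properties as Bool
open import Data.List.Base
  using (List; []; _∷_; _++_; _∷ʳ_; length; map; foldr; filter; deduplicate; zipWith; take; last)
import Data.List.Base as List
open import Data.List.Membership.Propositional using () renaming (_∈_ to _∈ˡ_)
open import Data.List.Relation.Binary.BagAndSetEquality using (_∼[_]_; set)
open import Data.List.Relation.Binary.Pointwise using (Pointwise)
open import Data.List.Relation.Binary.Subset.Propositional using () renaming (_⊆_ to _⊆ˡ_)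
open import Data.List.Relation.Unary.All using (All)
open import Data.List.Relation.Unary.AllPairs using (AllPairs)
open import Data.List.Relation.Unary.Linked using (Linked)
open import Data.Maybe.Base using (just)
open import Data.Nat.Base using (ℕ; suc; _+_; _*_; _∸_; _^_; _⊔_; _≤_; _<_; ⌊_/2⌋)
open import Data.Nat.ListAction using (sum)
open import Data.Product.Base using (Σ-syntax; ∃-syntax; _×_; _,_; proj₁; proj₂)
open import Data.Sum.Base using (_⊎_)
open import Data.Unit.Base using (⊤)
open import Data.Vec.Base using (Vec; []; _∷_; tabulate; lookup)
open import Data.Vec.Properties using (≡-dec)
open import Relation.Binary.Definitions using (DecidableEquality)
open import Relation.Binary.PropositionalEquality using (_≡_; _≢_)
open import Relation.Nullary.Decidable using (does; _×-dec_; _⊎-dec_)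

-- The order of the two ends of an edge plays no role. Loops and parallel
-- edges are allowed, so simple graphs are a special case.
record Graph : Set where
  field
    #vertices #edges : ℕ
    ends             : Fin #edges → Fin #vertices × Fin #vertices

  edgesAt : Fin #vertices → Subset #edges
  edgesAt v = tabulate λ e → does ((v ≟ᶠ proj₁ (ends e)) ⊎-dec (v ≟ᶠ proj₂ (ends e)))

  ∂ : Subset #edges → Subset #vertices
  ∂ D = tabulate λ v →
    does (nonempty? (D ∩ edgesAt v) ×-dec ((D ∩ edgesAt v) ⊂? edgesAt v))

-- A family is a finite set of subsets, listed in any order and possibly with
-- repetitions; nothing below depends on more than which subsets are listed.
Family : ℕ → Set
Family n = List (Subset n)

module _ {n : ℕ} where

  Disjoint : Subset n → Subset n → Set
  Disjoint X Y = Empty (X ∩ Y)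

  Noncrossing : Subset n → Subset n → Set
  Noncrossing X Y = Disjoint X Y ⊎ (X ⊆ Y) ⊎ (Y ⊆ X)

  record NoncrossingFamily (C : Subset n) (𝒞 : Family n) : Set where
    field
      nonempty    : ∀ D → D ∈ˡ 𝒞 → Nonempty D
      within      : ∀ D → D ∈ˡ 𝒞 → D ⊆ C
      noncrossing : ∀ D D′ → D ∈ˡ 𝒞 → D′ ∈ˡ 𝒞 → Noncrossing D D′

  record BranchDecomposition (C : Subset n) (𝒞 : Family n) : Set where
    field
      root-nonempty     : Nonempty C
      noncrossingFamily : NoncrossingFamily C 𝒞
      maximal           : ∀ 𝒟 → NoncrossingFamily C 𝒟 → 𝒞 ⊆ˡ 𝒟 → 𝒟 ⊆ˡ 𝒞

  _≟ˢ_ : DecidableEquality (Subset n)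
  _≟ˢ_ = ≡-dec Bool._≟_

  #clustersContaining : Fin n → Family n → ℕ
  #clustersContaining e 𝒞 = length (deduplicate _≟ˢ_ (filter (e ∈?_) 𝒞))

width : (G : Graph) → Family (Graph.#edges G) → ℕ
width G 𝒞 = foldr _⊔_ 0 (map (λ D → ∣ Graph.∂ G D ∣) 𝒞)

-- c ≤ 3 log₂ m + 1 with the real logarithm, both sides exponentiated (m ≥ 1).
_≤3log₂_+1 : ℕ → ℕ → Set
c ≤3log₂ m +1 = 2 ^ c ≤ 2 * m ^ 3

-- Balance and Complete are input/output relations: the choice of a heavy
-- path is not unique, so Balance may have several outputs.

record Rooted (n : ℕ) : Set where
  constructor rooted
  field
    root   : Subset n
    family : Family n

open Rooted public

module _ {n : ℕ} where

  size : Rooted n → ℕ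
  size x = ∣ root x ∣

  unionOfRoots : List (Rooted n) → Subset n
  unionOfRoots xs = ⋃ (map root xs)

  -- j (counted from 1) is the least index with m₁ + ⋯ + m_j > m / 2.
  IsSplitIndex : List ℕ → ℕ → Set
  IsSplitIndex ms j =
    sum ms < 2 * sum (take j ms) × (∀ i → sum ms < 2 * sum (take i ms) → j ≤ i)

  mutual
    -- Here ls, x, rs are the inputs before, at and after the split index.
    data Complete : List (Rooted n) → Family n → Set where
      complete : ∀ {xs ls x rs ℬ 𝒞′} →
                 xs ≡ ls ++ x ∷ rs →
                 IsSplitIndex (map size xs) (suc (length ls)) →
                 UpToSplit ls x ℬ →
                 AfterSplit (unionOfRoots xs) ℬ rs 𝒞′ →
                 Complete xs 𝒞′

    data UpToSplit : List (Rooted n) → Rooted n → Family n → Set where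
      j≡1 : ∀ {x} → UpToSplit [] x (family x)
      j>1 : ∀ {l ls x 𝒜} →
            Complete (l ∷ ls) 𝒜 →
            UpToSplit (l ∷ ls) x (𝒜 ++ unionOfRoots ((l ∷ ls) ∷ʳ x) ∷ family x)

    data AfterSplit (C : Subset n) (ℬ : Family n) : List (Rooted n) → Family n → Set where
      j≡k : AfterSplit C ℬ [] ℬ
      j<k : ∀ {r rs ℰ} →
            Complete (r ∷ rs) ℰ →
            AfterSplit C ℬ (r ∷ rs) (ℬ ++ C ∷ ℰ)

  record HeavyPath (C : Subset n) (𝒞 : Family n) (H : List (Subset n)) : Set where
    field
      clusters  : All (_∈ˡ 𝒞) H
      ascending : Linked _⊂_ H
      maximal   : ∀ D → D ∈ˡ 𝒞 → All (λ X → (D ⊆ X) ⊎ (X ⊆ D)) H → D ∈ˡ H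
      top       : last H ≡ just C
      heavy     : Linked (λ X Y → ∣ Y ─ X ∣ ≤ ∣ X ∣) H

  -- H₁, H₂ ─ H₁, …, H_k ─ H_{k-1}
  differences : List (Subset n) → List (Subset n)
  differences []        = []
  differences (H₁ ∷ Hs) = H₁ ∷ zipWith (λ X Y → Y ─ X) (H₁ ∷ Hs) Hs

  restrict : Subset n → Family n → Family n
  restrict X = filter (_⊆? X)

  data Balance : (C : Subset n) (𝒞 𝒞′ : Family n) → Set where
    single : ∀ {C 𝒞} → ∣ C ∣ ≡ 1 → Balance C 𝒞 𝒞
    split  : ∀ {C 𝒞 𝒞′ H 𝒞s} →
             ∣ C ∣ ≢ 1 →
             HeavyPath C 𝒞 H →
             Pointwise (λ Cᵢ 𝒞ᵢ → Balance Cᵢ (restrict Cᵢ 𝒞) 𝒞ᵢ) (differences H) 𝒞s →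
             Complete (zipWith rooted (differences H) 𝒞s) 𝒞′ →
             Balance C 𝒞 𝒞′

-- A first-order call-by-value language with a cost semantics. Data are words,
-- immutable two-field cells and immutable arrays; every construct costs one
-- unit, except that creating an array also costs its length. Each unit is a
-- bounded amount of work on a RAM, where cells and arrays are pointers.
-- Addition, the only operation that could create ever larger words, is
-- defined only when its result is at most the word bound W.

data Val : Set where
  nat  : ℕ → Val
  cell : Val → Val → Val
  arr  : List Val → Val

listVal : List Val → Val
listVal = foldr cell (nat 0)

-- Expressions with f callable functions and n variables in scope.
data Exp (f : ℕ) : ℕ → Set where
  var   : ∀ {n} → Fin n → Exp f n
  lit   : ∀ {n} → ℕ → Exp f n
  add   : ∀ {n} → Exp f n → Exp f n → Exp f n
  sub   : ∀ {n} → Exp f n → Exp f n → Exp f n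
  half  : ∀ {n} → Exp f n → Exp f n
  cons  : ∀ {n} → Exp f n → Exp f n → Exp f n
  array : ∀ {n} → Exp f n → Exp f n
  index : ∀ {n} → Exp f n → Exp f n → Exp f n
  ifle  : ∀ {n} → Exp f n → Exp f n → Exp f n → Exp f n → Exp f n
  -- branches on word or cell; the second branch binds the two fields
  match : ∀ {n} → Exp f n → Exp f n → Exp f (suc (suc n)) → Exp f n
  bind  : ∀ {n} → Exp f n → Exp f (suc n) → Exp f n
  call  : ∀ {n} → Fin f → Exp f n → Exp f n

-- Functions take one argument and may call each other recursively.
record Program : Set where
  field
    #functions : ℕ
    bodies     : Vec (Exp #functions 1) #functions
    main       : Fin #functions

module _ {f : ℕ} (bodies : Vec (Exp f 1) f) (W : ℕ) where

  -- Eval ρ e v c: in environment ρ, e evaluates to v at cost c.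
  data Eval {n : ℕ} (ρ : Vec Val n) : Exp f n → Val → ℕ → Set where
    var   : ∀ {i} → Eval ρ (var i) (lookup ρ i) 1
    lit   : ∀ {k} → Eval ρ (lit k) (nat k) 1
    add   : ∀ {e₁ e₂ x y a b} →
            Eval ρ e₁ (nat x) a → Eval ρ e₂ (nat y) b → x + y ≤ W →
            Eval ρ (add e₁ e₂) (nat (x + y)) (suc (a + b))
    sub   : ∀ {e₁ e₂ x y a b} →
            Eval ρ e₁ (nat x) a → Eval ρ e₂ (nat y) b →
            Eval ρ (sub e₁ e₂) (nat (x ∸ y)) (suc (a + b))
    half  : ∀ {e x a} →
            Eval ρ e (nat x) a →
            Eval ρ (half e) (nat ⌊ x /2⌋) (suc a)
    cons  : ∀ {e₁ e₂ u v a b} →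
            Eval ρ e₁ u a → Eval ρ e₂ v b →
            Eval ρ (cons e₁ e₂) (cell u v) (suc (a + b))
    array : ∀ {e vs a} →
            Eval ρ e (listVal vs) a →
            Eval ρ (array e) (arr vs) (suc (a + length vs))
    index : ∀ {e₁ e₂ vs a b} {i : Fin (length vs)} →
            Eval ρ e₁ (arr vs) a → Eval ρ e₂ (nat (toℕ i)) b →
            Eval ρ (index e₁ e₂) (List.lookup vs i) (suc (a + b))
    ifle-yes : ∀ {e₁ e₂ e₃ e₄ x y v a b c} →
            Eval ρ e₁ (nat x) a → Eval ρ e₂ (nat y) b → x ≤ y →
            Eval ρ e₃ v c →
            Eval ρ (ifle e₁ e₂ e₃ e₄) v (suc (a + b + c))
    ifle-no  : ∀ {e₁ e₂ e₃ e₄ x y v a b c} →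
            Eval ρ e₁ (nat x) a → Eval ρ e₂ (nat y) b → y < x →
            Eval ρ e₄ v c →
            Eval ρ (ifle e₁ e₂ e₃ e₄) v (suc (a + b + c))
    match-nat  : ∀ {e e₁ e₂ x v a b} →
            Eval ρ e (nat x) a → Eval ρ e₁ v b →
            Eval ρ (match e e₁ e₂) v (suc (a + b))
    match-cell : ∀ {e e₁ e₂ u₁ u₂ v a b} →
            Eval ρ e (cell u₁ u₂) a → Eval (u₁ ∷ u₂ ∷ ρ) e₂ v b →
            Eval ρ (match e e₁ e₂) v (suc (a + b))
    bind  : ∀ {e₁ e₂ u v a b} →
            Eval ρ e₁ u a → Eval (u ∷ ρ) e₂ v b →
            Eval ρ (bind e₁ e₂) v (suc (a + b))
    call  : ∀ {g e u v a b} →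
            Eval ρ e u a → Eval (u ∷ []) (lookup bodies g) v b →
            Eval ρ (call g e) v (suc (a + b))

Run : Program → (W : ℕ) → (input output : Val) → (cost : ℕ) → Set
Run P W u v c = Eval bodies W (u ∷ []) (lookup bodies main) v c
  where open Program P

data Tree (n : ℕ) : Set where
  leaf : Fin n → Tree n
  node : Tree n → Tree n → Tree n

module _ {n : ℕ} where

  rootCluster : Tree n → Subset n
  rootCluster (leaf e)   = ⁅ e ⁆
  rootCluster (node l r) = rootCluster l ∪ rootCluster r

  treeClusters : Tree n → Family n
  treeClusters (leaf e)   = ⁅ e ⁆ ∷ []
  treeClusters (node l r) =
    (rootCluster l ∪ rootCluster r) ∷ treeClusters l ++ treeClusters r

  DisjointChildren : Tree n → Set
  DisjointChildren (leaf e)   = ⊤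
  DisjointChildren (node l r) =
    Disjoint (rootCluster l) (rootCluster r) × DisjointChildren l × DisjointChildren r

  _Represents_ : Tree n → Family n → Set
  t Represents 𝒞 = DisjointChildren t × treeClusters t ∼[ set ] 𝒞

  treeVal : Tree n → Val
  treeVal (leaf e)   = nat (toℕ e)
  treeVal (node l r) = cell (treeVal l) (treeVal r)

-- One constant K serves for the running time and for the word bound, so that
-- words have O(log m) bits.

BalanceInLinearTime : Set
BalanceInLinearTime =
  Σ[ P ∈ Program ] Σ[ K ∈ ℕ ]
    (∀ {n} (C : Subset n) (𝒞 : Family n) (t : Tree n) →
     BranchDecomposition C 𝒞 → t Represents 𝒞 →
     ∃[ t′ ] ∃[ 𝒞′ ] ∃[ c ]
       Run P (K * ∣ C ∣) (treeVal t) (treeVal t′) c ×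
       c ≤ K * ∣ C ∣ ×
       t′ Represents 𝒞′ ×
       Balance C 𝒞 𝒞′)

CompleteInLinearTime : Set
CompleteInLinearTime =
  Σ[ P ∈ Program ] Σ[ K ∈ ℕ ]
    (∀ {n} (xs : List (Rooted n)) (ts : List (Tree n)) →
     xs ≢ [] →
     All (λ x → BranchDecomposition (root x) (family x)) xs →
     AllPairs (λ x y → Disjoint (root x) (root y)) xs →
     Pointwise (λ t x → t Represents family x) ts xs →
     ∃[ t′ ] ∃[ 𝒞′ ] ∃[ c ]
       Run P (K * sum (map size xs)) (listVal (map treeVal ts)) (treeVal t′) c ×
       c ≤ K * sum (map size xs) ×
       t′ Represents 𝒞′ ×
       Complete xs 𝒞′)

{-# OPTIONS --safe #-}

-- A cluster created by Complete is a union of consecutive blocks H_i ─ H_{i-1} of a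
-- heavy path, hence a difference of two old clusters, and ∂ (Y ─ X) ⊆ ∂ Y ∪ ∂ X, so the
-- width at most doubles.
--
-- A recursive call of Complete halves the total size and costs a block at most two new
-- clusters, and only one if it lies to the right of the split index. In general this
-- gives 2^d m_i² ≤ 4 m² for the number d of new clusters around a block of size m_i.
-- Along a heavy path m_i ≤ m₁ + ⋯ + m_{i-1} for i > 1, which improves the bound to
-- 2^d m_i³ ≤ m³, so that 2^depth ≤ 2 m³ passes through the recursion of Balance; the
-- first block is a single edge.
--
-- For linear time, the split indices of one heavy path are found by binary search in an
-- array of prefix sums. A search among blocks of total size s costs O(1 + log s), which
-- amortises because s halves in every recursive call.

module Submission where

open import Defs
open import Data.Empty using (⊥-elim)
open import Data.Fin.Base using (Fin; zero; suc; toℕ; fromℕ<)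
open import Data.Fin.Subset
  using (Subset; _∈_; _∉_; _⊆_; _⊂_; _∩_; _∪_; _─_; ⋃; ⁅_⁆; ∣_∣; Nonempty; inside; outside)
  renaming (⊥ to ∅)
open import Data.Fin.Subset.Properties
open import Data.List.Base
  using (List; []; _∷_; _++_; _∷ʳ_; length; map; filter; zipWith; take; last)
import Data.List.Base as List
open import Data.List.Properties
  using (∷-injective; map-∘; ++-assoc; ++-identityʳ; length-++; map-++; length-map)
open import Data.List.Membership.Propositional using () renaming (_∈_ to _∈ˡ_)
open import Data.List.Membership.Propositional.Properties
  using (∈-++⁺ˡ; ∈-++⁺ʳ; ∈-++⁻; ∈-filter⁺; ∈-filter⁻; ∈-deduplicate⁻; ∈-∃++; ∈-map⁻)
open import Data.List.Relation.Binary.BagAndSetEquality using (_∼[_]_; set)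
open import Data.List.Relation.Binary.Pointwise using (Pointwise; []; _∷_)
open import Data.List.Relation.Binary.Subset.Propositional using () renaming (_⊆_ to _⊆ˡ_)
open import Data.List.Relation.Unary.All using (All; []; _∷_)
import Data.List.Relation.Unary.All as All
import Data.List.Relation.Unary.All.Properties as All
open import Data.List.Relation.Unary.AllPairs using (AllPairs; []; _∷_)
import Data.List.Relation.Unary.AllPairs.Properties as AllPairs
open import Data.List.Relation.Unary.Any using (here; there)
open import Data.List.Relation.Unary.Linked using (Linked; []; [-]; _∷_)
open import Data.List.Relation.Unary.Unique.Propositional using (Unique)
import Data.List.Relation.Unary.Unique.DecPropositional.Properties as Unique
open import Data.Maybe.Base using (just)
open import Data.Nat using (ℕ; zero; suc; _+_; _*_; _∸_; _^_; _≤_; _<_; z≤n; s≤s; z<s; _≤?_; _<?_; ⌊_/2⌋; ⌈_/2⌉)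
open import Data.Nat.Induction using (<-wellFounded)
open import Data.Nat.ListAction using (sum)
open import Data.Nat.ListAction.Properties using (sum-++)
open import Data.Nat.Logarithm using (⌈log₂_⌉; ⌈log₂⌉-mono-≤; ⌈log₂⌈n/2⌉⌉≡⌈log₂n⌉∸1; ⌈log₂2*n⌉≡1+⌈log₂n⌉; ⌈log₂2^n⌉≡n)
open import Data.Nat.Properties
open import Data.Nat.Tactic.RingSolver using (solve-∀)
open import Data.Product.Base using (∃-syntax; _×_; _,_; proj₁; proj₂)
open import Data.Sum.Base using (_⊎_; inj₁; inj₂)
open import Data.Unit.Base using (tt)
open import Data.Vec.Base using (Vec; []; _∷_; lookup; tabulate; here; there)
open import Data.Vec.Properties using (lookup∘tabulate; []=⇒lookup; lookup⇒[]=)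
open import Function.Base using (_∘_; id; case_of_)
open import Function.Bundles using (Equivalence; mk⇔)
open import Induction.WellFounded using (Acc; acc)
open import Relation.Binary.PropositionalEquality
  using (_≡_; _≢_; refl; sym; trans; cong; cong₂; subst; subst₂)
open import Relation.Nullary using (Dec; yes; no; ¬_)
open import Relation.Nullary.Decidable using (does; dec-true; True; toWitness; _×-dec_)

-- Subsets and branch decompositions

-- The quadratic depth bound cannot pass through the recursion of `Balance` by itself: its constant
-- 4 would be lost once per level. The cubic bound for the later blocks has constant 1 and is
-- therefore stable. The first block only has a quadratic bound with constant 2, but the recursion
-- ends there. The doubling of the width does not accumulate either, because the clusters of a
-- restriction are clusters of the original family. For linear time the logarithms must telescope
-- through two nested recursions. A run of `Complete` on blocks of sizes m_i with total s, none
-- above s / 2, satisfies cost + 3M λ(s) ≤ ∑ (3M λ(m_i) + const), where λ is the logarithm rounded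
-- up. So the run that produced a block leaves over the very term that the block contributes one
-- level up. The constants are paid by the leaves: the heavy path of a cluster with several edges
-- has at least two blocks and yields only one block for the next level. That `Balance` has an
-- output at all is read off from a run of the program.

∈-split : ∀ {a} {V : Set a} {x y : V} xs {zs} → x ∈ˡ xs ++ y ∷ zs → x ∈ˡ xs ⊎ x ≡ y ⊎ x ∈ˡ zs
∈-split xs x∈ with ∈-++⁻ xs x∈
... | inj₁ x∈xs         = inj₁ x∈xs
... | inj₂ (here x≡y)   = inj₂ (inj₁ x≡y)
... | inj₂ (there x∈zs) = inj₂ (inj₂ x∈zs)

largest : ∀ {a} {V : Set a} (f : V → ℕ) (x : V) (xs : List V) →
          ∃[ y ] (y ∈ˡ x ∷ xs × ∀ z → z ∈ˡ x ∷ xs → f z ≤ f y)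
largest f x [] = x , here refl , λ { z (here refl) → ≤-refl }
largest f x (x′ ∷ xs) with largest f x′ xs
... | y , y∈ , y-max with f x ≤? f y
...   | yes fx≤fy = y , there y∈ , λ where
        z (here refl) → fx≤fy
        z (there z∈)  → y-max z z∈
...   | no  fx≰fy = x , here refl , λ where
        z (here refl) → ≤-refl
        z (there z∈)  → ≤-trans (y-max z z∈) (<⇒≤ (≰⇒> fx≰fy))

module _ {n : ℕ} where

  private variable
    A B X Y Z : Subset n

  disjoint⁺ : (∀ {e} → e ∈ X → e ∉ Y) → Disjoint X Y
  disjoint⁺ f (e , e∈) with x∈p∩q⁻ _ _ e∈
  ... | e∈X , e∈Y = f e∈X e∈Y

  disjoint⁻ : Disjoint X Y → ∀ {e} → e ∈ X → e ∉ Y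
  disjoint⁻ dis e∈X e∈Y = dis (_ , x∈p∩q⁺ (e∈X , e∈Y))

  disjoint-sym : Disjoint X Y → Disjoint Y X
  disjoint-sym dis = disjoint⁺ λ e∈Y e∈X → disjoint⁻ dis e∈X e∈Y

  disjoint-⊆ : X ⊆ A → Y ⊆ B → Disjoint A B → Disjoint X Y
  disjoint-⊆ X⊆A Y⊆B dis = disjoint⁺ λ e∈X e∈Y → disjoint⁻ dis (X⊆A e∈X) (Y⊆B e∈Y)

  disjoint-∪ : Disjoint X Z → Disjoint Y Z → Disjoint (X ∪ Y) Z
  disjoint-∪ {X = X} {Y = Y} dis₁ dis₂ = disjoint⁺ λ e∈ e∈Z → case x∈p∪q⁻ X Y e∈ of λ where
    (inj₁ e∈X) → disjoint⁻ dis₁ e∈X e∈Z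
    (inj₂ e∈Y) → disjoint⁻ dis₂ e∈Y e∈Z

  noncrossing-sym : Noncrossing X Y → Noncrossing Y X
  noncrossing-sym (inj₁ dis)        = inj₁ (disjoint-sym dis)
  noncrossing-sym (inj₂ (inj₁ X⊆Y)) = inj₂ (inj₂ X⊆Y)
  noncrossing-sym (inj₂ (inj₂ Y⊆X)) = inj₂ (inj₁ Y⊆X)

x∈p─q⁻ : ∀ {n} (p q : Subset n) {x} → x ∈ p ─ q → x ∈ p × x ∉ q
x∈p─q⁻ (inside  ∷ p) (outside ∷ q) here       = here , λ ()
x∈p─q⁻ (s       ∷ p) (inside  ∷ q) (there x∈) with x∈p─q⁻ p q x∈
... | x∈p , x∉q = there x∈p , λ { (there x∈q) → x∉q x∈q }
x∈p─q⁻ (s       ∷ p) (outside ∷ q) (there x∈) with x∈p─q⁻ p q x∈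
... | x∈p , x∉q = there x∈p , λ { (there x∈q) → x∉q x∈q }

∣p∪q∣≡∣p∣+∣q∣ : ∀ {n} (p q : Subset n) → Disjoint p q → ∣ p ∪ q ∣ ≡ ∣ p ∣ + ∣ q ∣
∣p∪q∣≡∣p∣+∣q∣ []            []            dis = refl
∣p∪q∣≡∣p∣+∣q∣ (inside  ∷ p) (inside  ∷ q) dis = ⊥-elim (dis (_ , here))
∣p∪q∣≡∣p∣+∣q∣ (inside  ∷ p) (outside ∷ q) dis =
  cong suc (∣p∪q∣≡∣p∣+∣q∣ p q (drop-∷-Empty dis))
∣p∪q∣≡∣p∣+∣q∣ (outside ∷ p) (inside  ∷ q) dis =
  trans (cong suc (∣p∪q∣≡∣p∣+∣q∣ p q (drop-∷-Empty dis))) (sym (+-suc ∣ p ∣ ∣ q ∣))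
∣p∪q∣≡∣p∣+∣q∣ (outside ∷ p) (outside ∷ q) dis = ∣p∪q∣≡∣p∣+∣q∣ p q (drop-∷-Empty dis)

module _ {n : ℕ} where

  private variable
    A B C D X Y : Subset n
    𝒜 ℬ 𝒞 𝒟 : Family n

  ⁅_⁆⊆ : ∀ {e} → e ∈ X → ⁅ e ⁆ ⊆ X
  ⁅_⁆⊆ {X = X} {e} e∈X x∈ = subst (_∈ X) (sym (x∈⁅y⁆⇒x≡y e x∈)) e∈X

  nonempty⇒1≤∣∣ : Nonempty X → 1 ≤ ∣ X ∣
  nonempty⇒1≤∣∣ (e , e∈X) = subst (_≤ _) (∣⁅x⁆∣≡1 e) (p⊆q⇒∣p∣≤∣q∣ ⁅ e∈X ⁆⊆)

  ⊆∧∣≥∣⇒⊇ : X ⊆ Y → ∣ Y ∣ ≤ ∣ X ∣ → Y ⊆ X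
  ⊆∧∣≥∣⇒⊇ {X} {Y} X⊆Y ∣Y∣≤∣X∣ {e} e∈Y with e ∈? X
  ... | yes e∈X = e∈X
  ... | no  e∉X = ⊥-elim (≤⇒≯ ∣Y∣≤∣X∣ (p⊂q⇒∣p∣<∣q∣ (X⊆Y , e , e∈Y , e∉X)))

  ⊆-size-1 : ∣ C ∣ ≡ 1 → Nonempty X → X ⊆ C → X ≡ C
  ⊆-size-1 ∣C∣≡1 X≢∅ X⊆C =
    ⊆-antisym X⊆C (⊆∧∣≥∣⇒⊇ X⊆C (subst (_≤ _) (sym ∣C∣≡1) (nonempty⇒1≤∣∣ X≢∅)))

  ∪-─ : X ⊆ Y → X ∪ (Y ─ X) ≡ Y
  ∪-─ {X} {Y} X⊆Y = ⊆-antisym to from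
    where
    to : X ∪ (Y ─ X) ⊆ Y
    to e∈ with x∈p∪q⁻ X (Y ─ X) e∈
    ... | inj₁ e∈X = X⊆Y e∈X
    ... | inj₂ e∈  = p─q⊆p Y X e∈
    from : Y ⊆ X ∪ (Y ─ X)
    from {e} e∈Y with e ∈? X
    ... | yes e∈X = x∈p∪q⁺ (inj₁ e∈X)
    ... | no  e∉X = x∈p∪q⁺ (inj₂ (x∈p∧x∉q⇒x∈p─q e∈Y e∉X))

  disjoint-─ : Disjoint X (Y ─ X)
  disjoint-─ {X} {Y} = disjoint⁺ λ e∈X e∈ → proj₂ (x∈p─q⁻ Y X e∈) e∈X

  ∪-─-cancel : Disjoint X Y → (X ∪ Y) ─ X ≡ Y
  ∪-─-cancel {X} {Y} dis = ⊆-antisym to from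
    where
    to : (X ∪ Y) ─ X ⊆ Y
    to e∈ with x∈p─q⁻ (X ∪ Y) X e∈
    ... | e∈∪ , e∉X with x∈p∪q⁻ X Y e∈∪
    ...   | inj₁ e∈X = ⊥-elim (e∉X e∈X)
    ...   | inj₂ e∈Y = e∈Y
    from : Y ⊆ (X ∪ Y) ─ X
    from e∈Y = x∈p∧x∉q⇒x∈p─q (q⊆p∪q X Y e∈Y) (λ e∈X → disjoint⁻ dis e∈X e∈Y)

  module BD {C : Subset n} {𝒞 : Family n} (bd : BranchDecomposition C 𝒞) where
    open BranchDecomposition bd public
    open NoncrossingFamily noncrossingFamily public

    -- Maximality in the form in which it is used: `X ∷ 𝒞` is still a noncrossing family, so it
    -- lists nothing outside `𝒞`.
    mem⁺ : Nonempty X → X ⊆ C → (∀ D → D ∈ˡ 𝒞 → Noncrossing X D) → X ∈ˡ 𝒞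
    mem⁺ {X} X≢∅ X⊆C nc = maximal (X ∷ 𝒞) fam there (here refl)
      where
      fam : NoncrossingFamily C (X ∷ 𝒞)
      fam .NoncrossingFamily.nonempty _ (here refl) = X≢∅
      fam .NoncrossingFamily.nonempty D (there D∈)  = nonempty D D∈
      fam .NoncrossingFamily.within _ (here refl) = X⊆C
      fam .NoncrossingFamily.within D (there D∈)  = within D D∈
      fam .NoncrossingFamily.noncrossing _ _ (here refl) (here refl) = inj₂ (inj₁ id)
      fam .NoncrossingFamily.noncrossing _ D (here refl) (there D∈)  = nc D D∈
      fam .NoncrossingFamily.noncrossing D _ (there D∈)  (here refl) = noncrossing-sym (nc D D∈)
      fam .NoncrossingFamily.noncrossing D E (there D∈)  (there E∈)  = noncrossing D E D∈ E∈

    root∈ : C ∈ˡ 𝒞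
    root∈ = mem⁺ root-nonempty id λ D D∈ → inj₂ (inj₂ (within D D∈))

    singleton∈ : ∀ {e} → e ∈ C → ⁅ e ⁆ ∈ˡ 𝒞
    singleton∈ {e} e∈C = mem⁺ (e , x∈⁅x⁆ e) ⁅ e∈C ⁆⊆ nc
      where
      nc : ∀ D → D ∈ˡ 𝒞 → Noncrossing ⁅ e ⁆ D
      nc D _ with e ∈? D
      ... | yes e∈D = inj₂ (inj₁ ⁅ e∈D ⁆⊆)
      ... | no  e∉D = inj₁ (disjoint⁺ λ x∈ x∈D → e∉D (subst (_∈ D) (x∈⁅y⁆⇒x≡y e x∈) x∈D))

    ∈-restrict⁻ : D ∈ˡ restrict X 𝒞 → D ∈ˡ 𝒞 × D ⊆ X
    ∈-restrict⁻ {X = X} = ∈-filter⁻ (_⊆? X) {xs = 𝒞}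

    restrict-bd : X ∈ˡ 𝒞 → BranchDecomposition X (restrict X 𝒞)
    restrict-bd {X} X∈ = record
      { root-nonempty     = nonempty X X∈
      ; noncrossingFamily = record
        { nonempty    = λ D D∈ → nonempty D (proj₁ (∈-restrict⁻ D∈))
        ; within      = λ D D∈ → proj₂ (∈-restrict⁻ D∈)
        ; noncrossing = λ D E D∈ E∈ →
            noncrossing D E (proj₁ (∈-restrict⁻ D∈)) (proj₁ (∈-restrict⁻ E∈))
        }
      ; maximal           = restrict-maximal
      }
      where
      restrict-maximal : ∀ 𝒟 → NoncrossingFamily X 𝒟 → restrict X 𝒞 ⊆ˡ 𝒟 → 𝒟 ⊆ˡ restrict X 𝒞
      restrict-maximal 𝒟 fam 𝒞⊆𝒟 {D} D∈ =
        ∈-filter⁺ (_⊆? X) (mem⁺ (𝒟.nonempty D D∈) (within X X∈ ∘ D⊆X) nc) D⊆X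
        where
        module 𝒟 = NoncrossingFamily fam
        D⊆X : D ⊆ X
        D⊆X = 𝒟.within D D∈
        nc : ∀ E → E ∈ˡ 𝒞 → Noncrossing D E
        -- A cluster that is not inside `X` is disjoint from `X` or contains it, hence cannot cross
        -- `D`; the clusters inside `X` belong to `𝒟`.
        nc E E∈ with noncrossing E X E∈ X∈
        ... | inj₁ dis        = inj₁ (disjoint-⊆ D⊆X id (disjoint-sym dis))
        ... | inj₂ (inj₁ E⊆X) = 𝒟.noncrossing D E D∈ (𝒞⊆𝒟 (∈-filter⁺ (_⊆? X) E∈ E⊆X))
        ... | inj₂ (inj₂ X⊆E) = inj₂ (inj₁ (X⊆E ∘ D⊆X))

    -- Y covers X in the inclusion order of 𝒞, so the difference is the sibling of X.
    difference∈ : X ∈ˡ 𝒞 → Y ∈ˡ 𝒞 → X ⊂ Y →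
                  (∀ D → D ∈ˡ 𝒞 → X ⊆ D → D ⊆ Y → D ≡ X ⊎ D ≡ Y) → (Y ─ X) ∈ˡ 𝒞
    difference∈ {X} {Y} X∈ Y∈ (X⊆Y , e , e∈Y , e∉X) cover =
      mem⁺ (e , x∈p∧x∉q⇒x∈p─q e∈Y e∉X) (within Y Y∈ ∘ p─q⊆p Y X) nc
      where
      nc : ∀ D → D ∈ˡ 𝒞 → Noncrossing (Y ─ X) D
      nc D D∈ with noncrossing D X D∈ X∈ | noncrossing D Y D∈ Y∈
      ... | inj₂ (inj₁ D⊆X) | _ = inj₁ (disjoint-sym (disjoint-⊆ D⊆X id disjoint-─))
      ... | _ | inj₁ dis = inj₁ (disjoint-sym (disjoint-⊆ id (p─q⊆p Y X) dis))
      ... | _ | inj₂ (inj₂ Y⊆D) = inj₂ (inj₁ (Y⊆D ∘ p─q⊆p Y X))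
      ... | inj₁ dis | inj₂ (inj₁ D⊆Y) =
        inj₂ (inj₂ λ e∈D → x∈p∧x∉q⇒x∈p─q (D⊆Y e∈D) (disjoint⁻ dis e∈D))
      ... | inj₂ (inj₂ X⊆D) | inj₂ (inj₁ D⊆Y) with cover D D∈ X⊆D D⊆Y
      ...   | inj₁ refl = inj₁ (disjoint-sym disjoint-─)
      ...   | inj₂ refl = inj₂ (inj₁ (p─q⊆p Y X))

  noncrossing-halves : Noncrossing D A → Noncrossing D B → D ⊆ A ∪ B →
                       D ⊆ A ⊎ D ⊆ B ⊎ D ≡ A ∪ B
  noncrossing-halves {A = A} {B = B} (inj₁ dis) _ D⊆ =
    inj₂ (inj₁ λ e∈D → case x∈p∪q⁻ A B (D⊆ e∈D) of λ where
      (inj₁ e∈A) → ⊥-elim (disjoint⁻ dis e∈D e∈A)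
      (inj₂ e∈B) → e∈B)
  noncrossing-halves (inj₂ (inj₁ D⊆A)) _ _ = inj₁ D⊆A
  noncrossing-halves {A = A} {B = B} (inj₂ (inj₂ A⊆D)) (inj₁ dis) D⊆ =
    inj₁ λ e∈D → case x∈p∪q⁻ A B (D⊆ e∈D) of λ where
      (inj₁ e∈A) → e∈A
      (inj₂ e∈B) → ⊥-elim (disjoint⁻ dis e∈D e∈B)
  noncrossing-halves (inj₂ (inj₂ A⊆D)) (inj₂ (inj₁ D⊆B)) _ = inj₂ (inj₁ D⊆B)
  noncrossing-halves {A = A} {B = B} (inj₂ (inj₂ A⊆D)) (inj₂ (inj₂ B⊆D)) D⊆ =
    inj₂ (inj₂ (⊆-antisym D⊆ λ e∈ → case x∈p∪q⁻ A B e∈ of λ where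
      (inj₁ e∈A) → A⊆D e∈A
      (inj₂ e∈B) → B⊆D e∈B))

  -- For maximality: a larger noncrossing family contains both roots, so each of its members is the
  -- whole set or lies in one half, where the maximality of that half applies.
  join-bd : BranchDecomposition A 𝒜 → BranchDecomposition B ℬ → Disjoint A B →
            BranchDecomposition (A ∪ B) (𝒜 ++ (A ∪ B) ∷ ℬ)
  join-bd {A} {𝒜} {B} {ℬ} bdA bdB dis = record
    { root-nonempty     = proj₁ A.root-nonempty , p⊆p∪q B (proj₂ A.root-nonempty)
    ; noncrossingFamily = record { nonempty = nonempty ; within = within ; noncrossing = noncrossing }
    ; maximal           = maximal
    }
    where
    module A = BD bdA
    module B = BD bdB
    nonempty : ∀ D → D ∈ˡ 𝒜 ++ (A ∪ B) ∷ ℬ → Nonempty D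
    nonempty D D∈ with ∈-split 𝒜 D∈
    ... | inj₁ D∈𝒜         = A.nonempty D D∈𝒜
    ... | inj₂ (inj₁ refl) = proj₁ A.root-nonempty , p⊆p∪q B (proj₂ A.root-nonempty)
    ... | inj₂ (inj₂ D∈ℬ)  = B.nonempty D D∈ℬ
    within : ∀ D → D ∈ˡ 𝒜 ++ (A ∪ B) ∷ ℬ → D ⊆ A ∪ B
    within D D∈ with ∈-split 𝒜 D∈
    ... | inj₁ D∈𝒜         = p⊆p∪q B ∘ A.within D D∈𝒜
    ... | inj₂ (inj₁ refl) = id
    ... | inj₂ (inj₂ D∈ℬ)  = q⊆p∪q A B ∘ B.within D D∈ℬ
    noncrossing : ∀ D E → D ∈ˡ 𝒜 ++ (A ∪ B) ∷ ℬ → E ∈ˡ 𝒜 ++ (A ∪ B) ∷ ℬ → Noncrossing D E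
    noncrossing D E D∈ E∈ with ∈-split 𝒜 D∈ | ∈-split 𝒜 E∈
    ... | inj₂ (inj₁ refl) | _                = inj₂ (inj₂ (within E E∈))
    ... | _                | inj₂ (inj₁ refl) = inj₂ (inj₁ (within D D∈))
    ... | inj₁ D∈𝒜         | inj₁ E∈𝒜         = A.noncrossing D E D∈𝒜 E∈𝒜
    ... | inj₂ (inj₂ D∈ℬ)  | inj₂ (inj₂ E∈ℬ)  = B.noncrossing D E D∈ℬ E∈ℬ
    ... | inj₁ D∈𝒜         | inj₂ (inj₂ E∈ℬ)  =
      inj₁ (disjoint-⊆ (A.within D D∈𝒜) (B.within E E∈ℬ) dis)
    ... | inj₂ (inj₂ D∈ℬ)  | inj₁ E∈𝒜         =
      inj₁ (disjoint-⊆ (B.within D D∈ℬ) (A.within E E∈𝒜) (disjoint-sym dis))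
    maximal : ∀ 𝒟 → NoncrossingFamily (A ∪ B) 𝒟 → 𝒜 ++ (A ∪ B) ∷ ℬ ⊆ˡ 𝒟 → 𝒟 ⊆ˡ 𝒜 ++ (A ∪ B) ∷ ℬ
    maximal 𝒟 fam 𝒜ℬ⊆𝒟 {D} D∈ =
      case noncrossing-halves (nc _ (∈-++⁺ˡ A.root∈)) (nc _ (∈-++⁺ʳ 𝒜 (there B.root∈))) (𝒟.within D D∈) of λ where
        (inj₁ D⊆A)         → ∈-++⁺ˡ (A.mem⁺ (𝒟.nonempty D D∈) D⊆A λ E E∈ → nc E (∈-++⁺ˡ E∈))
        (inj₂ (inj₁ D⊆B))  →
          ∈-++⁺ʳ 𝒜 (there (B.mem⁺ (𝒟.nonempty D D∈) D⊆B λ E E∈ → nc E (∈-++⁺ʳ 𝒜 (there E∈))))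
        (inj₂ (inj₂ refl)) → ∈-++⁺ʳ 𝒜 (here refl)
      where
      module 𝒟 = NoncrossingFamily fam
      nc : ∀ E → E ∈ˡ 𝒜 ++ (A ∪ B) ∷ ℬ → Noncrossing D E
      nc E E∈ = 𝒟.noncrossing D E D∈ (𝒜ℬ⊆𝒟 E∈)

  size-1-or-proper : Nonempty C → ∣ C ∣ ≡ 1 ⊎ (∃[ e ] (e ∈ C × ⁅ e ⁆ ⊂ C))
  size-1-or-proper {C} (e , e∈C) with ⁅ e ⁆ ⊂? C
  ... | yes e⊂C = inj₂ (e , e∈C , e⊂C)
  ... | no  e⊄C = inj₁ (trans (cong ∣_∣ (⊆-antisym C⊆e ⁅ e∈C ⁆⊆)) (∣⁅x⁆∣≡1 e))
    where
    C⊆e : C ⊆ ⁅ e ⁆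
    C⊆e {x} x∈C with x ∈? ⁅ e ⁆
    ... | yes x∈ = x∈
    ... | no  x∉ = ⊥-elim (e⊄C (⁅ e∈C ⁆⊆ , x , x∈C , x∉))

  ⊆⇒≡⊎⊂ : X ⊆ Y → X ≡ Y ⊎ X ⊂ Y
  ⊆⇒≡⊎⊂ {X} {Y} X⊆Y with X ⊂? Y
  ... | yes X⊂Y = inj₂ X⊂Y
  ... | no  X⊄Y = inj₁ (⊆-antisym X⊆Y λ {x} x∈Y → case x ∈? X of λ where
    (yes x∈X) → x∈X
    (no  x∉X) → ⊥-elim (X⊄Y (X⊆Y , x , x∈Y , x∉X)))

  record Bisection (C : Subset n) (𝒞 : Family n) : Set where
    field
      {left right} : Subset n
      left∈    : left ∈ˡ 𝒞
      right∈   : right ∈ˡ 𝒞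
      disjoint : Disjoint left right
      cover    : left ∪ right ≡ C
      cases    : ∀ D → D ∈ˡ 𝒞 → D ⊆ left ⊎ D ⊆ right ⊎ D ≡ C

  -- No cluster lies strictly between a largest proper cluster and `C`, so the complement of that
  -- cluster in `C` is a cluster too. The singleton `⁅ e ⁆` only makes sure that the maximum is
  -- taken over a nonempty list.
  bisect : BranchDecomposition C 𝒞 → ∣ C ∣ ≢ 1 → Bisection C 𝒞
  bisect {C} {𝒞} bd ∣C∣≢1 with size-1-or-proper (BranchDecomposition.root-nonempty bd)
  ... | inj₁ ∣C∣≡1 = ⊥-elim (∣C∣≢1 ∣C∣≡1)
  ... | inj₂ (e , e∈C , e⊂C) with largest ∣_∣ ⁅ e ⁆ (filter (_⊂? C) 𝒞)
  ...   | A , A∈′ , A-max = record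
    { left∈ = A∈ ; right∈ = B∈ ; disjoint = disjoint-─ ; cover = ∪-─ (proj₁ A⊂C) ; cases = cases }
    where
    open BD bd
    A-proper : A ∈ˡ 𝒞 × A ⊂ C
    A-proper = case A∈′ of λ where
      (here refl) → singleton∈ e∈C , e⊂C
      (there A∈″) → ∈-filter⁻ (_⊂? C) {xs = 𝒞} A∈″
    A∈ = proj₁ A-proper
    A⊂C = proj₂ A-proper
    cover : ∀ D → D ∈ˡ 𝒞 → A ⊆ D → D ⊆ C → D ≡ A ⊎ D ≡ C
    cover D D∈ A⊆D D⊆C with ⊆⇒≡⊎⊂ D⊆C
    ... | inj₁ D≡C = inj₂ D≡C
    ... | inj₂ D⊂C =
      inj₁ (⊆-antisym (⊆∧∣≥∣⇒⊇ A⊆D (A-max D (there (∈-filter⁺ (_⊂? C) D∈ D⊂C)))) A⊆D)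
    B∈ : (C ─ A) ∈ˡ 𝒞
    B∈ = difference∈ A∈ root∈ A⊂C cover
    cases : ∀ D → D ∈ˡ 𝒞 → D ⊆ A ⊎ D ⊆ C ─ A ⊎ D ≡ C
    cases D D∈ with noncrossing-halves (noncrossing D A D∈ A∈) (noncrossing D _ D∈ B∈)
                      (λ x∈ → subst (_ ∈_) (sym (∪-─ (proj₁ A⊂C))) (within D D∈ x∈))
    ... | inj₁ D⊆A          = inj₁ D⊆A
    ... | inj₂ (inj₁ D⊆B)   = inj₂ (inj₁ D⊆B)
    ... | inj₂ (inj₂ D≡A∪B) = inj₂ (inj₂ (trans D≡A∪B (∪-─ (proj₁ A⊂C))))

  ∼⁺ : 𝒜 ⊆ˡ ℬ → ℬ ⊆ˡ 𝒜 → 𝒜 ∼[ set ] ℬ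
  ∼⁺ to from = mk⇔ to from

  -- Provides an input for the program, whose run will witness that `Balance` has an output.
  tree-of-acc : BranchDecomposition C 𝒞 → Acc _<_ ∣ C ∣ → ∃[ t ] (rootCluster t ≡ C × t Represents 𝒞)
  tree-of-acc {C} {𝒞} bd (acc rec) with ∣ C ∣ ≟ 1
  ... | yes ∣C∣≡1 = leaf e , e≡C , tt ,
        ∼⁺ (λ { (here refl) → subst (_∈ˡ 𝒞) (sym e≡C) root∈ ; (there ()) })
           (λ {D} D∈ → here (trans (⊆-size-1 ∣C∣≡1 (nonempty D D∈) (within D D∈)) (sym e≡C)))
    where
    open BD bd
    e = proj₁ root-nonempty
    e≡C : ⁅ e ⁆ ≡ C
    e≡C = ⊆-size-1 ∣C∣≡1 (e , x∈⁅x⁆ e) ⁅ proj₂ root-nonempty ⁆⊆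
  ... | no ∣C∣≢1 with bisect bd ∣C∣≢1
  ...   | record { left = A ; right = B ; left∈ = A∈ ; right∈ = B∈ ; disjoint = dis ; cover = refl ; cases = cases }
        with tree-of-acc (BD.restrict-bd bd A∈) (rec ∣A∣<) | tree-of-acc (BD.restrict-bd bd B∈) (rec ∣B∣<)
        where
        open BD bd
        ∣A∪B∣ = ∣p∪q∣≡∣p∣+∣q∣ A B dis
        ∣A∣< : ∣ A ∣ < ∣ A ∪ B ∣
        ∣A∣< = subst (∣ A ∣ <_) (sym ∣A∪B∣) (m<m+n ∣ A ∣ (nonempty⇒1≤∣∣ (nonempty B B∈)))
        ∣B∣< : ∣ B ∣ < ∣ A ∪ B ∣
        ∣B∣< = subst (∣ B ∣ <_) (sym ∣A∪B∣) (m<n+m ∣ B ∣ (nonempty⇒1≤∣∣ (nonempty A A∈)))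
  ...     | l , refl , dl , l∼ | r , refl , dr , r∼ = node l r , refl , (dis , dl , dr) , ∼⁺ to from
    where
    open BD bd using (root∈)
    to : treeClusters (node l r) ⊆ˡ 𝒞
    to (here refl) = root∈
    to (there D∈) with ∈-++⁻ (treeClusters l) D∈
    ... | inj₁ D∈l = proj₁ (∈-filter⁻ (_⊆? _) {xs = 𝒞} (Equivalence.to l∼ D∈l))
    ... | inj₂ D∈r = proj₁ (∈-filter⁻ (_⊆? _) {xs = 𝒞} (Equivalence.to r∼ D∈r))
    from : 𝒞 ⊆ˡ treeClusters (node l r)
    from {D} D∈ with cases D D∈
    ... | inj₁ D⊆A         = there (∈-++⁺ˡ (Equivalence.from l∼ (∈-filter⁺ (_⊆? _) D∈ D⊆A)))
    ... | inj₂ (inj₁ D⊆B)  =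
      there (∈-++⁺ʳ (treeClusters l) (Equivalence.from r∼ (∈-filter⁺ (_⊆? _) D∈ D⊆B)))
    ... | inj₂ (inj₂ refl) = here refl

  tree-of : BranchDecomposition C 𝒞 → ∃[ t ] (rootCluster t ≡ C × t Represents 𝒞)
  tree-of bd = tree-of-acc bd (<-wellFounded _)

-- The clusters created by Complete

AllPairs-++⁻ : ∀ {a ℓ} {V : Set a} {R : V → V → Set ℓ} xs {ys} → AllPairs R (xs ++ ys) →
               AllPairs R xs × AllPairs R ys × All (λ x → All (R x) ys) xs
AllPairs-++⁻ []       prs        = [] , prs , []
AllPairs-++⁻ (x ∷ xs) (pr ∷ prs) with AllPairs-++⁻ xs prs
... | prs₁ , prs₂ , cross = All.++⁻ˡ xs pr ∷ prs₁ , prs₂ , All.++⁻ʳ xs pr ∷ cross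

-- Tells on which side of the split index a marked input lies; these are the cases of `Depth`.
split-trichotomy : ∀ {a} {V : Set a} (as ls : List V) {x y bs rs} → as ++ x ∷ bs ≡ ls ++ y ∷ rs →
                   (∃[ bs′ ] (ls ≡ as ++ x ∷ bs′ × bs ≡ bs′ ++ y ∷ rs)) ⊎
                   (as ≡ ls × x ≡ y × bs ≡ rs) ⊎
                   (∃[ as′ ] (as ≡ ls ++ y ∷ as′ × rs ≡ as′ ++ x ∷ bs))
split-trichotomy []       []       refl = inj₂ (inj₁ (refl , refl , refl))
split-trichotomy []       (_ ∷ ls) refl = inj₁ (ls , refl , refl)
split-trichotomy (_ ∷ as) []       refl = inj₂ (inj₂ (as , refl , refl))
split-trichotomy (a ∷ as) (l ∷ ls) eq with ∷-injective eq
... | refl , eq′ with split-trichotomy as ls eq′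
...   | inj₁ (bs′ , refl , refl)        = inj₁ (bs′ , refl , refl)
...   | inj₂ (inj₁ (refl , refl , refl)) = inj₂ (inj₁ (refl , refl , refl))
...   | inj₂ (inj₂ (as′ , refl , refl)) = inj₂ (inj₂ (as′ , refl , refl))

module _ {n : ℕ} where

  private variable
    A B C D X Y Z : Subset n
    𝒜 ℬ 𝒞 : Family n
    xs ys ls rs : List (Rooted n)

  ⋃-++ : ∀ (Xs : List (Subset n)) {Ys} → ⋃ (Xs ++ Ys) ≡ ⋃ Xs ∪ ⋃ Ys
  ⋃-++ []       = sym (∪-identityˡ _)
  ⋃-++ (X ∷ Xs) = trans (cong (X ∪_) (⋃-++ Xs)) (sym (∪-assoc X (⋃ Xs) _))

  unionOfRoots-++ : ∀ (xs : List (Rooted n)) {ys} →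
                    unionOfRoots (xs ++ ys) ≡ unionOfRoots xs ∪ unionOfRoots ys
  unionOfRoots-++ xs {ys} = trans (cong ⋃ (map-++ root xs ys)) (⋃-++ (map root xs))

  unionOfRoots-∷ʳ : ∀ (xs : List (Rooted n)) x → unionOfRoots (xs ∷ʳ x) ≡ unionOfRoots xs ∪ root x
  unionOfRoots-∷ʳ xs x = trans (unionOfRoots-++ xs) (cong (unionOfRoots xs ∪_) (∪-identityʳ (root x)))

  unionOfRoots-split : ∀ (ls : List (Rooted n)) x rs →
                       unionOfRoots (ls ++ x ∷ rs) ≡ unionOfRoots (ls ∷ʳ x) ∪ unionOfRoots rs
  unionOfRoots-split ls x rs =
    trans (cong unionOfRoots (sym (++-assoc ls (x ∷ []) rs))) (unionOfRoots-++ (ls ∷ʳ x))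

  ∈-⋃⁻ : ∀ {e} (Xs : List (Subset n)) → e ∈ ⋃ Xs → ∃[ X ] (X ∈ˡ Xs × e ∈ X)
  ∈-⋃⁻ []       e∈ = ⊥-elim (∉⊥ e∈)
  ∈-⋃⁻ (X ∷ Xs) e∈ with x∈p∪q⁻ X (⋃ Xs) e∈
  ... | inj₁ e∈X = X , here refl , e∈X
  ... | inj₂ e∈⋃ with ∈-⋃⁻ Xs e∈⋃
  ...   | Y , Y∈ , e∈Y = Y , there Y∈ , e∈Y

  ∈-unionOfRoots⁻ : ∀ {e} (xs : List (Rooted n)) → e ∈ unionOfRoots xs → ∃[ x ] (x ∈ˡ xs × e ∈ root x)
  ∈-unionOfRoots⁻ xs e∈ with ∈-⋃⁻ (map root xs) e∈
  ... | X , X∈ , e∈X with ∈-map⁻ root X∈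
  ...   | x , x∈ , refl = x , x∈ , e∈X

  disjoint-⋃ : All (Disjoint X) 𝒞 → Disjoint X (⋃ 𝒞)
  disjoint-⋃ {𝒞 = 𝒞} dis = disjoint⁺ λ e∈X e∈⋃ → case ∈-⋃⁻ 𝒞 e∈⋃ of λ where
    (Y , Y∈ , e∈Y) → disjoint⁻ (All.lookup dis Y∈) e∈X e∈Y

  DisjointRoots : Rooted n → Rooted n → Set
  DisjointRoots x y = Disjoint (root x) (root y)

  IsBD : Rooted n → Set
  IsBD x = BranchDecomposition (root x) (family x)

  disjoint-unionOfRoots : All (λ y → Disjoint X (root y)) ys → Disjoint X (unionOfRoots ys)
  disjoint-unionOfRoots dis = disjoint-⋃ (All.map⁺ dis)

  disjoint-unionsOfRoots : All (λ x → All (DisjointRoots x) ys) xs →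
                           Disjoint (unionOfRoots xs) (unionOfRoots ys)
  disjoint-unionsOfRoots dis =
    disjoint-sym (disjoint-unionOfRoots (All.map (λ d → disjoint-sym (disjoint-unionOfRoots d)) dis))

  size-unionOfRoots : AllPairs DisjointRoots xs → ∣ unionOfRoots xs ∣ ≡ sum (map size xs)
  size-unionOfRoots []                           = ∣⊥∣≡0 n
  size-unionOfRoots {xs = x ∷ xs} (dis ∷ disj) =
    trans (∣p∪q∣≡∣p∣+∣q∣ (root x) (unionOfRoots xs) (disjoint-unionOfRoots dis))
          (cong (size x +_) (size-unionOfRoots disj))

  mutual
    complete-bd : Complete xs 𝒞 → All IsBD xs → AllPairs DisjointRoots xs →
                  BranchDecomposition (unionOfRoots xs) 𝒞
    complete-bd (complete {ls = ls} {x} {rs} refl _ up after) bds disj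
      with AllPairs-++⁻ ls disj | All.++⁻ˡ ls bds | All.++⁻ʳ ls bds
    ... | disjˡ , disˣ ∷ disjʳ , cross | bdˡ | bdˣ ∷ bdʳ =
      afterSplit-bd after (upToSplit-bd up bdˡ bdˣ disjˡ (All.map All.head cross)) bdʳ disjʳ
        (subst (λ Z → Disjoint Z (unionOfRoots rs)) (sym (unionOfRoots-∷ʳ ls x))
          (disjoint-∪ (disjoint-unionsOfRoots (All.map All.tail cross)) (disjoint-unionOfRoots disˣ)))
        (unionOfRoots-split ls x rs)

    upToSplit-bd : ∀ {x} → UpToSplit ls x ℬ → All IsBD ls → IsBD x → AllPairs DisjointRoots ls →
                   All (λ l → DisjointRoots l x) ls → BranchDecomposition (unionOfRoots (ls ∷ʳ x)) ℬ
    upToSplit-bd j≡1 _ bdˣ _ _ = subst (λ Z → BranchDecomposition Z _) (sym (∪-identityʳ _)) bdˣ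
    upToSplit-bd {ls = ls} {x = x} (j>1 {𝒜 = 𝒜} c) bdˡ bdˣ disj dis =
      subst (λ Z → BranchDecomposition Z (𝒜 ++ Z ∷ family x)) (sym (unionOfRoots-∷ʳ ls x))
        (join-bd (complete-bd c bdˡ disj) bdˣ (disjoint-sym (disjoint-unionOfRoots (All.map disjoint-sym dis))))

    afterSplit-bd : AfterSplit C ℬ rs 𝒞 → BranchDecomposition B ℬ → All IsBD rs →
                    AllPairs DisjointRoots rs → Disjoint B (unionOfRoots rs) →
                    C ≡ B ∪ unionOfRoots rs → BranchDecomposition C 𝒞
    afterSplit-bd j≡k bdᴮ _ _ _ refl =
      subst (λ Z → BranchDecomposition Z _) (sym (∪-identityʳ _)) bdᴮ
    afterSplit-bd (j<k c) bdᴮ bdʳ disj dis refl = join-bd bdᴮ (complete-bd c bdʳ disj) dis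

  Interval : List (Rooted n) → Subset n → Set
  Interval xs D = ∃[ as ] ∃[ bs ] ∃[ cs ] (xs ≡ as ++ bs ++ cs × D ≡ unionOfRoots bs)

  FromInputs : List (Rooted n) → Subset n → Set
  FromInputs xs D = (∃[ x ] (x ∈ˡ xs × D ∈ˡ family x)) ⊎ Interval xs D

  fromInputs-++ˡ : FromInputs ls D → FromInputs (ls ++ rs) D
  fromInputs-++ˡ (inj₁ (x , x∈ , D∈)) = inj₁ (x , ∈-++⁺ˡ x∈ , D∈)
  fromInputs-++ˡ {rs = rs} (inj₂ (as , bs , cs , refl , D≡)) =
    inj₂ (as , bs , cs ++ rs ,
          trans (++-assoc as (bs ++ cs) rs) (cong (as ++_) (++-assoc bs cs rs)) , D≡)

  fromInputs-++ʳ : ∀ ls → FromInputs rs D → FromInputs (ls ++ rs) D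
  fromInputs-++ʳ ls (inj₁ (x , x∈ , D∈)) = inj₁ (x , ∈-++⁺ʳ ls x∈ , D∈)
  fromInputs-++ʳ ls (inj₂ (as , bs , cs , refl , D≡)) =
    inj₂ (ls ++ as , bs , cs , sym (++-assoc ls as (bs ++ cs)) , D≡)

  mutual
    -- Serves two purposes: along a heavy path intervals are differences of clusters, which bounds
    -- the width, and a recursive call whose inputs all avoid an edge creates no cluster around that
    -- edge.
    complete-fromInputs : Complete xs 𝒞 → D ∈ˡ 𝒞 → FromInputs xs D
    complete-fromInputs {D = D} (complete {xs = xs} {ls} {x} {rs} refl _ up after) D∈
      with afterSplit-fromInputs after D∈
    ... | inj₁ D∈ℬ         =
      subst (λ ys → FromInputs ys D) (++-assoc ls (x ∷ []) rs) (fromInputs-++ˡ (upToSplit-fromInputs up D∈ℬ))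
    ... | inj₂ (inj₁ refl) = inj₂ ([] , xs , [] , sym (++-identityʳ xs) , refl)
    ... | inj₂ (inj₂ fr)   =
      subst (λ ys → FromInputs ys D) (++-assoc ls (x ∷ []) rs) (fromInputs-++ʳ (ls ∷ʳ x) fr)

    upToSplit-fromInputs : ∀ {x} → UpToSplit ls x ℬ → D ∈ˡ ℬ → FromInputs (ls ∷ʳ x) D
    upToSplit-fromInputs j≡1 D∈ = inj₁ (_ , here refl , D∈)
    upToSplit-fromInputs {ls = ls} {x = x} (j>1 {𝒜 = 𝒜} c) D∈ with ∈-split 𝒜 D∈
    ... | inj₁ D∈𝒜         = fromInputs-++ˡ (complete-fromInputs c D∈𝒜)
    ... | inj₂ (inj₁ refl) = inj₂ ([] , ls ∷ʳ x , [] , sym (++-identityʳ (ls ∷ʳ x)) , refl)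
    ... | inj₂ (inj₂ D∈x)  = inj₁ (x , ∈-++⁺ʳ ls (here refl) , D∈x)

    afterSplit-fromInputs : AfterSplit C ℬ rs 𝒞 → D ∈ˡ 𝒞 → D ∈ˡ ℬ ⊎ D ≡ C ⊎ FromInputs rs D
    afterSplit-fromInputs j≡k D∈ = inj₁ D∈
    afterSplit-fromInputs {ℬ = ℬ} (j<k c) D∈ with ∈-split ℬ D∈
    ... | inj₁ D∈ℬ        = inj₁ D∈ℬ
    ... | inj₂ (inj₁ D≡C) = inj₂ (inj₁ D≡C)
    ... | inj₂ (inj₂ D∈ℰ) = inj₂ (inj₂ (complete-fromInputs c D∈ℰ))

  FamilyWithin : Rooted n → Set
  FamilyWithin x = ∀ D → D ∈ˡ family x → D ⊆ root x

  fromInputs-∈ : ∀ {e} → All FamilyWithin xs → FromInputs xs D → e ∈ D → ∃[ x ] (x ∈ˡ xs × e ∈ root x)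
  fromInputs-∈ w (inj₁ (x , x∈ , D∈)) e∈D = x , x∈ , All.lookup w x∈ _ D∈ e∈D
  fromInputs-∈ w (inj₂ (as , bs , cs , refl , refl)) e∈D with ∈-unionOfRoots⁻ bs e∈D
  ... | x , x∈ , e∈x = x , ∈-++⁺ʳ as (∈-++⁺ˡ x∈) , e∈x

-- Depth in the output of Complete

-- Depth as m bs d: an input of size m, with inputs of sizes as before it and bs
-- after it, lies in at most d of the clusters created by Complete.
data Depth : List ℕ → ℕ → List ℕ → ℕ → Set where
  before  : ∀ {as m bs m₀ cs d} → 2 * sum (as ++ m ∷ bs) ≤ sum (as ++ m ∷ bs ++ m₀ ∷ cs) →
            Depth as m bs d → Depth as m (bs ++ m₀ ∷ cs) (2 + d)
  atFirst : ∀ {m cs} → Depth [] m cs 1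
  at      : ∀ {a as m cs} → Depth (a ∷ as) m cs 2
  after   : ∀ {as m₀ bs m cs d} → 2 * sum (bs ++ m ∷ cs) ≤ sum ((as ++ m₀ ∷ bs) ++ m ∷ cs) →
            Depth bs m cs d → Depth (as ++ m₀ ∷ bs) m cs (1 + d)

sum-before : ∀ as m bs → sum as + m ≤ sum (as ++ m ∷ bs)
sum-before as m bs = ≤-trans (+-monoʳ-≤ (sum as) (m≤m+n m (sum bs))) (≤-reflexive (sym (sum-++ as (m ∷ bs))))

sum-at : ∀ as m bs → m ≤ sum (as ++ m ∷ bs)
sum-at as m bs = ≤-trans (m≤n+m m (sum as)) (sum-before as m bs)

-- A Positivstellensatz certificate: L ≤ R because R − L = (B − A) + slack.
certificate : ∀ {A B L R} slack → A ≤ B → L + B + slack ≡ R + A → L ≤ R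
certificate {A} {B} {L} {R} slack A≤B eq = +-cancelʳ-≤ B L R (begin
  L + B         ≤⟨ m≤m+n (L + B) slack ⟩
  L + B + slack ≡⟨ eq ⟩
  R + A         ≤⟨ +-monoʳ-≤ R A≤B ⟩
  R + B         ∎)
  where open ≤-Reasoning

sq-mono : ∀ {x y} → x ≤ y → x * x ≤ y * y
sq-mono x≤y = *-mono-≤ x≤y x≤y

cube-mono : ∀ {x y} → x ≤ y → x * x * x ≤ y * y * y
cube-mono x≤y = *-mono-≤ (sq-mono x≤y) x≤y

halves-sq : ∀ t′ {p t} → 2 * t′ ≤ t → p ≤ 4 * (t′ * t′) → p ≤ t * t
halves-sq t′ 2t′≤t p≤ = ≤-trans p≤ (≤-trans (≤-reflexive (lem t′)) (sq-mono 2t′≤t))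
  where
  lem : ∀ t → 4 * (t * t) ≡ 2 * t * (2 * t)
  lem = solve-∀

halves-cube : ∀ t′ {p t} → 2 * t′ ≤ t → p ≤ 8 * (t′ * t′ * t′) → p ≤ t * t * t
halves-cube t′ 2t′≤t p≤ = ≤-trans p≤ (≤-trans (≤-reflexive (lem t′)) (cube-mono 2t′≤t))
  where
  lem : ∀ t → 8 * (t * t * t) ≡ 2 * t * (2 * t) * (2 * t)
  lem = solve-∀

-- A recursive call multiplies `2 ^ d` by at most 4, while the square of the total grows at least by
-- the factor 4 from the inner to the outer call. The constant 4 stands for the two clusters of the
-- innermost call.
depth-any : ∀ {as m bs d} → Depth as m bs d →
            2 ^ d * (m * m) ≤ 4 * (sum (as ++ m ∷ bs) * sum (as ++ m ∷ bs))
depth-any {as} {m} (before {bs = bs} {d = d} h dep) = begin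
  2 ^ (2 + d) * (m * m)       ≡⟨ lem (2 ^ d) (m * m) ⟩
  4 * (2 ^ d * (m * m))       ≤⟨ *-monoʳ-≤ 4 (halves-sq (sum (as ++ m ∷ bs)) h (depth-any dep)) ⟩
  _                           ∎
  where
  open ≤-Reasoning
  lem : ∀ p q → 2 * (2 * p) * q ≡ 4 * (p * q)
  lem = solve-∀
depth-any {m = m} {cs} atFirst = *-mono-≤ {2} {4} (s≤s (s≤s z≤n)) (sq-mono {m} {sum (m ∷ cs)} (sum-at [] m cs))
depth-any {as} {m} {cs} at = *-monoʳ-≤ 4 (sq-mono {m} {sum (as ++ m ∷ cs)} (sum-at as m cs))
depth-any {m = m} {cs} (after {bs = bs} {d = d} h dep) = begin
  2 ^ (1 + d) * (m * m)       ≡⟨ *-assoc 2 (2 ^ d) (m * m) ⟩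
  2 * (2 ^ d * (m * m))       ≤⟨ *-mono-≤ {2} {4} (s≤s (s≤s z≤n)) (halves-sq (sum (bs ++ m ∷ cs)) h (depth-any dep)) ⟩
  _                           ∎
  where open ≤-Reasoning

-- An input with nothing before it keeps this position in all recursive calls. It therefore ends in
-- `atFirst`, with one cluster where `at` has two, which halves the constant.
depth-first : ∀ {as m bs d} → as ≡ [] → Depth as m bs d →
              2 ^ d * (m * m) ≤ 2 * (sum (as ++ m ∷ bs) * sum (as ++ m ∷ bs))
depth-first {as} {m} as≡[] (before {bs = bs} {d = d} h dep) = begin
  2 ^ (2 + d) * (m * m)       ≡⟨ lem (2 ^ d) (m * m) ⟩
  2 * (2 * (2 ^ d * (m * m))) ≤⟨ *-monoʳ-≤ 2 (halves-sq t h
                                   (≤-trans (*-monoʳ-≤ 2 (depth-first as≡[] dep)) (≤-reflexive (lem′ (t * t))))) ⟩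
  _                           ∎
  where
  open ≤-Reasoning
  t = sum (as ++ m ∷ bs)
  lem : ∀ p q → 2 * (2 * p) * q ≡ 2 * (2 * (p * q))
  lem = solve-∀
  lem′ : ∀ p → 2 * (2 * p) ≡ 4 * p
  lem′ = solve-∀
depth-first {m = m} {cs} _ atFirst = *-monoʳ-≤ 2 (sq-mono {m} {sum (m ∷ cs)} (sum-at [] m cs))
depth-first () (after {as = []}    _ _)
depth-first () (after {as = _ ∷ _} _ _)

-- The hypothesis `m ≤ sum as` is inherited in `before` and excludes `atFirst`. In `after` the list
-- `as` is cut and the hypothesis is lost, but there only one cluster is added while the cube of the
-- total gains a factor 8, so `depth-any` is good enough: 2 * 4 = 8.
depth-heavy : ∀ {as m bs d} → m ≤ sum as → 1 ≤ m → Depth as m bs d →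
              2 ^ d * (m * m * m) ≤ sum (as ++ m ∷ bs) * sum (as ++ m ∷ bs) * sum (as ++ m ∷ bs)
depth-heavy {m = m} m≤as 1≤m (before {as = as} {bs = bs} {d = d} h dep) = halves-cube t h (begin
  2 ^ (2 + d) * (m * m * m)   ≡⟨ lem (2 ^ d) (m * m * m) ⟩
  4 * (2 ^ d * (m * m * m))   ≤⟨ *-mono-≤ {4} {8} (s≤s (s≤s (s≤s (s≤s z≤n)))) (depth-heavy m≤as 1≤m dep) ⟩
  8 * (t * t * t)             ∎)
  where
  open ≤-Reasoning
  t = sum (as ++ m ∷ bs)
  lem : ∀ p q → 2 * (2 * p) * q ≡ 4 * (p * q)
  lem = solve-∀
depth-heavy m≤0 1≤m atFirst = ⊥-elim (<⇒≱ 1≤m m≤0)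
depth-heavy {as} {m} {cs} m≤as 1≤m at =
  halves-cube m (≤-trans (≤-trans (≤-reflexive (cong (m +_) (+-identityʳ m))) (+-monoˡ-≤ m m≤as)) (sum-before as m cs))
    (*-monoˡ-≤ (m * m * m) {4} {8} (s≤s (s≤s (s≤s (s≤s z≤n)))))
depth-heavy {m = m} m≤as 1≤m (after {bs = bs} {cs = cs} {d = d} h dep) = halves-cube t h (begin
  2 ^ (1 + d) * (m * m * m)   ≡⟨ lem (2 ^ d) m ⟩
  2 * (2 ^ d * (m * m)) * m   ≤⟨ *-mono-≤ (*-monoʳ-≤ 2 (depth-any dep)) (sum-at bs m cs) ⟩
  2 * (4 * (t * t)) * t       ≡⟨ lem′ t ⟩
  8 * (t * t * t)             ∎)
  where
  open ≤-Reasoning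
  t = sum (bs ++ m ∷ cs)
  lem : ∀ p m → 2 * p * (m * m * m) ≡ 2 * (p * (m * m)) * m
  lem = solve-∀
  lem′ : ∀ t → 2 * (4 * (t * t)) * t ≡ 8 * (t * t * t)
  lem′ = solve-∀

take-length-++ : ∀ {a} {V : Set a} (xs : List V) {ys} → take (length xs) (xs ++ ys) ≡ xs
take-length-++ []       = refl
take-length-++ (x ∷ xs) = cong (x ∷_) (take-length-++ xs)

module _ {n : ℕ} where

  private variable
    C D : Subset n
    𝒜 ℬ 𝒞 𝒞′ : Family n
    xs as bs ls rs : List (Rooted n)
    x x₀ : Rooted n

  -- Minimality of the index bounds what comes before it; what comes after it is the complement of a
  -- prefix with more than half of the total.
  splitIndex-halves : ∀ as m bs → IsSplitIndex {n} (as ++ m ∷ bs) (suc (length as)) →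
                      2 * sum as ≤ sum (as ++ m ∷ bs) × 2 * sum bs ≤ sum (as ++ m ∷ bs)
  splitIndex-halves as m bs (above , least) = 2as≤ , <⇒≤ (2bs<)
    where
    2as≤ : 2 * sum as ≤ sum (as ++ m ∷ bs)
    2as≤ = ≮⇒≥ λ T<2as → 1+n≰n (least (length as)
      (subst (λ z → sum (as ++ m ∷ bs) < 2 * sum z) (sym (take-length-++ as)) T<2as))
    take-suc : take (suc (length as)) (as ++ m ∷ bs) ≡ as ++ m ∷ []
    take-suc = trans (cong₂ take (sym (trans (length-++ as) (+-comm (length as) 1))) (sym (++-assoc as (m ∷ []) bs)))
                     (take-length-++ (as ++ m ∷ []))
    sum-∷ʳ : sum (as ++ m ∷ []) ≡ sum as + m
    sum-∷ʳ = trans (sum-++ as (m ∷ [])) (cong (sum as +_) (+-identityʳ m))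
    above′ : sum as + (m + sum bs) < 2 * (sum as + m)
    above′ = subst₂ (λ y z → y < 2 * z) (sum-++ as (m ∷ bs)) (trans (cong sum take-suc) sum-∷ʳ) above
    2bs< : 2 * sum bs < sum (as ++ m ∷ bs)
    2bs< = subst (2 * sum bs <_) (sym (sum-++ as (m ∷ bs)))
      (certificate 0 above′ (lem (sum as) m (sum bs)))
      where
      lem : ∀ a m b → suc (2 * b) + 2 * (a + m) + 0 ≡ a + (m + b) + suc (a + (m + b))
      lem = solve-∀

  ∉-fromInputs : ∀ {e} → All FamilyWithin xs → All (λ y → e ∉ root y) xs → FromInputs xs D → e ∉ D
  ∉-fromInputs w e∉ fr e∈D with fromInputs-∈ w fr e∈D
  ... | y , y∈ , e∈y = All.lookup e∉ y∈ e∈y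

  afterSplit-∈ : ∀ {e} → AfterSplit C ℬ rs 𝒞 → All FamilyWithin rs → All (λ y → e ∉ root y) rs →
                 D ∈ˡ 𝒞 → e ∈ D → D ∈ˡ ℬ ⊎ D ≡ C
  afterSplit-∈ aft w e∉ D∈ e∈D with afterSplit-fromInputs aft D∈
  ... | inj₁ D∈ℬ        = inj₁ D∈ℬ
  ... | inj₂ (inj₁ D≡C) = inj₂ D≡C
  ... | inj₂ (inj₂ fr)  = ⊥-elim (∉-fromInputs w e∉ fr e∈D)

  -- The list N contains all clusters of 𝒞′ that contain e, apart from those of the input x.
  Cover : Fin n → Rooted n → Family n → Family n → Set
  Cover e x 𝒞′ N = ∀ D → D ∈ˡ 𝒞′ → e ∈ D → D ∈ˡ N ⊎ D ∈ˡ family x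

  upToSplit-cover : ∀ {e} → UpToSplit ls x ℬ → All FamilyWithin ls → All (λ y → e ∉ root y) ls →
                    ∃[ N ] (Cover e x ℬ N × ∀ {m cs} → Depth (map size ls) m cs (suc (length N)))
  upToSplit-cover j≡1 _ _ = [] , (λ D D∈ _ → inj₂ D∈) , atFirst
  upToSplit-cover {ls = ls} {x = x} (j>1 {𝒜 = 𝒜} c) w e∉ =
    unionOfRoots (ls ∷ʳ x) ∷ [] , cover , at
    where
    cover : Cover _ x (𝒜 ++ unionOfRoots (ls ∷ʳ x) ∷ family x) (unionOfRoots (ls ∷ʳ x) ∷ [])
    cover D D∈ e∈D with ∈-split 𝒜 D∈
    ... | inj₁ D∈𝒜        = ⊥-elim (∉-fromInputs w e∉ (complete-fromInputs c D∈𝒜) e∈D)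
    ... | inj₂ (inj₁ D≡)  = inj₁ (here D≡)
    ... | inj₂ (inj₂ D∈x) = inj₂ D∈x

  -- The function `f` is the lead of the listed clusters over the depth in the recursive call: `id`
  -- for a finished call of `Complete`, `suc` for the two intermediate stages, which add one cluster
  -- of their own.
  Covered : List (Rooted n) → Rooted n → List (Rooted n) → Fin n → (ℕ → ℕ) → Family n → Set
  Covered as x bs e f 𝒞 =
    ∃[ N ] ∃[ d ] (length N ≡ f d × Cover e x 𝒞 N × Depth (map size as) (size x) (map size bs) d)

  mutual
    complete-cover : ∀ {e} → Complete xs 𝒞 → xs ≡ as ++ x ∷ bs → All FamilyWithin xs →
                     All (λ y → e ∉ root y) as → All (λ y → e ∉ root y) bs → Covered as x bs e id 𝒞
    complete-cover {xs = xs} {𝒞 = 𝒞} {as = as} {x = x} {bs = bs} {e = e}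
                   (complete {ls = ls} {x₀} {rs} refl isSplit up aft) eq w e∉as e∉bs =
      case split-trichotomy as ls (sym eq) of λ where
        (inj₁ (bs′ , refl , refl)) →
          let N , d , len , cov , dep = upToSplit-covered up refl wˡ wˣ e∉as (All.++⁻ˡ bs′ e∉bs) (All.head (All.++⁻ʳ bs′ e∉bs))
          -- If nothing follows the split index, the same cluster is listed twice here; only an
          -- upper bound is needed.
          in  unionOfRoots xs ∷ N , 2 + d , cong suc len ,
              add-root (All.tail (All.++⁻ʳ bs′ e∉bs)) cov ,
              subst (λ z → Depth (map size as) (size x) z (2 + d)) (sym (map-++ size bs′ (x₀ ∷ rs)))
                (before (subst₂ (λ y z → 2 * sum y ≤ sum z) (map-++ size as (x ∷ bs′))
                          (trans (cong (_++ size x₀ ∷ map size rs) (map-++ size as (x ∷ bs′)))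
                                 (++-assoc (map size as) (size x ∷ map size bs′) (size x₀ ∷ map size rs)))
                          (proj₁ halves)) dep)
        (inj₂ (inj₁ (refl , refl , refl))) →
          let N , cov , dep = upToSplit-cover up wˡ e∉as
          in  unionOfRoots xs ∷ N , suc (length N) , refl , add-root e∉bs cov , dep
        (inj₂ (inj₂ (as′ , refl , refl))) →
          let e∉ls = All.++⁻ˡ ls e∉as
              e∉x₀ = All.head (All.++⁻ʳ ls e∉as)
              N , d , len , cov , dep = afterSplit-covered aft refl wʳ (All.tail (All.++⁻ʳ ls e∉as)) e∉bs
                -- Nothing built up to the split index contains `e`, so this level contributes its
                -- root alone.
                λ D D∈ℬ → ∉-fromInputs (All.++⁺ wˡ (wˣ ∷ [])) (All.++⁺ e∉ls (e∉x₀ ∷ [])) (upToSplit-fromInputs up D∈ℬ)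
          in  N , suc d , len , cov ,
              subst (λ z → Depth z (size x) (map size bs) (1 + d)) (sym (map-++ size ls (x₀ ∷ as′)))
                (after (subst₂ (λ y z → 2 * sum y ≤ sum z) (map-++ size as′ (x ∷ bs))
                         (trans (cong (λ z → map size ls ++ size x₀ ∷ z) (map-++ size as′ (x ∷ bs)))
                                (sym (++-assoc (map size ls) (size x₀ ∷ map size as′) (size x ∷ map size bs))))
                         (proj₂ halves)) dep)
      where
      wˡ = All.++⁻ˡ ls w
      wˣ = All.head (All.++⁻ʳ ls w)
      wʳ = All.tail (All.++⁻ʳ ls w)
      halves = splitIndex-halves (map size ls) (size x₀) (map size rs)
        (subst₂ (λ y z → IsSplitIndex {n} y (suc z)) (map-++ size ls (x₀ ∷ rs)) (sym (length-map size ls)) isSplit)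
      add-root : ∀ {N} → All (λ y → e ∉ root y) rs → Cover e x _ N → Cover e x 𝒞 (unionOfRoots xs ∷ N)
      add-root e∉rs cov D D∈ e∈D with afterSplit-∈ aft wʳ e∉rs D∈ e∈D
      ... | inj₂ D≡C = inj₁ (here D≡C)
      ... | inj₁ D∈ℬ with cov D D∈ℬ e∈D
      ...   | inj₁ D∈N = inj₁ (there D∈N)
      ...   | inj₂ D∈x = inj₂ D∈x

    upToSplit-covered : ∀ {e} → UpToSplit ls x₀ ℬ → ls ≡ as ++ x ∷ bs → All FamilyWithin ls →
                        FamilyWithin x₀ → All (λ y → e ∉ root y) as → All (λ y → e ∉ root y) bs →
                        e ∉ root x₀ → Covered as x bs e suc ℬ
    upToSplit-covered {as = []}    j≡1 ()
    upToSplit-covered {as = _ ∷ _} j≡1 ()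
    upToSplit-covered {ls = ls} {x₀ = x₀} {x = x} (j>1 {𝒜 = 𝒜} c) ls≡ wˡ wˣ e∉as e∉bs e∉x₀
      with complete-cover c ls≡ wˡ e∉as e∉bs
    ... | N , d , refl , cov , dep = unionOfRoots (ls ∷ʳ x₀) ∷ N , d , refl , cov′ , dep
      where
      cov′ : Cover _ x (𝒜 ++ unionOfRoots (ls ∷ʳ x₀) ∷ family x₀) (unionOfRoots (ls ∷ʳ x₀) ∷ N)
      cov′ D D∈ e∈D with ∈-split 𝒜 D∈
      ... | inj₂ (inj₁ D≡)   = inj₁ (here D≡)
      ... | inj₂ (inj₂ D∈x₀) = ⊥-elim (e∉x₀ (wˣ D D∈x₀ e∈D))
      ... | inj₁ D∈𝒜 with cov D D∈𝒜 e∈D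
      ...   | inj₁ D∈N = inj₁ (there D∈N)
      ...   | inj₂ D∈x = inj₂ D∈x

    afterSplit-covered : ∀ {e} → AfterSplit C ℬ rs 𝒞 → rs ≡ as ++ x ∷ bs → All FamilyWithin rs →
                         All (λ y → e ∉ root y) as → All (λ y → e ∉ root y) bs →
                         (∀ D → D ∈ˡ ℬ → e ∉ D) → Covered as x bs e suc 𝒞
    afterSplit-covered {as = []}    j≡k ()
    afterSplit-covered {as = _ ∷ _} j≡k ()
    afterSplit-covered {C = C} {ℬ = ℬ} {x = x} (j<k {ℰ = ℰ} c) rs≡ w e∉as e∉bs e∉ℬ
      with complete-cover c rs≡ w e∉as e∉bs
    ... | N , d , refl , cov , dep = C ∷ N , d , refl , cov′ , dep
      where
      cov′ : Cover _ x (ℬ ++ C ∷ ℰ) (C ∷ N)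
      cov′ D D∈ e∈D with ∈-split ℬ D∈
      ... | inj₂ (inj₁ D≡) = inj₁ (here D≡)
      ... | inj₁ D∈ℬ       = ⊥-elim (e∉ℬ D D∈ℬ e∈D)
      ... | inj₂ (inj₂ D∈ℰ) with cov D D∈ℰ e∈D
      ...   | inj₁ D∈N = inj₁ (there D∈N)
      ...   | inj₂ D∈x = inj₂ D∈x

-- Heavy paths and the invariants of `Balance`

module _ {n : ℕ} where

  private variable
    A C D X Y Z : Subset n
    𝒞 𝒟 𝒞′ : Family n
    H Hs : List (Subset n)
    xs ys as bs rs : List (Rooted n)
    x : Rooted n

  steps : Subset n → List (Subset n) → List (Subset n)
  steps X Hs = zipWith (λ X Y → Y ─ X) (X ∷ Hs) Hs

  ─-self : ∀ (X : Subset n) → X ─ X ≡ ∅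
  ─-self X = ⊆-antisym (λ e∈ → case x∈p─q⁻ X X e∈ of λ where (e∈X , e∉X) → ⊥-elim (e∉X e∈X)) ⊥⊆

  ─-∪-─ : X ⊆ Y → Y ⊆ Z → (Y ─ X) ∪ (Z ─ Y) ≡ Z ─ X
  ─-∪-─ {X} {Y} {Z} X⊆Y Y⊆Z = ⊆-antisym to from
    where
    to : (Y ─ X) ∪ (Z ─ Y) ⊆ Z ─ X
    to e∈ with x∈p∪q⁻ (Y ─ X) (Z ─ Y) e∈
    ... | inj₁ e∈Y─X = let e∈Y , e∉X = x∈p─q⁻ Y X e∈Y─X in x∈p∧x∉q⇒x∈p─q (Y⊆Z e∈Y) e∉X
    ... | inj₂ e∈Z─Y = let e∈Z , e∉Y = x∈p─q⁻ Z Y e∈Z─Y in x∈p∧x∉q⇒x∈p─q e∈Z (e∉Y ∘ X⊆Y)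
    from : Z ─ X ⊆ (Y ─ X) ∪ (Z ─ Y)
    from {e} e∈ with x∈p─q⁻ Z X e∈ | e ∈? Y
    ... | e∈Z , e∉X | yes e∈Y = x∈p∪q⁺ (inj₁ (x∈p∧x∉q⇒x∈p─q e∈Y e∉X))
    ... | e∈Z , e∉X | no  e∉Y = x∈p∪q⁺ (inj₂ (x∈p∧x∉q⇒x∈p─q e∈Z e∉Y))

  chain-⊆ : Linked _⊂_ (X ∷ Hs) → ∀ {Y} → Y ∈ˡ X ∷ Hs → X ⊆ Y
  chain-⊆ _                 (here refl) = id
  chain-⊆ ((X⊆Y , _) ∷ chn) (there Z∈)  = λ e∈X → chain-⊆ chn Z∈ (X⊆Y e∈X)

  steps-disjoint : Linked _⊂_ (X ∷ Hs) → All (Disjoint X) (steps X Hs)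
  steps-disjoint [-]               = []
  steps-disjoint ((X⊆Y , _) ∷ chn) =
    disjoint-─ ∷ All.map (λ dis → disjoint-⊆ X⊆Y id dis) (steps-disjoint chn)

  steps-allDisjoint : Linked _⊂_ (X ∷ Hs) → AllPairs Disjoint (steps X Hs)
  steps-allDisjoint [-]                        = []
  steps-allDisjoint {X} {Y ∷ Hs} (X⊂Y ∷ chn) =
    All.map (λ dis → disjoint-⊆ (p─q⊆p Y X) id dis) (steps-disjoint chn) ∷ steps-allDisjoint chn

  -- The differences along an ascending chain telescope.
  ⋃-steps-prefix : ∀ Hs bs {cs} → Linked _⊂_ (X ∷ Hs) → steps X Hs ≡ bs ++ cs →
                   ∃[ V ] (V ∈ˡ X ∷ Hs × ⋃ bs ≡ V ─ X)
  ⋃-steps-prefix {X} Hs []             _                 _  = X , here refl , sym (─-self X)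
  ⋃-steps-prefix {X} (Y ∷ Hs) (b ∷ bs) ((X⊆Y , _) ∷ chn) eq with ∷-injective eq
  ... | refl , eq′ with ⋃-steps-prefix Hs bs chn eq′
  ...   | V , V∈ , ⋃≡ = V , there V∈ , trans (cong (b ∪_) ⋃≡) (─-∪-─ X⊆Y (chain-⊆ chn V∈))

  ⋃-steps-interval : ∀ Hs as bs {cs} → Linked _⊂_ (X ∷ Hs) → steps X Hs ≡ as ++ bs ++ cs →
                     ∃[ U ] ∃[ V ] (U ∈ˡ X ∷ Hs × V ∈ˡ X ∷ Hs × ⋃ bs ≡ V ─ U)
  ⋃-steps-interval Hs [] bs chn eq =
    let V , V∈ , ⋃≡ = ⋃-steps-prefix Hs bs chn eq in _ , V , here refl , V∈ , ⋃≡
  ⋃-steps-interval (Y ∷ Hs) (a ∷ as) bs (_ ∷ chn) eq =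
    let U , V , U∈ , V∈ , ⋃≡ = ⋃-steps-interval Hs as bs chn (proj₂ (∷-injective eq))
    in  U , V , there U∈ , there V∈ , ⋃≡

  ⋃-steps : Linked _⊂_ (X ∷ Hs) → last (X ∷ Hs) ≡ just C → X ∪ ⋃ (steps X Hs) ≡ C
  ⋃-steps {X} [-] refl = ∪-identityʳ X
  ⋃-steps {X} {Y ∷ Hs} ((X⊆Y , _) ∷ chn) eq =
    trans (sym (∪-assoc X (Y ─ X) _)) (trans (cong (_∪ ⋃ (steps Y Hs)) (∪-─ X⊆Y)) (⋃-steps chn eq))

  ∣X∣+∣Y─X∣ : X ⊆ Y → ∣ X ∣ + ∣ Y ─ X ∣ ≡ ∣ Y ∣
  ∣X∣+∣Y─X∣ {X} {Y} X⊆Y = trans (sym (∣p∪q∣≡∣p∣+∣q∣ X (Y ─ X) disjoint-─)) (cong ∣_∣ (∪-─ X⊆Y))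

  Heavy : Subset n → Subset n → Set
  Heavy X Y = ∣ Y ─ X ∣ ≤ ∣ X ∣

  -- The right-hand side is the size of the path cluster whose sibling is `D`, as the earlier
  -- differences fill it up from `X`.
  steps-heavy : ∀ Hs as {D bs} → Linked _⊂_ (X ∷ Hs) → Linked Heavy (X ∷ Hs) →
                steps X Hs ≡ as ++ D ∷ bs → ∣ D ∣ ≤ ∣ X ∣ + sum (map ∣_∣ as)
  steps-heavy {X} (Y ∷ Hs) [] _ (h ∷ _) eq with ∷-injective eq
  ... | refl , _ = ≤-trans h (m≤m+n _ 0)
  steps-heavy {X} (Y ∷ Hs) (a ∷ as) (X⊂Y ∷ chn) (_ ∷ hs) eq with ∷-injective eq
  ... | refl , eq′ = ≤-trans (steps-heavy Hs as chn hs eq′)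
    (≤-reflexive (trans (cong (_+ _) (sym (∣X∣+∣Y─X∣ (proj₁ X⊂Y)))) (+-assoc ∣ X ∣ ∣ Y ─ X ∣ _)))

  Comparable : Subset n → Subset n → Set
  Comparable D X = (D ⊆ X) ⊎ (X ⊆ D)

  -- The hypothesis speaks only of clusters above `X`: these are comparable with everything below
  -- `X` on the path, so the hypothesis can be handed on to the rest of the path.
  steps∈ : BranchDecomposition C 𝒞 → ∀ Hs → All (_∈ˡ 𝒞) (X ∷ Hs) → Linked _⊂_ (X ∷ Hs) →
           (∀ D → D ∈ˡ 𝒞 → X ⊆ D → All (Comparable D) Hs → D ∈ˡ X ∷ Hs) → All (_∈ˡ 𝒞) (steps X Hs)
  steps∈ bd [] _ _ _ = []
  steps∈ {X = X} bd (Y ∷ Hs) (X∈ ∷ Y∈ ∷ Hs∈) (X⊂Y ∷ chn) maxl =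
    BD.difference∈ bd X∈ Y∈ X⊂Y cover ∷ steps∈ bd Hs (Y∈ ∷ Hs∈) chn maxl′
    where
    cover : ∀ D → D ∈ˡ _ → X ⊆ D → D ⊆ Y → D ≡ X ⊎ D ≡ Y
    cover D D∈ X⊆D D⊆Y
      with maxl D D∈ X⊆D (inj₁ D⊆Y ∷ All.tabulate λ Z∈ → inj₁ (λ e∈D → chain-⊆ chn (there Z∈) (D⊆Y e∈D)))
    ... | here D≡X          = inj₁ D≡X
    ... | there D∈′         = inj₂ (⊆-antisym D⊆Y (chain-⊆ chn D∈′))
    maxl′ : ∀ D → D ∈ˡ _ → Y ⊆ D → All (Comparable D) Hs → D ∈ˡ Y ∷ Hs
    maxl′ D D∈ Y⊆D cmp with maxl D D∈ (Y⊆D ∘ proj₁ X⊂Y) (inj₂ Y⊆D ∷ cmp)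
    ... | there D∈′ = D∈′
    ... | here refl = ⊥-elim (⊂-irref refl (⊂-⊆-trans X⊂Y Y⊆D))

  record HeavyBlocks (C : Subset n) (𝒞 : Family n) (Ds : List (Subset n)) : Set where
    field
      members   : All (_∈ˡ 𝒞) Ds
      union     : ⋃ Ds ≡ C
      disjoint  : AllPairs Disjoint Ds
      first     : ∀ {D Ds′} → Ds ≡ D ∷ Ds′ → ∣ D ∣ ≡ 1
      light     : ∀ E as {D bs} → Ds ≡ (E ∷ as) ++ D ∷ bs → ∣ D ∣ ≤ sum (map ∣_∣ (E ∷ as))
      intervals : ∀ as bs cs → Ds ≡ as ++ bs ++ cs →
                  ∃[ U ] ∃[ V ] ((U ∈ˡ 𝒞 ⊎ U ≡ ∅) × (V ∈ˡ 𝒞 ⊎ V ≡ ∅) × ⋃ bs ≡ V ─ U)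

  -- Prefixing `∅` turns the first block into a difference like all others, so every interval of
  -- blocks is a difference of two members of one chain.
  differences≡steps : ∀ H → differences H ≡ steps ∅ H
  differences≡steps []       = refl
  differences≡steps (X ∷ Hs) = cong (_∷ steps X Hs) (sym (p─⊥≡p X))

  heavyBlocks : BranchDecomposition C 𝒞 → HeavyPath C 𝒞 H → HeavyBlocks C 𝒞 (differences H)
  heavyBlocks {H = []} bd hp = case HeavyPath.top hp of λ ()
  heavyBlocks {C} {𝒞} {H = X ∷ Hs} bd hp = record
    { members   = X∈ ∷ steps∈ bd Hs hp.clusters hp.ascending
                    (λ D D∈ X⊆D cmp → hp.maximal D D∈ (inj₂ X⊆D ∷ cmp))
    ; union     = ⋃-steps hp.ascending hp.top
    ; disjoint  = steps-disjoint hp.ascending ∷ steps-allDisjoint hp.ascending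
    ; first     = λ { refl → ∣X∣≡1 }
    ; light     = λ where
        E as eq → case ∷-injective eq of λ where
          (refl , eq′) → steps-heavy Hs as hp.ascending hp.heavy eq′
    ; intervals = λ as bs cs eq →
        let U , V , U∈ , V∈ , ⋃≡ = ⋃-steps-interval (X ∷ Hs) as bs ((⊥⊆ , e , e∈X , ∉⊥) ∷ hp.ascending)
                                     (trans (sym (differences≡steps (X ∷ Hs))) eq)
        in  U , V , classify U∈ , classify V∈ , ⋃≡
    }
    where
    module hp = HeavyPath hp
    module bd = BD bd
    X∈ : X ∈ˡ 𝒞
    X∈ = All.head hp.clusters
    e : Fin n
    e = proj₁ (bd.nonempty X X∈)
    e∈X : e ∈ X
    e∈X = proj₂ (bd.nonempty X X∈)
    -- A singleton inside the lowest cluster is comparable with the whole chain. Maximality puts it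
    -- on the chain, above `X`, so `X` is this singleton.
    ⁅e⁆∈H : ⁅ e ⁆ ∈ˡ X ∷ Hs
    ⁅e⁆∈H = hp.maximal ⁅ e ⁆ (bd.singleton∈ (bd.within X X∈ e∈X))
      (All.tabulate λ Y∈ → inj₁ ⁅ chain-⊆ hp.ascending Y∈ e∈X ⁆⊆)
    ∣X∣≡1 : ∣ X ∣ ≡ 1
    ∣X∣≡1 = trans (cong ∣_∣ (⊆-antisym (chain-⊆ hp.ascending ⁅e⁆∈H) ⁅ e∈X ⁆⊆)) (∣⁅x⁆∣≡1 e)
    classify : ∀ {U} → U ∈ˡ ∅ ∷ X ∷ Hs → U ∈ˡ 𝒞 ⊎ U ≡ ∅
    classify (here refl) = inj₂ refl
    classify (there U∈)  = inj₁ (All.lookup hp.clusters U∈)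

  Difference : Family n → Subset n → Set
  Difference 𝒞 D = ∃[ U ] ∃[ V ] ((U ∈ˡ 𝒞 ⊎ U ≡ ∅) × (V ∈ˡ 𝒞 ⊎ V ≡ ∅) × D ≡ V ─ U)

  -- A list L covering the clusters around e bounds their number even if 𝒞 has repetitions.
  Shallow : Subset n → Family n → Set
  Shallow C 𝒞 = ∀ e → e ∈ C → ∃[ L ] ((∀ D → D ∈ˡ 𝒞 → e ∈ D → D ∈ˡ L) ×
                                        2 ^ length L ≤ 2 * (∣ C ∣ * ∣ C ∣ * ∣ C ∣))

  -- The field `asDifference` refers to the input family at every level of the recursion, since
  -- `restrict` only selects from it. Thus the width is doubled once and not once per level.
  record Balanced (C : Subset n) (𝒞 𝒞′ : Family n) : Set where
    field
      bd           : BranchDecomposition C 𝒞′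
      asDifference : ∀ D → D ∈ˡ 𝒞′ → Difference 𝒞 D
      shallow      : Shallow C 𝒞′

  single-balanced : BranchDecomposition C 𝒞 → ∣ C ∣ ≡ 1 → Balanced C 𝒞 𝒞
  single-balanced {C} {𝒞} bd ∣C∣≡1 = record
    { bd          = bd
    ; asDifference = λ D D∈ → ∅ , D , inj₂ refl , inj₁ D∈ , sym (p─⊥≡p D)
    ; shallow     = λ e e∈C → C ∷ [] , (λ D D∈ e∈D → here (⊆-size-1 ∣C∣≡1 (e , e∈D) (BD.within bd D D∈))) ,
                      subst (λ m → 2 ≤ 2 * (m * m * m)) (sym ∣C∣≡1) ≤-refl
    }

  AllBalanced : Family n → List (Rooted n) → Set
  AllBalanced 𝒞 = All (λ x → Balanced (root x) (restrict (root x) 𝒞) (family x))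

  complete-balanced : HeavyBlocks C 𝒞 (map root xs) → 2 ≤ ∣ C ∣ → AllBalanced 𝒞 xs →
                      Complete xs 𝒞′ → Balanced C 𝒞 𝒞′
  complete-balanced {C} {𝒞} {xs} {𝒞′} hb 2≤∣C∣ bal c = record
    { bd = subst (λ Z → BranchDecomposition Z 𝒞′) hb.union (complete-bd c bds disj)
    ; asDifference = diff
    ; shallow = shallow
    }
    where
    module hb = HeavyBlocks hb
    bds : All IsBD xs
    bds = All.map Balanced.bd bal
    disj : AllPairs DisjointRoots xs
    disj = AllPairs.map⁻ hb.disjoint
    within : All FamilyWithin xs
    within = All.map (λ b → BD.within b) bds
    lift : ∀ {X U} → U ∈ˡ restrict X 𝒞 ⊎ U ≡ ∅ → U ∈ˡ 𝒞 ⊎ U ≡ ∅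
    lift {X} (inj₁ U∈)  = inj₁ (proj₁ (∈-filter⁻ (_⊆? X) {xs = 𝒞} U∈))
    lift     (inj₂ U≡∅) = inj₂ U≡∅
    diff : ∀ D → D ∈ˡ 𝒞′ → Difference 𝒞 D
    diff D D∈ with complete-fromInputs c D∈
    ... | inj₁ (x , x∈ , D∈x) =
      let U , V , U∈ , V∈ , D≡ = Balanced.asDifference (All.lookup bal x∈) D D∈x in U , V , lift U∈ , lift V∈ , D≡
    ... | inj₂ (as , bs , cs , xs≡ , refl) =
      hb.intervals (map root as) (map root bs) (map root cs)
        (trans (cong (map root) xs≡) (trans (map-++ root as (bs ++ cs)) (cong (map root as ++_) (map-++ root bs cs))))
    size≡ : sum (map size xs) ≡ ∣ C ∣
    size≡ = trans (sym (size-unionOfRoots disj)) (cong ∣_∣ hb.union)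
    shallow : Shallow C 𝒞′
    shallow e e∈C with ∈-unionOfRoots⁻ xs (subst (e ∈_) (sym hb.union) e∈C)
    ... | x , x∈ , e∈x with ∈-∃++ x∈
    ...   | as , bs , refl with AllPairs-++⁻ as disj
    ...     | _ , disˣ ∷ _ , cross
          with complete-cover c refl within
                 (All.map (λ ds e∈y → disjoint⁻ (All.head ds) e∈y e∈x) cross)
                 (All.map (λ d e∈y → disjoint⁻ d e∈x e∈y) disˣ)
             | Balanced.shallow (All.lookup bal x∈) e e∈x
    ...       | N , d , refl , cov , dep | L , covL , L≤ = N ++ L , cov′ , bound as refl dep
      where
      cov′ : ∀ D → D ∈ˡ 𝒞′ → e ∈ D → D ∈ˡ N ++ L
      cov′ D D∈ e∈D with cov D D∈ e∈D
      ... | inj₁ D∈N = ∈-++⁺ˡ D∈N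
      ... | inj₂ D∈x = ∈-++⁺ʳ N (covL D D∈x e∈D)
      sizes≡ : sum (map size as ++ size x ∷ map size bs) ≡ ∣ C ∣
      sizes≡ = trans (cong sum (sym (map-++ size as (x ∷ bs)))) size≡
      length≡ : 2 ^ length (N ++ L) ≡ 2 ^ length N * 2 ^ length L
      length≡ = trans (cong (2 ^_) (length-++ N)) (^-distribˡ-+-* 2 (length N) (length L))
      bound : ∀ as′ → as ≡ as′ → Depth (map size as′) (size x) (map size bs) (length N) →
              2 ^ length (N ++ L) ≤ 2 * (∣ C ∣ * ∣ C ∣ * ∣ C ∣)
      bound [] refl dep = subst (_≤ _) (sym length≡) (begin
        -- A first block has one edge, which leaves only the factor 2 for its own clusters; this
        -- factor becomes the third factor `∣ C ∣`.
        2 ^ length N * 2 ^ length L                   ≤⟨ *-mono-≤ N≤ (subst (λ m → 2 ^ length L ≤ 2 * (m * m * m)) ∣x∣≡1 L≤) ⟩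
        2 * (∣ C ∣ * ∣ C ∣) * 2                       ≤⟨ *-monoʳ-≤ (2 * (∣ C ∣ * ∣ C ∣)) 2≤∣C∣ ⟩
        2 * (∣ C ∣ * ∣ C ∣) * ∣ C ∣                   ≡⟨ *-assoc 2 (∣ C ∣ * ∣ C ∣) ∣ C ∣ ⟩
        2 * (∣ C ∣ * ∣ C ∣ * ∣ C ∣)                   ∎)
        where
        open ≤-Reasoning
        ∣x∣≡1 : size x ≡ 1
        ∣x∣≡1 = hb.first refl
        N≤ : 2 ^ length N ≤ 2 * (∣ C ∣ * ∣ C ∣)
        N≤ = ≤-trans (m≤m*n (2 ^ length N) 1)
          (subst₂ (λ m s → 2 ^ length N * (m * m) ≤ 2 * (s * s)) ∣x∣≡1 sizes≡ (depth-first refl dep))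
      bound (a ∷ as′) refl dep = subst (_≤ _) (sym length≡) (begin
        2 ^ length N * 2 ^ length L                        ≤⟨ *-monoʳ-≤ (2 ^ length N) L≤ ⟩
        2 ^ length N * (2 * (m * m * m))                   ≡⟨ lem (2 ^ length N) (m * m * m) ⟩
        2 * (2 ^ length N * (m * m * m))                   ≤⟨ *-monoʳ-≤ 2 N≤ ⟩
        2 * (∣ C ∣ * ∣ C ∣ * ∣ C ∣)                        ∎)
        where
        open ≤-Reasoning
        m = size x
        lem : ∀ p q → p * (2 * q) ≡ 2 * (p * q)
        lem = solve-∀
        m≤ : m ≤ sum (map size (a ∷ as′))
        m≤ = subst (λ z → m ≤ sum z) (sym (map-∘ (a ∷ as′)))
               (hb.light (root a) (map root as′) (map-++ root (a ∷ as′) (x ∷ bs)))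
        N≤ : 2 ^ length N * (m * m * m) ≤ ∣ C ∣ * ∣ C ∣ * ∣ C ∣
        N≤ = subst (λ s → 2 ^ length N * (m * m * m) ≤ s * s * s) sizes≡
               (depth-heavy m≤ (nonempty⇒1≤∣∣ (e , e∈x)) dep)

  2≤∣C∣ : Nonempty C → ∣ C ∣ ≢ 1 → 2 ≤ ∣ C ∣
  2≤∣C∣ C≢∅ ∣C∣≢1 = ≤∧≢⇒< (nonempty⇒1≤∣∣ C≢∅) (∣C∣≢1 ∘ sym)

  roots-zip : ∀ {R : Subset n → Family n → Set} {Ds 𝒞s} → Pointwise R Ds 𝒞s → map root (zipWith rooted Ds 𝒞s) ≡ Ds
  roots-zip []       = refl
  roots-zip (_ ∷ rs) = cong (_ ∷_) (roots-zip rs)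

  mutual
    balance-balanced : Balance C 𝒞 𝒞′ → BranchDecomposition C 𝒞 → Balanced C 𝒞 𝒞′
    balance-balanced (single ∣C∣≡1)            bd = single-balanced bd ∣C∣≡1
    balance-balanced (split ∣C∣≢1 hp bals cpl) bd =
      complete-balanced (subst (HeavyBlocks _ _) (sym (roots-zip bals)) hb)
        (2≤∣C∣ (BD.root-nonempty bd) ∣C∣≢1) (balances-balanced bals bd (HeavyBlocks.members hb)) cpl
      where hb = heavyBlocks bd hp

    balances-balanced : ∀ {Ds 𝒞s} → Pointwise (λ D 𝒟 → Balance D (restrict D 𝒞) 𝒟) Ds 𝒞s →
                        BranchDecomposition C 𝒞 → All (_∈ˡ 𝒞) Ds → AllBalanced 𝒞 (zipWith rooted Ds 𝒞s)
    balances-balanced []           bd []         = []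
    balances-balanced (bal ∷ bals) bd (D∈ ∷ Ds∈) =
      balance-balanced bal (BD.restrict-bd bd D∈) ∷ balances-balanced bals bd Ds∈

-- Counting clusters and bounding the width

unique-⊆⇒length≤ : ∀ {a} {V : Set a} {xs ys : List V} → Unique xs → xs ⊆ˡ ys → length xs ≤ length ys
unique-⊆⇒length≤ {xs = []}     _            _     = z≤n
unique-⊆⇒length≤ {xs = x ∷ xs} (x∉ ∷ uniq) xs⊆ys with ∈-∃++ (xs⊆ys (here refl))
... | as , bs , refl = begin
  suc (length xs)            ≤⟨ s≤s (unique-⊆⇒length≤ uniq xs⊆) ⟩
  suc (length (as ++ bs))    ≡⟨ cong suc (length-++ as) ⟩
  suc (length as + length bs) ≡⟨ sym (+-suc (length as) (length bs)) ⟩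
  length as + length (x ∷ bs) ≡⟨ sym (length-++ as) ⟩
  length (as ++ x ∷ bs)      ∎
  where
  open ≤-Reasoning
  xs⊆ : xs ⊆ˡ as ++ bs
  xs⊆ z∈ with ∈-split as (xs⊆ys (there z∈))
  ... | inj₁ z∈as         = ∈-++⁺ˡ z∈as
  ... | inj₂ (inj₁ refl)  = ⊥-elim (All.lookup x∉ z∈ refl)
  ... | inj₂ (inj₂ z∈bs)  = ∈-++⁺ʳ as z∈bs

#clusters-≤ : ∀ {n} e (𝒞 L : Family n) → (∀ D → D ∈ˡ 𝒞 → e ∈ D → D ∈ˡ L) → #clustersContaining e 𝒞 ≤ length L
#clusters-≤ e 𝒞 L cover = unique-⊆⇒length≤ (Unique.deduplicate-! _≟ˢ_ (filter (e ∈?_) 𝒞)) λ D∈ →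
  let D∈𝒞 , e∈D = ∈-filter⁻ (e ∈?_) {xs = 𝒞} (∈-deduplicate⁻ _≟ˢ_ (filter (e ∈?_) 𝒞) D∈) in cover _ D∈𝒞 e∈D

shallow⇒3log₂ : ∀ {n} {C : Subset n} {𝒞} → Shallow C 𝒞 → ∀ e → e ∈ C → #clustersContaining e 𝒞 ≤3log₂ ∣ C ∣ +1
shallow⇒3log₂ {C = C} {𝒞} shallow e e∈C with shallow e e∈C
... | L , cover , L≤ = ≤-trans (^-monoʳ-≤ 2 (#clusters-≤ e 𝒞 L cover)) (≤-trans L≤ (≤-reflexive (lem ∣ C ∣)))
  where
  lem : ∀ m → 2 * (m * m * m) ≡ 2 * (m * (m * (m * 1)))
  lem = solve-∀

module _ (G : Graph) where
  open Graph G

  ∈-∂⁻ : ∀ {D v} → v ∈ ∂ D → Nonempty (D ∩ edgesAt v) × (D ∩ edgesAt v) ⊂ edgesAt v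
  ∈-∂⁻ {D} {v} v∈ =
    does⇒ (nonempty? (D ∩ edgesAt v) ×-dec ((D ∩ edgesAt v) ⊂? edgesAt v))
          (trans (sym (lookup∘tabulate _ v)) ([]=⇒lookup v∈))
    where
    does⇒ : ∀ {P : Set} (P? : Dec P) → does P? ≡ inside → P
    does⇒ (yes p) _ = p

  ∈-∂⁺ : ∀ {D v} e f → e ∈ D → e ∈ edgesAt v → f ∉ D → f ∈ edgesAt v → v ∈ ∂ D
  ∈-∂⁺ {D} {v} e f e∈D e∈v f∉D f∈v = lookup⇒[]= v _ (trans (lookup∘tabulate _ v)
    (dec-true (nonempty? (D ∩ edgesAt v) ×-dec ((D ∩ edgesAt v) ⊂? edgesAt v))
      ((e , x∈p∩q⁺ (e∈D , e∈v)) , p∩q⊆q D (edgesAt v) , f , f∈v , f∉D ∘ proj₁ ∘ x∈p∩q⁻ D (edgesAt v))))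

  -- Let `e` be an edge at `v` inside `Y ─ X` and `f` one outside. If `f` is outside `Y`, the pair
  -- shows `v ∈ ∂ Y`; otherwise `f` is in `X` while `e` is not, so `v ∈ ∂ X`.
  ∂-─ : ∀ X Y → ∂ (Y ─ X) ⊆ ∂ Y ∪ ∂ X
  ∂-─ X Y {v} v∈ with ∈-∂⁻ v∈
  ... | (e , e∈) , (_ , f , f∈v , f∉) with x∈p∩q⁻ (Y ─ X) (edgesAt v) e∈ | f ∈? Y | f ∈? X
  ...   | e∈Y─X , e∈v | no f∉Y | _ =
          x∈p∪q⁺ (inj₁ (∈-∂⁺ e f (proj₁ (x∈p─q⁻ Y X e∈Y─X)) e∈v f∉Y f∈v))
  ...   | e∈Y─X , e∈v | yes _  | yes f∈X =
          x∈p∪q⁺ (inj₂ (∈-∂⁺ f e f∈X f∈v (proj₂ (x∈p─q⁻ Y X e∈Y─X)) e∈v))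
  ...   | _ | yes f∈Y | no f∉X = ⊥-elim (f∉ (x∈p∩q⁺ (x∈p∧x∉q⇒x∈p─q f∈Y f∉X , f∈v)))

  ∣∂∅∣≡0 : ∣ ∂ ∅ ∣ ≡ 0
  ∣∂∅∣≡0 = trans (cong ∣_∣ (Empty-unique λ where
    (v , v∈) → case proj₁ (∈-∂⁻ v∈) of λ where
      (e , e∈) → ∉⊥ (proj₁ (x∈p∩q⁻ ∅ (edgesAt v) e∈)))) (∣⊥∣≡0 #vertices)

  ∈⇒∣∂∣≤width : ∀ {𝒞 D} → D ∈ˡ 𝒞 → ∣ ∂ D ∣ ≤ width G 𝒞
  ∈⇒∣∂∣≤width (here refl)        = m≤m⊔n _ _
  ∈⇒∣∂∣≤width {E ∷ 𝒞} (there D∈) = ≤-trans (∈⇒∣∂∣≤width D∈) (m≤n⊔m ∣ ∂ E ∣ (width G 𝒞))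

  width-≤ : ∀ {w} 𝒞 → (∀ D → D ∈ˡ 𝒞 → ∣ ∂ D ∣ ≤ w) → width G 𝒞 ≤ w
  width-≤ []      _ = z≤n
  width-≤ (D ∷ 𝒞) h = ⊔-lub (h D (here refl)) (width-≤ 𝒞 λ E E∈ → h E (there E∈))

  width-differences : ∀ {w} 𝒞 𝒞′ → width G 𝒞 ≤ w → (∀ D → D ∈ˡ 𝒞′ → Difference 𝒞 D) → width G 𝒞′ ≤ 2 * w
  width-differences {w} 𝒞 𝒞′ 𝒞≤w diff = width-≤ 𝒞′ λ D D∈ →
    let U , V , U∈ , V∈ , D≡ = diff D D∈ in begin
    ∣ ∂ D ∣             ≡⟨ cong (λ E → ∣ ∂ E ∣) D≡ ⟩
    ∣ ∂ (V ─ U) ∣       ≤⟨ p⊆q⇒∣p∣≤∣q∣ (∂-─ U V) ⟩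
    ∣ ∂ V ∪ ∂ U ∣       ≤⟨ ∣p∪q∣≤∣p∣+∣q∣ (∂ V) (∂ U) ⟩
    ∣ ∂ V ∣ + ∣ ∂ U ∣   ≤⟨ +-mono-≤ (bound V∈) (bound U∈) ⟩
    w + w               ≡⟨ cong (w +_) (sym (+-identityʳ w)) ⟩
    2 * w               ∎
    where
    open ≤-Reasoning
    bound : ∀ {X} → X ∈ˡ 𝒞 ⊎ X ≡ ∅ → ∣ ∂ X ∣ ≤ w
    bound (inj₁ X∈)   = ≤-trans (∈⇒∣∂∣≤width X∈) 𝒞≤w
    bound (inj₂ refl) = subst (_≤ w) (sym ∣∂∅∣≡0) z≤n
    ∣p∪q∣≤∣p∣+∣q∣ : ∀ {n} (p q : Subset n) → ∣ p ∪ q ∣ ≤ ∣ p ∣ + ∣ q ∣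
    ∣p∪q∣≤∣p∣+∣q∣ p q = begin
      ∣ p ∪ q ∣             ≡⟨ cong ∣_∣ (⊆-antisym ∪⊆ ⊆∪) ⟩
      ∣ p ∪ (q ─ p) ∣       ≡⟨ ∣p∪q∣≡∣p∣+∣q∣ p (q ─ p) disjoint-─ ⟩
      ∣ p ∣ + ∣ q ─ p ∣     ≤⟨ +-monoʳ-≤ ∣ p ∣ (∣p─q∣≤∣p∣ q p) ⟩
      ∣ p ∣ + ∣ q ∣         ∎
      where
      ∪⊆ : p ∪ q ⊆ p ∪ (q ─ p)
      ∪⊆ {e} e∈ with x∈p∪q⁻ p q e∈ | e ∈? p
      ... | inj₁ e∈p | _       = x∈p∪q⁺ (inj₁ e∈p)
      ... | inj₂ e∈q | yes e∈p = x∈p∪q⁺ (inj₁ e∈p)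
      ... | inj₂ e∈q | no  e∉p = x∈p∪q⁺ (inj₂ (x∈p∧x∉q⇒x∈p─q e∈q e∉p))
      ⊆∪ : p ∪ (q ─ p) ⊆ p ∪ q
      ⊆∪ e∈ with x∈p∪q⁻ p (q ─ p) e∈
      ... | inj₁ e∈p = x∈p∪q⁺ (inj₁ e∈p)
      ... | inj₂ e∈─ = x∈p∪q⁺ (inj₂ (p─q⊆p q p e∈─))

-- Programs

module Semantics {f : ℕ} (bodies : Vec (Exp f 1) f) (W : ℕ) where

  private variable
    n x y d d₁ d₂ d₃ c : ℕ
    ρ : Vec Val n
    e e₁ e₂ e₃ e₄ : Exp f n
    u v u₁ u₂ : Val
    g : Fin f
    vs : List Val

  weight : Exp f n → ℕ
  weight (var _)              = 1
  weight (lit _)              = 1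
  weight (add e₁ e₂)          = suc (weight e₁ + weight e₂)
  weight (sub e₁ e₂)          = suc (weight e₁ + weight e₂)
  weight (half e)             = suc (weight e)
  weight (cons e₁ e₂)         = suc (weight e₁ + weight e₂)
  weight (array e)            = suc (weight e)
  weight (index e₁ e₂)        = suc (weight e₁ + weight e₂)
  weight (ifle e₁ e₂ e₃ e₄)   = suc (weight e₁ + weight e₂ + (weight e₃ + weight e₄))
  weight (match e e₁ e₂)      = suc (weight e + (weight e₁ + weight e₂))
  weight (bind e₁ e₂)         = suc (weight e₁ + weight e₂)
  weight (call _ e)           = suc (weight e)

  -- Every construct of e is executed at most once, so besides weight e only the
  -- calls and array creations, bounded by d, contribute to the cost.
  Eval≤ : Vec Val n → Exp f n → Val → ℕ → Set
  Eval≤ ρ e v d = ∃[ c ] (Eval bodies W ρ e v c × c ≤ weight e + d)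

  Call : Fin f → Val → Val → ℕ → Set
  Call g u v b = ∃[ c ] (Eval bodies W (u ∷ []) (lookup bodies g) v c × c ≤ b)

  private
    combine : ∀ {a b d₁ d₂} p q → a ≤ p + d₁ → b ≤ q + d₂ → suc (a + b) ≤ suc (p + q) + (d₁ + d₂)
    combine {d₁ = d₁} {d₂} p q h₁ h₂ = s≤s (≤-trans (+-mono-≤ h₁ h₂) (≤-reflexive (lem p q d₁ d₂)))
      where
      lem : ∀ p q d₁ d₂ → p + d₁ + (q + d₂) ≡ p + q + (d₁ + d₂)
      lem = solve-∀

  -- Replaces a number as the machine computes it, for instance a truncated difference, by the
  -- quantity that the specification speaks of.
  ⇓≡ : u ≡ v → Eval≤ ρ e u d → Eval≤ ρ e v d
  ⇓≡ refl E = E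

  ⇓var : ∀ i → Eval≤ ρ (var i) (lookup ρ i) 0
  ⇓var i = 1 , var , ≤-refl

  ⇓lit : ∀ {k} → Eval≤ ρ (lit k) (nat k) 0
  ⇓lit = 1 , lit , ≤-refl

  ⇓add : x + y ≤ W → Eval≤ ρ e₁ (nat x) d₁ → Eval≤ ρ e₂ (nat y) d₂ →
         Eval≤ ρ (add e₁ e₂) (nat (x + y)) (d₁ + d₂)
  ⇓add {e₁ = e₁} {e₂ = e₂} ≤W (_ , E₁ , h₁) (_ , E₂ , h₂) =
    _ , add E₁ E₂ ≤W , combine (weight e₁) (weight e₂) h₁ h₂

  ⇓sub : Eval≤ ρ e₁ (nat x) d₁ → Eval≤ ρ e₂ (nat y) d₂ → Eval≤ ρ (sub e₁ e₂) (nat (x ∸ y)) (d₁ + d₂)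
  ⇓sub {e₁ = e₁} {e₂ = e₂} (_ , E₁ , h₁) (_ , E₂ , h₂) =
    _ , sub E₁ E₂ , combine (weight e₁) (weight e₂) h₁ h₂

  ⇓half : Eval≤ ρ e (nat x) d → Eval≤ ρ (half e) (nat ⌊ x /2⌋) d
  ⇓half (_ , E , h) = _ , half E , s≤s h

  ⇓cons : Eval≤ ρ e₁ u d₁ → Eval≤ ρ e₂ v d₂ → Eval≤ ρ (cons e₁ e₂) (cell u v) (d₁ + d₂)
  ⇓cons {e₁ = e₁} {e₂ = e₂} (_ , E₁ , h₁) (_ , E₂ , h₂) =
    _ , cons E₁ E₂ , combine (weight e₁) (weight e₂) h₁ h₂

  ⇓array : Eval≤ ρ e (listVal vs) d → Eval≤ ρ (array e) (arr vs) (d + length vs)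
  ⇓array {e = e} {vs = vs} {d = d} (_ , E , h) =
    _ , array E , s≤s (≤-trans (+-monoˡ-≤ (length vs) h) (≤-reflexive (+-assoc (weight e) d (length vs))))

  ⇓index : ∀ as {bs} → vs ≡ as ++ v ∷ bs → Eval≤ ρ e₁ (arr vs) d₁ → Eval≤ ρ e₂ (nat (length as)) d₂ →
           Eval≤ ρ (index e₁ e₂) v (d₁ + d₂)
  ⇓index {v = v} {ρ = ρ} {e₁ = e₁} {e₂ = e₂} as {bs} refl (_ , E₁ , h₁) (_ , E₂ , h₂) =
    _ , subst (λ v → Eval bodies W ρ (index e₁ e₂) v _) (proj₂ (position as))
          (index E₁ (subst (λ k → Eval bodies W ρ e₂ (nat k) _) (sym (proj₁ (position as))) E₂)) ,
    combine (weight e₁) (weight e₂) h₁ h₂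
    where
    at# : ∀ as → Fin (length (as ++ v ∷ bs))
    at# []       = zero
    at# (_ ∷ as) = suc (at# as)
    position : ∀ as → toℕ (at# as) ≡ length as × List.lookup (as ++ v ∷ bs) (at# as) ≡ v
    position []       = refl , refl
    position (_ ∷ as) = cong suc (proj₁ (position as)) , proj₂ (position as)

  ⇓if-yes : x ≤ y → Eval≤ ρ e₁ (nat x) d₁ → Eval≤ ρ e₂ (nat y) d₂ → Eval≤ ρ e₃ v d₃ →
            Eval≤ ρ (ifle e₁ e₂ e₃ e₄) v (d₁ + d₂ + d₃)
  ⇓if-yes {e₁ = e₁} {e₂ = e₂} {e₃ = e₃} {d₃ = d₃} {e₄ = e₄} x≤y (_ , E₁ , h₁) (_ , E₂ , h₂) (_ , E₃ , h₃) =
    _ , ifle-yes E₁ E₂ x≤y E₃ ,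
    ≤-pred (combine (suc (weight e₁ + weight e₂)) (weight e₃ + weight e₄)
      (combine (weight e₁) (weight e₂) h₁ h₂) (≤-trans h₃ (+-monoˡ-≤ d₃ (m≤m+n (weight e₃) (weight e₄)))))

  ⇓if-no : y < x → Eval≤ ρ e₁ (nat x) d₁ → Eval≤ ρ e₂ (nat y) d₂ → Eval≤ ρ e₄ v d₃ →
           Eval≤ ρ (ifle e₁ e₂ e₃ e₄) v (d₁ + d₂ + d₃)
  ⇓if-no {e₁ = e₁} {e₂ = e₂} {e₄ = e₄} {d₃ = d₃} {e₃ = e₃} y<x (_ , E₁ , h₁) (_ , E₂ , h₂) (_ , E₄ , h₄) =
    _ , ifle-no E₁ E₂ y<x E₄ ,
    ≤-pred (combine (suc (weight e₁ + weight e₂)) (weight e₃ + weight e₄)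
      (combine (weight e₁) (weight e₂) h₁ h₂) (≤-trans h₄ (+-monoˡ-≤ d₃ (m≤n+m (weight e₄) (weight e₃)))))

  ⇓match-nat : Eval≤ ρ e (nat x) d₁ → Eval≤ ρ e₁ v d₂ → Eval≤ ρ (match e e₁ e₂) v (d₁ + d₂)
  ⇓match-nat {e = e} {e₁ = e₁} {d₂ = d₂} {e₂ = e₂} (_ , E , h) (_ , E₁ , h₁) =
    _ , match-nat E E₁ , combine (weight e) (weight e₁ + weight e₂) h (≤-trans h₁ (+-monoˡ-≤ d₂ (m≤m+n (weight e₁) (weight e₂))))

  ⇓match-cell : Eval≤ ρ e (cell u₁ u₂) d₁ → Eval≤ (u₁ ∷ u₂ ∷ ρ) e₂ v d₂ →
                Eval≤ ρ (match e e₁ e₂) v (d₁ + d₂)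
  ⇓match-cell {e = e} {e₂ = e₂} {d₂ = d₂} {e₁ = e₁} (_ , E , h) (_ , E₂ , h₂) =
    _ , match-cell E E₂ , combine (weight e) (weight e₁ + weight e₂) h (≤-trans h₂ (+-monoˡ-≤ d₂ (m≤n+m (weight e₂) (weight e₁))))

  ⇓bind : Eval≤ ρ e₁ u d₁ → Eval≤ (u ∷ ρ) e₂ v d₂ → Eval≤ ρ (bind e₁ e₂) v (d₁ + d₂)
  ⇓bind {e₁ = e₁} {e₂ = e₂} (_ , E₁ , h₁) (_ , E₂ , h₂) =
    _ , bind E₁ E₂ , combine (weight e₁) (weight e₂) h₁ h₂

  ⇓call : ∀ {b} → Call g u v b → Eval≤ ρ e u d → Eval≤ ρ (call g e) v (d + b)
  ⇓call {e = e} {d = d} {b = b} (_ , E′ , h′) (_ , E , h) =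
    _ , call E E′ , s≤s (≤-trans (+-mono-≤ h h′) (≤-reflexive (+-assoc (weight e) d b)))

-- The code shared by the two programs

pattern annotateᶠ = zero
pattern balanceᶠ = suc annotateᶠ
pattern pathᶠ = suc balanceᶠ
pattern assembleᶠ = suc pathᶠ
pattern lengthᶠ = suc assembleᶠ
pattern entriesᶠ = suc lengthᶠ
pattern buildᶠ = suc entriesᶠ
pattern searchᶠ = suc buildᶠ
pattern sizesᶠ = suc searchᶠ
pattern balanceTreeᶠ = suc sizesᶠ
pattern completeᶠ = suc balanceTreeᶠ

Code : ℕ → Set
Code = Exp 11

-- De Bruijn indices count from the latest binding; the second branch of `match` has the fields at 0
-- and 1.
#_ : ∀ m {n} {m<n : True (m <? n)} → Code n
#_ m {m<n = m<n} = var (fromℕ< (toWitness m<n))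

-- For branches that are never taken.
junk : ∀ {n} → Code n
junk = lit 0

annotate : Code 1
annotate =
  match (# 0) (cons (lit 1) (# 0))
    (bind (call annotateᶠ (# 0))
    (bind (call annotateᶠ (# 2))
    (match (# 1) junk
    (match (# 2) junk
    (cons (add (# 2) (# 0)) (cons (# 5) (# 4)))))))

balanceAnnotated : Code 1
balanceAnnotated = call assembleᶠ (call pathᶠ (cons (# 0) (lit 0)))

-- Argument (annotated tree, blocks), where a block is (size, tree) and blocks
-- collects the balanced siblings met so far; returns the blocks of the heavy path,
-- its leaf first.
path : Code 1
path =
  match (# 0) junk
  (match (# 0) junk
  -- For a leaf the annotated tree is already the block of size 1.
  (match (# 1) (cons (# 2) (# 3))
  (match (# 0) junk
  (match (# 3) junk
  (ifle (# 2) (# 0)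
    (call pathᶠ (cons (# 5) (cons (cons (# 2) (call balanceᶠ (# 4))) (# 9))))
    (call pathᶠ (cons (# 4) (cons (cons (# 0) (call balanceᶠ (# 5))) (# 9)))))))))

assemble : Code 1
assemble = call buildᶠ
  (cons (array (call entriesᶠ (cons (lit 0) (# 0)))) (cons (lit 0) (call lengthᶠ (# 0))))

lengthCode : Code 1
lengthCode = match (# 0) (lit 0) (add (lit 1) (call lengthᶠ (# 1)))

-- Argument (p, blocks), where p is the total size of the preceding blocks. An entry
-- is (p, (p + m, tree)): the block occupies the positions p, …, p + m − 1.
entries : Code 1
entries =
  match (# 0) junk
  (match (# 1) (lit 0)
  (match (# 0) junk
  (bind (add (# 4) (# 0))
  (cons (cons (# 5) (cons (# 0) (# 2))) (call entriesᶠ (cons (# 0) (# 4)))))))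

-- Argument (entries, (lo, d)): Complete on the d blocks from index lo on.
build : Code 1
build =
  match (# 0) junk
  (match (# 1) junk
  (bind (add (# 0) (# 1))
  (match (index (# 3) (# 1)) junk
  (match (index (# 5) (sub (# 2) (lit 1))) junk
  (match (# 1) junk
  -- The total size is the end of the last entry minus the start of the first, and the split block
  -- is the one that occupies the middle position.
  (bind (call searchᶠ (cons (cons (# 9) (add (# 4) (half (sub (# 0) (# 4))))) (cons (# 7) (# 8))))
  (match (index (# 10) (# 0)) junk
  (match (# 1) junk
  (bind (ifle (# 4) (# 12) (# 1) (cons (call buildᶠ (cons (# 14) (cons (# 12) (sub (# 4) (# 12))))) (# 1)))
  (bind (add (# 5) (lit 1))
  (ifle (# 13) (# 0) (# 1) (cons (# 1) (call buildᶠ (cons (# 16) (cons (# 0) (sub (# 13) (# 0)))))))))))))))))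

-- The part of a probe in which the two outcomes differ; the evaluation of all that precedes it is
-- shared by both cases in `search-call`.
searchSides : Code 11
searchSides =
  ifle (# 0) (# 7)
    (call searchᶠ (cons (cons (# 6) (# 7)) (cons (# 2) (sub (# 5) (# 3)))))
    (call searchᶠ (cons (cons (# 6) (# 7)) (cons (# 4) (# 3))))

-- Argument ((entries, h), (lo, d)): the index of the block that occupies position h,
-- by binary search among the d blocks from index lo on.
search : Code 1
search =
  match (# 0) junk
  (match (# 0) junk
  (match (# 3) junk
  (ifle (# 1) (lit 1) (# 0)
  (bind (half (# 1))
  (bind (add (# 1) (# 0))
  (match (index (# 4) (# 0)) junk
  searchSides))))))

sizes : Code 1
sizes =
  match (# 0) (lit 0)
  (match (call annotateᶠ (# 0)) junk
  (cons (cons (# 0) (# 2)) (call sizesᶠ (# 3))))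

balanceTree : Code 1
balanceTree = call balanceᶠ (call annotateᶠ (# 0))

completeTrees : Code 1
completeTrees = call assembleᶠ (call sizesᶠ (# 0))

code : Vec (Code 1) 11
code = annotate ∷ balanceAnnotated ∷ path ∷ assemble ∷ lengthCode ∷ entries ∷ build ∷ search ∷
       sizes ∷ balanceTree ∷ completeTrees ∷ []

balanceProgram completeProgram : Program
balanceProgram  = record { bodies = code ; main = balanceTreeᶠ }
completeProgram = record { bodies = code ; main = completeᶠ }

-- Opaque, so that costs stay symbolic in the arithmetic below.
opaque
  M : ℕ
  M = 100

  weight≤M : ∀ W g → Semantics.weight code W (lookup code g) ≤ M
  weight≤M W annotateᶠ    = ≤ᵇ⇒≤ _ _ tt
  weight≤M W balanceᶠ     = ≤ᵇ⇒≤ _ _ tt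
  weight≤M W pathᶠ        = ≤ᵇ⇒≤ _ _ tt
  weight≤M W assembleᶠ    = ≤ᵇ⇒≤ _ _ tt
  weight≤M W lengthᶠ      = ≤ᵇ⇒≤ _ _ tt
  weight≤M W entriesᶠ     = ≤ᵇ⇒≤ _ _ tt
  weight≤M W buildᶠ       = ≤ᵇ⇒≤ _ _ tt
  weight≤M W searchᶠ      = ≤ᵇ⇒≤ _ _ tt
  weight≤M W sizesᶠ       = ≤ᵇ⇒≤ _ _ tt
  weight≤M W balanceTreeᶠ = ≤ᵇ⇒≤ _ _ tt
  weight≤M W completeᶠ    = ≤ᵇ⇒≤ _ _ tt

-- Cost of Complete

leaves : ∀ {n} → Tree n → ℕ
leaves (leaf _)   = 1
leaves (node l r) = leaves l + leaves r

1≤leaves : ∀ {n} (t : Tree n) → 1 ≤ leaves t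
1≤leaves (leaf _)   = ≤-refl
1≤leaves (node l r) = ≤-trans (1≤leaves l) (m≤m+n (leaves l) (leaves r))

leaves≡∣root∣ : ∀ {n} (t : Tree n) → DisjointChildren t → leaves t ≡ ∣ rootCluster t ∣
leaves≡∣root∣ (leaf e)   _               = sym (∣⁅x⁆∣≡1 e)
leaves≡∣root∣ (node l r) (dis , dˡ , dʳ) =
  trans (cong₂ _+_ (leaves≡∣root∣ l dˡ) (leaves≡∣root∣ r dʳ)) (sym (∣p∪q∣≡∣p∣+∣q∣ _ _ dis))

module _ {n : ℕ} where

  private variable
    Z : Subset n
    𝒜 ℬ : Family n
    l r : Tree n

  represents-node : l Represents 𝒜 → r Represents ℬ → Disjoint (rootCluster l) (rootCluster r) →
                    rootCluster l ∪ rootCluster r ≡ Z → node l r Represents (𝒜 ++ Z ∷ ℬ)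
  represents-node {l} {𝒜} {r} {ℬ} (dˡ , l∼) (dʳ , r∼) dis refl = (dis , dˡ , dʳ) , ∼⁺ to from
    where
    to : treeClusters (node l r) ⊆ˡ 𝒜 ++ (rootCluster l ∪ rootCluster r) ∷ ℬ
    to (here refl) = ∈-++⁺ʳ 𝒜 (here refl)
    to (there D∈) with ∈-++⁻ (treeClusters l) D∈
    ... | inj₁ D∈l = ∈-++⁺ˡ (Equivalence.to l∼ D∈l)
    ... | inj₂ D∈r = ∈-++⁺ʳ 𝒜 (there (Equivalence.to r∼ D∈r))
    from : 𝒜 ++ (rootCluster l ∪ rootCluster r) ∷ ℬ ⊆ˡ treeClusters (node l r)
    from D∈ with ∈-split 𝒜 D∈
    ... | inj₁ D∈𝒜         = there (∈-++⁺ˡ (Equivalence.from l∼ D∈𝒜))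
    ... | inj₂ (inj₁ refl) = here refl
    ... | inj₂ (inj₂ D∈ℬ)  = there (∈-++⁺ʳ (treeClusters l) (Equivalence.from r∼ D∈ℬ))

  -- An integer exceeds half of the total exactly if it exceeds the rounded half, so the block that
  -- occupies position `⌊ T /2⌋` is the split block.
  splitIndex⁺ : ∀ as m bs → sum as ≤ ⌊ sum (as ++ m ∷ bs) /2⌋ → ⌊ sum (as ++ m ∷ bs) /2⌋ < sum as + m →
                IsSplitIndex {n} (as ++ m ∷ bs) (suc (length as))
  splitIndex⁺ as m bs as≤ <as+m = above , λ i T< → ≰⇒> λ i≤ → <⇒≱ T< (begin
    2 * sum (take i (as ++ m ∷ bs))  ≤⟨ *-monoʳ-≤ 2 (take-mono i as i≤) ⟩
    2 * sum as                       ≤⟨ *-monoʳ-≤ 2 as≤ ⟩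
    2 * ⌊ T /2⌋                      ≤⟨ 2*⌊n/2⌋≤n T ⟩
    T                                ∎)
    where
    open ≤-Reasoning
    T = sum (as ++ m ∷ bs)
    2*⌊n/2⌋≤n : ∀ n → 2 * ⌊ n /2⌋ ≤ n
    2*⌊n/2⌋≤n zero          = z≤n
    2*⌊n/2⌋≤n (suc zero)    = z≤n
    2*⌊n/2⌋≤n (suc (suc n)) = ≤-trans (≤-reflexive (lem ⌊ n /2⌋)) (s≤s (s≤s (2*⌊n/2⌋≤n n)))
      where
      lem : ∀ k → 2 * suc k ≡ suc (suc (2 * k))
      lem = solve-∀
    n<2*suc⌊n/2⌋ : ∀ n → n < 2 * suc ⌊ n /2⌋
    n<2*suc⌊n/2⌋ zero          = s≤s z≤n
    n<2*suc⌊n/2⌋ (suc zero)    = s≤s (s≤s z≤n)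
    n<2*suc⌊n/2⌋ (suc (suc n)) = ≤-trans (s≤s (s≤s (n<2*suc⌊n/2⌋ n))) (≤-reflexive (lem ⌊ n /2⌋))
      where
      lem : ∀ k → suc (suc (2 * suc k)) ≡ 2 * suc (suc k)
      lem = solve-∀
    take-mono : ∀ i as → i ≤ length as → sum (take i (as ++ m ∷ bs)) ≤ sum as
    take-mono zero    as       _         = z≤n
    take-mono (suc i) (a ∷ as) (s≤s i≤) = +-monoʳ-≤ a (take-mono i as i≤)
    take-suc : ∀ as → sum (take (suc (length as)) (as ++ m ∷ bs)) ≡ sum as + m
    take-suc []       = +-identityʳ m
    take-suc (a ∷ as) = trans (cong (a +_) (take-suc as)) (sym (+-assoc a (sum as) m))
    above : T < 2 * sum (take (suc (length as)) (as ++ m ∷ bs))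
    above = <-≤-trans (n<2*suc⌊n/2⌋ T) (*-monoʳ-≤ 2 (≤-trans <as+m (≤-reflexive (sym (take-suc as)))))

-- The potential argument behind linear time. A call of build on inputs of total
-- size s costs O(1 + log s) besides its recursive calls, and pays for the
-- logarithm with the logarithms of the pieces: if no piece exceeds s / 2, then
-- two of them are at least s / 4.
λ₂ : ℕ → ℕ
λ₂ = ⌈log₂_⌉

λ₂-quarter : ∀ {s} c → 1 ≤ s → s ≤ 4 * c → λ₂ s ≤ 2 + λ₂ c
λ₂-quarter {s} zero    1≤s s≤ = ⊥-elim (<⇒≱ 1≤s s≤)
λ₂-quarter {s} (suc c) 1≤s s≤ = begin
  λ₂ s                       ≤⟨ ⌈log₂⌉-mono-≤ s≤ ⟩
  λ₂ (4 * suc c)             ≡⟨ cong λ₂ (lem (suc c)) ⟩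
  λ₂ (2 * (2 * suc c))       ≡⟨ ⌈log₂2*n⌉≡1+⌈log₂n⌉ (2 * suc c) ⟩
  1 + λ₂ (2 * suc c)         ≡⟨ cong suc (⌈log₂2*n⌉≡1+⌈log₂n⌉ (suc c)) ⟩
  2 + λ₂ (suc c)             ∎
  where
  open ≤-Reasoning
  lem : ∀ c → 4 * c ≡ 2 * (2 * c)
  lem = solve-∀

private
  other-quarter : ∀ {a b c s} → 2 * b ≤ s → a + (b + c) ≡ s → 4 * c ≤ s → s ≤ 4 * a
  other-quarter {a} {b} {c} 2b≤s refl 4c≤s = certificate 0 (+-mono-≤ (*-monoʳ-≤ 2 2b≤s) 4c≤s) (lem a b c)
    where
    lem : ∀ a b c → a + (b + c) + (2 * (a + (b + c)) + (a + (b + c))) + 0 ≡ 4 * a + (2 * (2 * b) + 4 * c)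
    lem = solve-∀

module Potential (M : ℕ) {a m b s Ca Cb C Πa Πb : ℕ}
  (1≤s : 1 ≤ s) (sum≡ : a + (m + b) ≡ s) (2a≤s : 2 * a ≤ s) (2b≤s : 2 * b ≤ s)
  (Ca≤ : Ca + 2 * M * λ₂ a ≤ Πa) (Cb≤ : Cb + 2 * M * λ₂ b ≤ Πb)
  (C≤ : C ≤ 2 * M + M * λ₂ s + (Ca + Cb)) where

  private
    two-quarters : s ≤ 4 * m ⊎ (s ≤ 4 * a × s ≤ 4 * b)
    two-quarters with s ≤? 4 * m
    ... | yes s≤4m = inj₁ s≤4m
    ... | no  s≰4m = inj₂
      ( other-quarter {a} {b} {m} 2b≤s (trans (cong (a +_) (+-comm b m)) sum≡) 4m≤s
      , other-quarter {b} {a} {m} 2a≤s (trans (lem a m b) sum≡) 4m≤s )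
      where
      4m≤s = <⇒≤ (≰⇒> s≰4m)
      lem : ∀ a m b → b + (a + m) ≡ a + (m + b)
      lem = solve-∀

  -- The search takes `M * λ₂ s` and twice as much must be left over, so three units of the
  -- logarithm are wanted. If `m` is at least a quarter of `s`, its coefficient 3 supplies them;
  -- otherwise `a` and `b` supply two units each.
  pays-2 : C + 2 * M * λ₂ s ≤ Πa + (3 * M * λ₂ m + 10 * M + Πb)
  pays-2 with two-quarters
  ... | inj₁ s≤4m = certificate (2 * M + 2 * M * λ₂ a + 2 * M * λ₂ b)
        (+-mono-≤ (+-mono-≤ Ca≤ Cb≤) (+-mono-≤ C≤ (*-monoʳ-≤ (3 * M) (λ₂-quarter m 1≤s s≤4m))))
        (lem M (λ₂ a) (λ₂ b) (λ₂ m) (λ₂ s) Ca Cb C Πa Πb)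
    where
    lem : ∀ M la lb lm ls Ca Cb C Πa Πb →
          C + 2 * M * ls + (Πa + Πb + (2 * M + M * ls + (Ca + Cb) + 3 * M * (2 + lm)))
            + (2 * M + 2 * M * la + 2 * M * lb) ≡
          Πa + (3 * M * lm + 10 * M + Πb) + (Ca + 2 * M * la + (Cb + 2 * M * lb) + (C + 3 * M * ls))
    lem = solve-∀
  ... | inj₂ (s≤4a , s≤4b) = certificate (M * λ₂ s + 3 * M * λ₂ m)
        (+-mono-≤ (+-mono-≤ Ca≤ Cb≤) (+-mono-≤ C≤
          (+-mono-≤ (*-monoʳ-≤ (2 * M) (λ₂-quarter a 1≤s s≤4a)) (*-monoʳ-≤ (2 * M) (λ₂-quarter b 1≤s s≤4b)))))
        (lem M (λ₂ a) (λ₂ b) (λ₂ m) (λ₂ s) Ca Cb C Πa Πb)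
    where
    lem : ∀ M la lb lm ls Ca Cb C Πa Πb →
          C + 2 * M * ls + (Πa + Πb + (2 * M + M * ls + (Ca + Cb) + (2 * M * (2 + la) + 2 * M * (2 + lb))))
            + (M * ls + 3 * M * lm) ≡
          Πa + (3 * M * lm + 10 * M + Πb)
            + (Ca + 2 * M * la + (Cb + 2 * M * lb) + (C + (2 * M * ls + 2 * M * ls)))
    lem = solve-∀

  -- Now four units are wanted, more than `m` alone has. As no piece exceeds half of `s`, two of the
  -- three reach a quarter, and each gives at least two units. The coefficient 3 on both sides lets
  -- the bound telescope through `Balance`.
  pays-3 : 2 * m ≤ s → C + 3 * M * λ₂ s ≤ Πa + (3 * M * λ₂ m + 10 * M + Πb)
  pays-3 2m≤s with two-quarters | s ≤? 4 * a
  ... | inj₂ (s≤4a , s≤4b) | _ = certificate (3 * M * λ₂ m)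
        (+-mono-≤ (+-mono-≤ Ca≤ Cb≤) (+-mono-≤ C≤
          (+-mono-≤ (*-monoʳ-≤ (2 * M) (λ₂-quarter a 1≤s s≤4a)) (*-monoʳ-≤ (2 * M) (λ₂-quarter b 1≤s s≤4b)))))
        (lem M (λ₂ a) (λ₂ b) (λ₂ m) (λ₂ s) Ca Cb C Πa Πb)
    where
    lem : ∀ M la lb lm ls Ca Cb C Πa Πb →
          C + 3 * M * ls + (Πa + Πb + (2 * M + M * ls + (Ca + Cb) + (2 * M * (2 + la) + 2 * M * (2 + lb))))
            + 3 * M * lm ≡
          Πa + (3 * M * lm + 10 * M + Πb)
            + (Ca + 2 * M * la + (Cb + 2 * M * lb) + (C + (2 * M * ls + 2 * M * ls)))
    lem = solve-∀
  ... | inj₁ s≤4m | yes s≤4a = certificate (M * λ₂ m + 2 * M * λ₂ b)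
        (+-mono-≤ (+-mono-≤ Ca≤ Cb≤) (+-mono-≤ C≤
          (+-mono-≤ (*-monoʳ-≤ (2 * M) (λ₂-quarter a 1≤s s≤4a)) (*-monoʳ-≤ (2 * M) (λ₂-quarter m 1≤s s≤4m)))))
        (lem M (λ₂ a) (λ₂ b) (λ₂ m) (λ₂ s) Ca Cb C Πa Πb)
    where
    lem : ∀ M la lb lm ls Ca Cb C Πa Πb →
          C + 3 * M * ls + (Πa + Πb + (2 * M + M * ls + (Ca + Cb) + (2 * M * (2 + la) + 2 * M * (2 + lm))))
            + (M * lm + 2 * M * lb) ≡
          Πa + (3 * M * lm + 10 * M + Πb)
            + (Ca + 2 * M * la + (Cb + 2 * M * lb) + (C + (2 * M * ls + 2 * M * ls)))
    lem = solve-∀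
  ... | inj₁ s≤4m | no s≰4a = certificate (M * λ₂ m + 2 * M * λ₂ a)
        (+-mono-≤ (+-mono-≤ Ca≤ Cb≤) (+-mono-≤ C≤
          (+-mono-≤ (*-monoʳ-≤ (2 * M) (λ₂-quarter b 1≤s s≤4b)) (*-monoʳ-≤ (2 * M) (λ₂-quarter m 1≤s s≤4m)))))
        (lem M (λ₂ a) (λ₂ b) (λ₂ m) (λ₂ s) Ca Cb C Πa Πb)
    where
    s≤4b : s ≤ 4 * b
    s≤4b = other-quarter {b} {m} {a} 2m≤s (trans (rot a m b) sum≡) (<⇒≤ (≰⇒> s≰4a))
      where
      rot : ∀ a m b → b + (m + a) ≡ a + (m + b)
      rot = solve-∀
    lem : ∀ M la lb lm ls Ca Cb C Πa Πb →
          C + 3 * M * ls + (Πa + Πb + (2 * M + M * ls + (Ca + Cb) + (2 * M * (2 + lb) + 2 * M * (2 + lm))))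
            + (M * lm + 2 * M * la) ≡
          Πa + (3 * M * lm + 10 * M + Πb)
            + (Ca + 2 * M * la + (Cb + 2 * M * lb) + (C + (2 * M * ls + 2 * M * ls)))
    lem = solve-∀

-- Values that the program handles

mutual
  annotated : ∀ {n} → Tree n → Val
  annotated t = cell (nat (leaves t)) (annotation t)

  annotation : ∀ {n} → Tree n → Val
  annotation (leaf e)   = nat (toℕ e)
  annotation (node l r) = cell (annotated l) (annotated r)

nodes : ∀ {n} → Tree n → ℕ
nodes (leaf _)   = 1
nodes (node l r) = suc (nodes l + nodes r)

nodes≤2*leaves : ∀ {n} (t : Tree n) → suc (nodes t) ≤ 2 * leaves t
nodes≤2*leaves (leaf _)   = ≤-refl
nodes≤2*leaves (node l r) =
  certificate 0 (+-mono-≤ (nodes≤2*leaves l) (nodes≤2*leaves r)) (lem (nodes l) (nodes r) (leaves l) (leaves r))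
  where
  lem : ∀ p q x y → suc (suc (p + q)) + (2 * x + 2 * y) + 0 ≡ 2 * (x + y) + (suc p + suc q)
  lem = solve-∀

split-at : ∀ {a} {V : Set a} k (xs : List V) → k < length xs →
           ∃[ as ] ∃[ y ] ∃[ bs ] (xs ≡ as ++ y ∷ bs × length as ≡ k)
split-at zero    (x ∷ xs) _         = [] , x , xs , refl , refl
split-at (suc k) (x ∷ xs) (s≤s k<) with split-at k xs k<
... | as , y , bs , refl , len = x ∷ as , y , bs , refl , cong suc len

-- The tree is meant to represent the family, see RepresentsBlock.
Block : ℕ → Set
Block n = Tree n × Family n

module _ {n : ℕ} where

  leaves# : Block n → ℕ
  leaves# b = leaves (proj₁ b)

  total : List (Block n) → ℕ
  total bs = sum (map leaves# bs)

  total-++ : ∀ as {bs} → total (as ++ bs) ≡ total as + total bs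
  total-++ as {bs} = trans (cong sum (map-++ leaves# as bs)) (sum-++ (map leaves# as) (map leaves# bs))

  length≤total : ∀ bs → length bs ≤ total bs
  length≤total []       = z≤n
  length≤total (b ∷ bs) = +-mono-≤ (1≤leaves (proj₁ b)) (length≤total bs)

  toRooted : Block n → Rooted n
  toRooted (t , 𝒟) = rooted (rootCluster t) 𝒟

  toRooteds : List (Block n) → List (Rooted n)
  toRooteds = map toRooted

  RepresentsBlock : Block n → Set
  RepresentsBlock (t , 𝒟) = t Represents 𝒟

  DisjointBlocks : Block n → Block n → Set
  DisjointBlocks b b′ = DisjointRoots (toRooted b) (toRooted b′)

  sizes≡leaves : ∀ {bs} → All RepresentsBlock bs → map size (toRooteds bs) ≡ map leaves# bs
  sizes≡leaves []                      = refl
  sizes≡leaves {b ∷ bs} ((d , _) ∷ rep) = cong₂ _∷_ (sym (leaves≡∣root∣ (proj₁ b) d)) (sizes≡leaves rep)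

  blockVal : Block n → Val
  blockVal (t , _) = cell (nat (leaves t)) (treeVal t)

  blocksVal : List (Block n) → Val
  blocksVal bs = listVal (map blockVal bs)

  entry : ℕ → Block n → Val
  entry p (t , _) = cell (nat p) (cell (nat (p + leaves t)) (treeVal t))

  entryVals : ℕ → List (Block n) → List Val
  entryVals p []       = []
  entryVals p (b ∷ bs) = entry p b ∷ entryVals (p + leaves# b) bs

  length-entryVals : ∀ p bs → length (entryVals p bs) ≡ length bs
  length-entryVals p []       = refl
  length-entryVals p (b ∷ bs) = cong suc (length-entryVals (p + leaves# b) bs)

  entryVals-++ : ∀ p as {b cs} → entryVals p (as ++ b ∷ cs) ≡
                 entryVals p as ++ entry (p + total as) b ∷ entryVals (p + total as + leaves# b) cs
  entryVals-++ p []       {b} {cs} = cong (λ q → entry q b ∷ entryVals (q + leaves# b) cs) (sym (+-identityʳ p))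
  entryVals-++ p (a ∷ as) {b} {cs} = cong (entry p a ∷_) (trans (entryVals-++ (p + leaves# a) as)
    (cong (λ q → entryVals (p + leaves# a) as ++ entry q b ∷ entryVals (q + leaves# b) cs)
          (+-assoc p (leaves# a) (total as))))

  -- The summand `10 * M` is made up of `2 * M` for the overhead of a call and `4 * M` for each of
  -- two paying pieces, whose logarithms may fall short of that of the total by 2.
  potential : List (Block n) → ℕ
  potential bs = sum (map (λ b → 3 * M * λ₂ (leaves# b) + 10 * M) bs)

  potential-++ : ∀ as {bs} → potential (as ++ bs) ≡ potential as + potential bs
  potential-++ as {bs} = trans (cong sum (map-++ _ as bs)) (sum-++ (map _ as) (map _ bs))

-- Annotation, list functions and binary search

module Costs (W : ℕ) where
  open Semantics code W

  ⇓function : ∀ g {u v d b} → M + d ≤ b → Eval≤ (u ∷ []) (lookup code g) v d → Call g u v b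
  ⇓function g {d = d} M+d≤b (c , E , h) = c , E , ≤-trans h (≤-trans (+-monoˡ-≤ d (weight≤M W g)) M+d≤b)

  M+0≤M*1 : M + 0 ≤ M * 1
  M+0≤M*1 = ≤-reflexive (trans (+-identityʳ M) (sym (*-identityʳ M)))

  annotate-call : ∀ {n} (t : Tree n) → leaves t ≤ W → Call annotateᶠ (treeVal t) (annotated t) (M * nodes t)
  annotate-call (leaf e) _ = ⇓function annotateᶠ M+0≤M*1
    (⇓match-nat (⇓var _) (⇓cons ⇓lit (⇓var _)))
  annotate-call (node l r) ≤W = ⇓function annotateᶠ (≤-reflexive (lem M (nodes l) (nodes r)))
    (⇓match-cell (⇓var _)
      (⇓bind (⇓call (annotate-call l (≤-trans (m≤m+n (leaves l) (leaves r)) ≤W)) (⇓var _))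
      (⇓bind (⇓call (annotate-call r (≤-trans (m≤n+m (leaves r) (leaves l)) ≤W)) (⇓var _))
      (⇓match-cell (⇓var _)
      (⇓match-cell (⇓var _)
      (⇓cons (⇓add ≤W (⇓var _) (⇓var _)) (⇓cons (⇓var _) (⇓var _))))))))
    where
    lem : ∀ m p q → m + (m * p + (m * q + 0)) ≡ m * suc (p + q)
    lem = solve-∀

  module _ {n : ℕ} where

    length-call : (bs : List (Block n)) → length bs ≤ W →
                  Call lengthᶠ (blocksVal bs) (nat (length bs)) (M * suc (length bs))
    length-call []       _  = ⇓function lengthᶠ M+0≤M*1 (⇓match-nat (⇓var _) ⇓lit)
    length-call (b ∷ bs) ≤W = ⇓function lengthᶠ (≤-reflexive (sym (*-suc M (suc (length bs)))))
      (⇓match-cell (⇓var _) (⇓add ≤W ⇓lit (⇓call (length-call bs (≤-trans (n≤1+n _) ≤W)) (⇓var _))))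

    entries-call : ∀ p (bs : List (Block n)) → p + total bs ≤ W →
                   Call entriesᶠ (cell (nat p) (blocksVal bs)) (listVal (entryVals p bs)) (M * suc (length bs))
    entries-call p []       _  = ⇓function entriesᶠ M+0≤M*1
      (⇓match-cell (⇓var _) (⇓match-nat (⇓var _) ⇓lit))
    entries-call p (b ∷ bs) ≤W = ⇓function entriesᶠ (≤-reflexive (sym (*-suc M (suc (length bs)))))
      (⇓match-cell (⇓var _)
        (⇓match-cell (⇓var _)
        (⇓match-cell (⇓var _)
        (⇓bind (⇓add (≤-trans (m≤m+n (p + leaves# b) (total bs)) ≤W′) (⇓var _) (⇓var _))
        (⇓cons (⇓cons (⇓var _) (⇓cons (⇓var _) (⇓var _)))
               (⇓call (entries-call (p + leaves# b) bs ≤W′) (⇓cons (⇓var _) (⇓var _))))))))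
      where
      ≤W′ : p + leaves# b + total bs ≤ W
      ≤W′ = ≤-trans (≤-reflexive (+-assoc p (leaves# b) (total bs))) ≤W

    module _ (bs : List (Block n)) (≤W : total bs ≤ W) where

      ⇓entry : ∀ {m} {ρ : Vec Val m} {e₁ e₂ d₁ d₂} as {b cs} → bs ≡ as ++ b ∷ cs →
               Eval≤ ρ e₁ (arr (entryVals 0 bs)) d₁ → Eval≤ ρ e₂ (nat (length as)) d₂ →
               Eval≤ ρ (index e₁ e₂) (entry (total as) b) (d₁ + d₂)
      ⇓entry as refl E₁ E₂ = ⇓index (entryVals 0 as) (entryVals-++ 0 as) E₁
        (⇓≡ (cong nat (sym (length-entryVals 0 as))) E₂)

      length-≤W : ∀ as {cs} → bs ≡ as ++ cs → length as ≤ W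
      length-≤W as {cs} refl = begin
        length as                 ≤⟨ length≤total as ⟩
        total as                  ≤⟨ m≤m+n (total as) (total cs) ⟩
        total as + total cs       ≡⟨ sym (total-++ as) ⟩
        total (as ++ cs)          ≤⟨ ≤W ⟩
        W                         ∎
        where open ≤-Reasoning

      total-≤W : ∀ as {cs} → bs ≡ as ++ cs → total as ≤ W
      total-≤W as {cs} refl = ≤-trans (m≤m+n (total as) (total cs)) (≤-trans (≤-reflexive (sym (total-++ as))) ≤W)

      range : List (Block n) → List (Block n) → Val
      range pre mid = cell (nat (length pre)) (nat (length mid))

      λ₂-half : ∀ {d d′} → 2 ≤ d → d′ ≤ ⌈ d /2⌉ → suc (λ₂ d′) ≤ λ₂ d
      λ₂-half {d} {d′} 2≤d d′≤ = begin
        suc (λ₂ d′)         ≤⟨ s≤s (⌈log₂⌉-mono-≤ d′≤) ⟩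
        suc (λ₂ ⌈ d /2⌉)    ≡⟨ cong suc (⌈log₂⌈n/2⌉⌉≡⌈log₂n⌉∸1 d) ⟩
        suc (λ₂ d ∸ 1)      ≡⟨ m+[n∸m]≡n (⌈log₂⌉-mono-≤ 2≤d) ⟩
        λ₂ d                ∎
        where open ≤-Reasoning

      record Found (h : ℕ) (pre mid : List (Block n)) : Set where
        field
          {ls rs} : List (Block n)
          {x}     : Block n
          mid≡    : mid ≡ ls ++ x ∷ rs
          low     : total (pre ++ ls) ≤ h
          high    : h < total (pre ++ ls) + leaves# x
          run     : Call searchᶠ (cell (cell (arr (entryVals 0 bs)) (nat h)) (range pre mid))
                      (nat (length (pre ++ ls))) (M * suc (λ₂ (length mid)))

      -- The position `h` stays inside the blocks of `mid`, so the range never runs empty. A probe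
      -- compares `h` with the start of the right half, a prefix sum stored in the array. This half
      -- is the larger one, with `⌈ d /2⌉` blocks, and even there the logarithm drops by one.
      search-call : ∀ h pre mid post → bs ≡ pre ++ mid ++ post → total pre ≤ h → h < total (pre ++ mid) →
                    Acc _<_ (length mid) → Found h pre mid
      search-call h pre [] post _ low high _ =
        ⊥-elim (<⇒≱ high (≤-trans (≤-reflexive (cong total (++-identityʳ pre))) low))
      search-call h pre (b ∷ []) post _ low high _ = record
        { ls = [] ; mid≡ = refl
        ; low = ≤-trans (≤-reflexive (cong total (++-identityʳ pre))) low
        ; high = <-≤-trans high (≤-reflexive (trans (total-++ pre)
                   (cong₂ _+_ (cong total (sym (++-identityʳ pre))) (+-identityʳ (leaves# b)))))
        ; run = ⇓function searchᶠ (≤-trans (≤-reflexive (+-identityʳ M)) (m≤m*n M (suc (λ₂ 1))))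
            (⇓match-cell (⇓var _)
              (⇓match-cell (⇓var _)
              (⇓match-cell (⇓var _)
              (⇓≡ (cong (nat ∘ length) (sym (++-identityʳ pre)))
              (⇓if-yes ≤-refl (⇓var _) ⇓lit (⇓var _))))))
        }
      search-call h pre mid@(_ ∷ _ ∷ _) post bs≡ low high (acc rec)
        with split-at ⌊ length mid /2⌋ mid (⌊n/2⌋<n _)
      ... | m₁ , y , m₂ , mid≡ , len₁ = case total (pre ++ m₁) ≤? h of λ where
          (yes ≤h) →
            let r = search-call h (pre ++ m₁) (y ∷ m₂) post bs≡ʳ ≤h
                      (subst (h <_) (cong total (trans (cong (pre ++_) mid≡) (sym (++-assoc pre m₁ (y ∷ m₂))))) high)
                      (rec len₂<)
                module r = Found r
            in record
              { ls = m₁ ++ r.ls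
              ; mid≡ = trans mid≡ (trans (cong (m₁ ++_) r.mid≡) (sym (++-assoc m₁ r.ls (r.x ∷ r.rs))))
              ; low = subst (λ z → total z ≤ h) (++-assoc pre m₁ r.ls) r.low
              ; high = subst (λ z → h < total z + leaves# r.x) (++-assoc pre m₁ r.ls) r.high
              ; run = ⇓function searchᶠ (cost (≤-reflexive len₂))
                  (prefix (⇓≡ (cong (nat ∘ length) (++-assoc pre m₁ r.ls))
                    (⇓if-yes ≤h (⇓var _) (⇓var _) (⇓call r.run
                      (⇓cons (⇓cons (⇓var _) (⇓var _)) (⇓cons (⇓var _)
                        (⇓≡ (cong nat len∸) (⇓sub (⇓var _) (⇓var _)))))))))
              }
          (no ≰h) →
            let r = search-call h pre m₁ (y ∷ m₂ ++ post) bs≡ˡ low (≰⇒> ≰h) (rec len₁<)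
                module r = Found r
            in record
              { mid≡ = trans mid≡ (trans (cong (_++ y ∷ m₂) r.mid≡) (++-assoc r.ls (r.x ∷ r.rs) (y ∷ m₂)))
              ; low = r.low
              ; high = r.high
              ; run = ⇓function searchᶠ (cost (≤-trans (≤-reflexive len₁) (⌊n/2⌋≤⌈n/2⌉ d)))
                  (prefix (⇓if-no (≰⇒> ≰h) (⇓var _) (⇓var _) (⇓call r.run
                      (⇓cons (⇓cons (⇓var _) (⇓var _)) (⇓cons (⇓var _) (⇓var _))))))
              }
        where
        d = length mid
        2≤d : 2 ≤ d
        2≤d = s≤s (s≤s z≤n)
        len₁+len₂ : length m₁ + length (y ∷ m₂) ≡ d
        len₁+len₂ = trans (sym (length-++ m₁)) (cong length (sym mid≡))
        len∸ : d ∸ length m₁ ≡ length (y ∷ m₂)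
        len∸ = trans (cong (_∸ length m₁) (sym len₁+len₂)) (m+n∸m≡n (length m₁) (length (y ∷ m₂)))
        len₂ : length (y ∷ m₂) ≡ ⌈ d /2⌉
        len₂ = +-cancelˡ-≡ ⌊ d /2⌋ _ _
          (trans (cong (_+ length (y ∷ m₂)) (sym len₁)) (trans len₁+len₂ (sym (⌊n/2⌋+⌈n/2⌉≡n d))))
        len₁< : length m₁ < d
        len₁< = subst (_< d) (sym len₁) (⌊n/2⌋<n _)
        len₂< : length (y ∷ m₂) < d
        len₂< = subst (_< d) (sym len₂) (⌈n/2⌉<n _)
        bs≡ʳ : bs ≡ (pre ++ m₁) ++ (y ∷ m₂) ++ post
        bs≡ʳ = trans bs≡ (trans (cong (λ z → pre ++ z ++ post) mid≡)
          (trans (cong (pre ++_) (++-assoc m₁ (y ∷ m₂) post)) (sym (++-assoc pre m₁ ((y ∷ m₂) ++ post)))))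
        bs≡ˡ : bs ≡ pre ++ m₁ ++ y ∷ m₂ ++ post
        bs≡ˡ = trans bs≡ʳ (++-assoc pre m₁ ((y ∷ m₂) ++ post))
        cost : ∀ {d′} → d′ ≤ ⌈ d /2⌉ → M + M * suc (λ₂ d′) ≤ M * suc (λ₂ d)
        cost {d′} d′≤ = ≤-trans (≤-reflexive (sym (*-suc M (suc (λ₂ d′))))) (*-monoʳ-≤ M (s≤s (λ₂-half 2≤d d′≤)))
        prefix : ∀ {v c} →
                 Eval≤ (nat (total (pre ++ m₁)) ∷ cell (nat (total (pre ++ m₁) + leaves# y)) (treeVal (proj₁ y)) ∷
                        nat (length (pre ++ m₁)) ∷ nat (length m₁) ∷ nat (length pre) ∷ nat d ∷
                        arr (entryVals 0 bs) ∷ nat h ∷ cell (arr (entryVals 0 bs)) (nat h) ∷ range pre mid ∷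
                        cell (cell (arr (entryVals 0 bs)) (nat h)) (range pre mid) ∷ []) searchSides v c →
                 Eval≤ (cell (cell (arr (entryVals 0 bs)) (nat h)) (range pre mid) ∷ []) search v c
        prefix E = ⇓match-cell (⇓var _)
              (⇓match-cell (⇓var _)
              (⇓match-cell (⇓var _)
              (⇓if-no 2≤d (⇓var _) ⇓lit
              (⇓bind (⇓≡ (cong nat (sym len₁)) (⇓half (⇓var _)))
              (⇓bind (⇓≡ (cong nat (sym (length-++ pre)))
                (⇓add (≤-trans (≤-reflexive (sym (length-++ pre))) (length-≤W (pre ++ m₁) bs≡ʳ)) (⇓var _) (⇓var _)))
              (⇓match-cell (⇓entry (pre ++ m₁) bs≡ʳ (⇓var _) (⇓var _)) E))))))

-- Complete on an interval of blocks

unsnoc : ∀ {a} {V : Set a} (x : V) xs → ∃[ ys ] ∃[ y ] (x ∷ xs ≡ ys ++ y ∷ [])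
unsnoc x []        = [] , x , refl
unsnoc x (x′ ∷ xs) with unsnoc x′ xs
... | ys , y , eq = x ∷ ys , y , cong (x ∷_) eq

module Build (W : ℕ) {n : ℕ} (bs : List (Block n)) (≤W : total bs ≤ W) where
  open Semantics code W
  open Costs W

  private
    E : Val
    E = arr (entryVals 0 bs)

  -- Recursive calls rely on `pays` only, since inside a subinterval one block may exceed half of
  -- the total. The stronger `paysHeavy` is for the outermost call, on the blocks of a heavy path.
  record Built (pre mid : List (Block n)) : Set where
    field
      {tree}     : Tree n
      {fam}      : Family n
      {cost}     : ℕ
      run        : Call buildᶠ (cell E (range bs ≤W pre mid)) (treeVal tree) cost
      completed  : Complete (toRooteds mid) fam
      represents : tree Represents fam
      root≡      : rootCluster tree ≡ unionOfRoots (toRooteds mid)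
      pays       : cost + 2 * M * λ₂ (total mid) ≤ potential mid
      paysHeavy  : All (λ b → 2 * leaves# b ≤ total mid) mid →
                   cost + 3 * M * λ₂ (total mid) ≤ potential mid

  private
    pays-nothing : 0 + 2 * M * λ₂ 0 ≤ 0
    pays-nothing = ≤-reflexive (*-zeroʳ (2 * M))

  -- Whether anything precedes the split index is decided here, for arbitrary code fragments; with
  -- `RightPart` for the other side, `build-call` evaluates its body once instead of in four cases.
  record LeftPart {m} (ρ : Vec Val m) (e : Code m) (ls : List (Block n)) (x : Block n) : Set where
    field
      {tree}     : Tree n
      {ℬ}        : Family n
      {cost}     : ℕ
      eval       : Eval≤ ρ e (treeVal tree) cost
      upToSplit  : UpToSplit (toRooteds ls) (toRooted x) ℬ
      represents : tree Represents ℬ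
      root≡      : rootCluster tree ≡ unionOfRoots (toRooteds ls ∷ʳ toRooted x)
      pays       : cost + 2 * M * λ₂ (total ls) ≤ potential ls

  leftPart : ∀ {m} {ρ : Vec Val m} {iᵉ loᵉ xᵉ Aᵉ} pre ls x → (ls ≢ [] → Built pre ls) →
             RepresentsBlock x → All (λ b → DisjointBlocks b x) ls →
             Eval≤ ρ iᵉ (nat (length (pre ++ ls))) 0 → Eval≤ ρ loᵉ (nat (length pre)) 0 →
             Eval≤ ρ xᵉ (treeVal (proj₁ x)) 0 → Eval≤ ρ Aᵉ E 0 →
             LeftPart ρ (ifle iᵉ loᵉ xᵉ (cons (call buildᶠ (cons Aᵉ (cons loᵉ (sub iᵉ loᵉ)))) xᵉ)) ls x
  leftPart pre [] x _ repˣ _ iᵛ loᵛ xᵛ Aᵛ = record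
    { eval       = ⇓if-yes (≤-reflexive (cong length (++-identityʳ pre))) iᵛ loᵛ xᵛ
    ; upToSplit  = j≡1
    ; represents = repˣ
    ; root≡      = sym (∪-identityʳ _)
    ; pays       = pays-nothing
    }
  leftPart {ρ = ρ} pre ls@(l ∷ ls′) x built repˣ dis iᵛ loᵛ xᵛ Aᵛ = record
    { eval       = subst (Eval≤ ρ _ _) (+-identityʳ B.cost)
        (⇓if-no lo<i iᵛ loᵛ (⇓cons (⇓call B.run (⇓cons Aᵛ (⇓cons loᵛ (⇓≡ (cong nat len∸) (⇓sub iᵛ loᵛ))))) xᵛ))
    ; upToSplit  = j>1 B.completed
    ; represents = represents-node B.represents repˣ
        (subst (λ Z → Disjoint Z (rootCluster (proj₁ x))) (sym B.root≡)
          (disjoint-sym (disjoint-unionOfRoots (All.map⁺ (All.map disjoint-sym dis)))))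
        (trans (cong (_∪ rootCluster (proj₁ x)) B.root≡) (sym (unionOfRoots-∷ʳ (toRooteds ls) (toRooted x))))
    ; root≡      = trans (cong (_∪ rootCluster (proj₁ x)) B.root≡) (sym (unionOfRoots-∷ʳ (toRooteds ls) (toRooted x)))
    ; pays       = B.pays
    }
    where
    module B = Built (built λ ())
    len : length (pre ++ ls) ≡ length pre + length ls
    len = length-++ pre
    len∸ : length (pre ++ ls) ∸ length pre ≡ length ls
    len∸ = trans (cong (_∸ length pre) len) (m+n∸m≡n (length pre) (length ls))
    lo<i : length pre < length (pre ++ ls)
    lo<i = subst (length pre <_) (sym len) (m<m+n (length pre) z<s)

  record RightPart {m} (ρ : Vec Val m) (e : Code m) (C B : Subset n) (ℬ : Family n) (rs : List (Block n)) : Set where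
    field
      {tree}     : Tree n
      {fam}      : Family n
      {cost}     : ℕ
      eval       : Eval≤ ρ e (treeVal tree) cost
      afterSplit : AfterSplit C ℬ (toRooteds rs) fam
      represents : tree Represents fam
      root≡      : rootCluster tree ≡ B ∪ unionOfRoots (toRooteds rs)
      pays       : cost + 2 * M * λ₂ (total rs) ≤ potential rs

  rightPart : ∀ {m} {ρ : Vec Val m} {hiᵉ i⁺ᵉ Bᵉ Aᵉ hi C ℬ t} pre rs → (rs ≢ [] → Built pre rs) →
              t Represents ℬ → Disjoint (rootCluster t) (unionOfRoots (toRooteds rs)) →
              rootCluster t ∪ unionOfRoots (toRooteds rs) ≡ C → hi ≡ length pre + length rs →
              Eval≤ ρ hiᵉ (nat hi) 0 → Eval≤ ρ i⁺ᵉ (nat (length pre)) 0 →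
              Eval≤ ρ Bᵉ (treeVal t) 0 → Eval≤ ρ Aᵉ E 0 →
              RightPart ρ (ifle hiᵉ i⁺ᵉ Bᵉ (cons Bᵉ (call buildᶠ (cons Aᵉ (cons i⁺ᵉ (sub hiᵉ i⁺ᵉ))))))
                C (rootCluster t) ℬ rs
  rightPart pre [] _ repᵗ _ _ refl hiᵛ iᵛ Bᵛ Aᵛ = record
    { eval       = ⇓if-yes (≤-reflexive (+-identityʳ (length pre))) hiᵛ iᵛ Bᵛ
    ; afterSplit = j≡k
    ; represents = repᵗ
    ; root≡      = sym (∪-identityʳ _)
    ; pays       = pays-nothing
    }
  rightPart {t = t} pre rs@(_ ∷ _) built repᵗ dis C≡ refl hiᵛ iᵛ Bᵛ Aᵛ = record
    { eval       = ⇓if-no (m<m+n (length pre) z<s) hiᵛ iᵛ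
        (⇓cons Bᵛ (⇓call B.run (⇓cons Aᵛ (⇓cons iᵛ (⇓≡ (cong nat (m+n∸m≡n (length pre) (length rs))) (⇓sub hiᵛ iᵛ))))))
    ; afterSplit = j<k B.completed
    ; represents = represents-node repᵗ B.represents (subst (Disjoint (rootCluster t)) (sym B.root≡) dis)
        (trans (cong (rootCluster t ∪_) B.root≡) C≡)
    ; root≡      = cong (rootCluster t ∪_) B.root≡
    ; pays       = B.pays
    }
    where
    module B = Built (built λ ())

  build-call : ∀ pre mid post → mid ≢ [] → bs ≡ pre ++ mid ++ post → All RepresentsBlock mid →
               AllPairs DisjointBlocks mid → Acc _<_ (length mid) → Built pre mid
  build-call pre []              post mid≢[] _   _   _    _         = ⊥-elim (mid≢[] refl)
  build-call pre mid@(b₀ ∷ mid′) post mid≢[] bs≡ rep disj (acc rec) with unsnoc b₀ mid′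
  -- The last block is singled out because its entry stores the end of the interval.
  ... | init , b₁ , mid≡∷ʳ = record
    { run        = ⇓function buildᶠ ≤-refl body
    ; completed  = complete (trans (cong toRooteds F.mid≡) (map-++ toRooted ls (x ∷ rs))) isSplit L.upToSplit R.afterSplit
    ; represents = R.represents
    ; root≡      = trans R.root≡ union≡
    ; pays       = ≤-trans Pays.pays-2 (≤-reflexive potential≡)
    ; paysHeavy  = λ light → ≤-trans
        (Pays.pays-3 (All.lookup light (subst (x ∈ˡ_) (sym F.mid≡) (∈-++⁺ʳ ls (here refl)))))
        (≤-reflexive potential≡)
    }
    where
    s = total mid
    h = total pre + ⌊ s /2⌋
    1≤s : 1 ≤ s
    1≤s = ≤-trans (1≤leaves (proj₁ b₀)) (m≤m+n (leaves# b₀) (total mid′))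
    bs≡pm : bs ≡ (pre ++ mid) ++ post
    bs≡pm = trans bs≡ (sym (++-assoc pre mid post))
    ⌊s/2⌋<s : ⌊ s /2⌋ < s
    ⌊s/2⌋<s = n≥1⇒⌊n/2⌋<n s 1≤s
      where
      n≥1⇒⌊n/2⌋<n : ∀ n → 1 ≤ n → ⌊ n /2⌋ < n
      n≥1⇒⌊n/2⌋<n (suc n) _ = ⌊n/2⌋<n n
    found : Found bs ≤W h pre mid
    found = search-call bs ≤W h pre mid post bs≡ (m≤m+n (total pre) _)
      (subst (h <_) (sym (total-++ pre)) (+-monoʳ-< (total pre) ⌊s/2⌋<s)) (<-wellFounded _)
    module F = Found found
    open F using (ls; rs; x)
    total≡ : total ls + (leaves# x + total rs) ≡ s
    total≡ = sym (trans (cong total F.mid≡) (total-++ ls))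
    leaves≡ : map leaves# mid ≡ map leaves# ls ++ leaves# x ∷ map leaves# rs
    leaves≡ = trans (cong (map leaves#) F.mid≡) (map-++ leaves# ls (x ∷ rs))
    isSplit′ : IsSplitIndex {n} (map leaves# ls ++ leaves# x ∷ map leaves# rs) (suc (length (map leaves# ls)))
    isSplit′ = splitIndex⁺ {n} (map leaves# ls) (leaves# x) (map leaves# rs)
      (subst (λ z → total ls ≤ ⌊ sum z /2⌋) leaves≡
        (+-cancelˡ-≤ (total pre) _ _ (subst (_≤ h) (total-++ pre) F.low)))
      (subst (λ z → ⌊ sum z /2⌋ < total ls + leaves# x) leaves≡
        (+-cancelˡ-< (total pre) _ _ (subst (h <_) (trans (cong (_+ leaves# x) (total-++ pre))
          (+-assoc (total pre) (total ls) (leaves# x))) F.high)))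
    isSplit : IsSplitIndex {n} (map size (toRooteds mid)) (suc (length (toRooteds ls)))
    isSplit = subst₂ (λ z k → IsSplitIndex {n} z (suc k)) (trans (sym leaves≡) (sym (sizes≡leaves rep)))
      (trans (length-map leaves# ls) (sym (length-map toRooted ls))) isSplit′
    halves : 2 * total ls ≤ s × 2 * total rs ≤ s
    halves = subst (λ z → 2 * total ls ≤ sum z × 2 * total rs ≤ sum z) (sym leaves≡)
      (splitIndex-halves {n} (map leaves# ls) (leaves# x) (map leaves# rs) isSplit′)
    rep′ : All RepresentsBlock (ls ++ x ∷ rs)
    rep′ = subst (All RepresentsBlock) F.mid≡ rep
    repˡ = All.++⁻ˡ ls rep′
    repˣ = All.head (All.++⁻ʳ ls rep′)
    repʳ = All.tail (All.++⁻ʳ ls rep′)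
    parts = AllPairs-++⁻ ls (subst (AllPairs DisjointBlocks) F.mid≡ disj)
    cross : All (λ b → All (DisjointBlocks b) (x ∷ rs)) ls
    cross = proj₂ (proj₂ parts)
    disjʳ : AllPairs DisjointBlocks (x ∷ rs)
    disjʳ = proj₁ (proj₂ parts)
    tail : ∀ {xs} → AllPairs DisjointBlocks (x ∷ xs) → All (DisjointBlocks x) xs × AllPairs DisjointBlocks xs
    tail (d ∷ ds) = d , ds
    length≡ : length mid ≡ length ls + suc (length rs)
    length≡ = trans (cong length F.mid≡) (length-++ ls)
    bs≡ˡ : bs ≡ pre ++ ls ++ (x ∷ rs ++ post)
    bs≡ˡ = trans bs≡ (cong (pre ++_) (trans (cong (_++ post) F.mid≡) (++-assoc ls (x ∷ rs) post)))
    bs≡ˣ : bs ≡ (pre ++ ls) ++ x ∷ rs ++ post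
    bs≡ˣ = trans bs≡ˡ (sym (++-assoc pre ls (x ∷ rs ++ post)))
    pre′ = (pre ++ ls) ∷ʳ x
    bs≡ʳ : bs ≡ pre′ ++ rs ++ post
    bs≡ʳ = trans bs≡ˣ (sym (++-assoc (pre ++ ls) (x ∷ []) (rs ++ post)))
    builtˡ : ls ≢ [] → Built pre ls
    builtˡ ls≢[] = build-call pre ls (x ∷ rs ++ post) ls≢[] bs≡ˡ repˡ (proj₁ parts)
      (rec (subst (length ls <_) (sym length≡) (m<m+n (length ls) z<s)))
    builtʳ : rs ≢ [] → Built pre′ rs
    builtʳ rs≢[] = build-call pre′ rs post rs≢[] bs≡ʳ repʳ (proj₂ (tail disjʳ))
      (rec (subst (length rs <_) (sym length≡) (m≤n+m (suc (length rs)) (length ls))))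

    i hi : ℕ
    i  = length (pre ++ ls)
    hi = length pre + length mid
    length-pre′ : i + 1 ≡ length pre′
    length-pre′ = sym (length-++ (pre ++ ls))
    hi≡ : hi ≡ length pre′ + length rs
    hi≡ = trans (sym (length-++ pre)) (trans (cong length (trans (cong (pre ++_) F.mid≡)
            (trans (sym (++-assoc pre ls (x ∷ rs))) (sym (++-assoc (pre ++ ls) (x ∷ []) rs)))))
            (length-++ pre′))
    last≡ : total (pre ++ init) + leaves# b₁ ≡ total pre + s
    last≡ = trans (cong (_+ leaves# b₁) (total-++ pre)) (trans (+-assoc (total pre) (total init) (leaves# b₁))
      (cong (total pre +_) (trans (cong (total init +_) (sym (+-identityʳ (leaves# b₁))))
        (trans (sym (total-++ init)) (cong total (sym mid≡∷ʳ))))))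
    hi-1≡ : hi ∸ 1 ≡ length (pre ++ init)
    hi-1≡ = trans (cong (λ z → length pre + length z ∸ 1) mid≡∷ʳ)
      (trans (cong (λ z → length pre + z ∸ 1) (length-++ init))
      (trans (cong (_∸ 1) (sym (+-assoc (length pre) (length init) 1)))
      (trans (m+n∸n≡m (length pre + length init) 1) (sym (length-++ pre)))))
    bs≡ᵉ : bs ≡ (pre ++ init) ++ b₁ ∷ post
    bs≡ᵉ = trans bs≡ (trans (cong (λ z → pre ++ z ++ post) mid≡∷ʳ)
      (trans (cong (pre ++_) (++-assoc init (b₁ ∷ []) post)) (sym (++-assoc pre init (b₁ ∷ post)))))

    ρ : Vec Val 17
    ρ = nat (total (pre ++ ls) + leaves# x) ∷ treeVal (proj₁ x) ∷
         nat (total (pre ++ ls)) ∷ cell (nat (total (pre ++ ls) + leaves# x)) (treeVal (proj₁ x)) ∷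
         nat i ∷
         nat (total (pre ++ init) + leaves# b₁) ∷ treeVal (proj₁ b₁) ∷
         nat (total (pre ++ init)) ∷ cell (nat (total (pre ++ init) + leaves# b₁)) (treeVal (proj₁ b₁)) ∷
         nat (total pre) ∷ cell (nat (total pre + leaves# b₀)) (treeVal (proj₁ b₀)) ∷
         nat hi ∷
         nat (length pre) ∷ nat (length mid) ∷ E ∷ range bs ≤W pre mid ∷ cell E (range bs ≤W pre mid) ∷ []
    left : LeftPart ρ _ ls x
    left = leftPart {iᵉ = # 4} {loᵉ = # 12} {xᵉ = # 1} {Aᵉ = # 14} pre ls x builtˡ repˣ (All.map All.head cross)
      (⇓var _) (⇓var _) (⇓var _) (⇓var _)
    module L = LeftPart left
    disᴮ : Disjoint (rootCluster L.tree) (unionOfRoots (toRooteds rs))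
    disᴮ = subst (λ Z → Disjoint Z (unionOfRoots (toRooteds rs)))
      (sym (trans L.root≡ (unionOfRoots-∷ʳ (toRooteds ls) (toRooted x))))
      (disjoint-∪ (disjoint-unionsOfRoots (All.map⁺ (All.map (λ d → All.map⁺ (All.tail d)) cross)))
                  (disjoint-unionOfRoots (All.map⁺ (proj₁ (tail disjʳ)))))
    union≡ : rootCluster L.tree ∪ unionOfRoots (toRooteds rs) ≡ unionOfRoots (toRooteds mid)
    union≡ = trans (cong (_∪ unionOfRoots (toRooteds rs)) L.root≡)
      (trans (sym (unionOfRoots-split (toRooteds ls) (toRooted x) (toRooteds rs)))
             (cong unionOfRoots (sym (trans (cong toRooteds F.mid≡) (map-++ toRooted ls (x ∷ rs))))))
    right : RightPart (nat (length pre′) ∷ treeVal L.tree ∷ ρ) _ (unionOfRoots (toRooteds mid)) (rootCluster L.tree) L.ℬ rs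
    right = rightPart {hiᵉ = # 13} {i⁺ᵉ = # 0} {Bᵉ = # 1} {Aᵉ = # 16} pre′ rs builtʳ L.represents disᴮ union≡ hi≡
      (⇓var _) (⇓var _) (⇓var _) (⇓var _)
    module R = RightPart right

    pm≤W : total pre + s ≤ W
    pm≤W = subst (_≤ W) (total-++ pre) (total-≤W bs ≤W (pre ++ mid) bs≡pm)
    body : Eval≤ (cell E (range bs ≤W pre mid) ∷ []) build (treeVal R.tree)
             (M * suc (λ₂ (length mid)) + (L.cost + R.cost))
    body =
      ⇓match-cell (⇓var _)
      (⇓match-cell (⇓var _)
      (⇓bind (⇓add (subst (_≤ W) (length-++ pre) (length-≤W bs ≤W (pre ++ mid) bs≡pm)) (⇓var _) (⇓var _))
      (⇓match-cell (⇓entry bs ≤W pre bs≡ (⇓var _) (⇓var _))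
      (⇓match-cell (⇓entry bs ≤W (pre ++ init) bs≡ᵉ (⇓var _) (⇓≡ (cong nat hi-1≡) (⇓sub (⇓var _) ⇓lit)))
      (⇓match-cell (⇓var _)
      (⇓bind (⇓call F.run (⇓cons (⇓cons (⇓var _)
          (⇓add (≤-trans (+-monoʳ-≤ (total pre) (⌊n/2⌋≤n s)) pm≤W) (⇓var _)
            (⇓≡ (cong (λ z → nat ⌊ z /2⌋) (trans (cong (_∸ total pre) last≡) (m+n∸m≡n (total pre) s)))
              (⇓half (⇓sub (⇓var _) (⇓var _))))))
          (⇓cons (⇓var _) (⇓var _))))
      (⇓match-cell (⇓entry bs ≤W (pre ++ ls) bs≡ˣ (⇓var _) (⇓var _))
      (⇓match-cell (⇓var _)
      (⇓bind L.eval
      (⇓bind (⇓≡ (cong nat length-pre′)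
          (⇓add (subst (_≤ W) (sym length-pre′) (length-≤W bs ≤W pre′ bs≡ʳ)) (⇓var _) ⇓lit))
        R.eval))))))))))

    cost≤ : M + (M * suc (λ₂ (length mid)) + (L.cost + R.cost)) ≤ 2 * M + M * λ₂ s + (L.cost + R.cost)
    -- Every block has a leaf, so the number of blocks searched is at most the total size.
    cost≤ = certificate 0 (*-monoʳ-≤ M (⌈log₂⌉-mono-≤ (length≤total mid))) (lem M (λ₂ (length mid)) (λ₂ s) L.cost R.cost)
      where
      lem : ∀ M k s a b → M + (M * suc k + (a + b)) + M * s + 0 ≡ 2 * M + M * s + (a + b) + M * k
      lem = solve-∀
    potential≡ : potential ls + (3 * M * λ₂ (leaves# x) + 10 * M + potential rs) ≡ potential mid
    potential≡ = sym (trans (cong potential F.mid≡) (potential-++ ls))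
    module Pays = Potential M {total ls} {leaves# x} {total rs} {s} 1≤s total≡ (proj₁ halves) (proj₂ halves) L.pays R.pays cost≤

-- Children of a node, budgets and the assembly of blocks

module _ {n : ℕ} where

  private variable
    D : Subset n
    𝒞 : Family n
    t h q : Tree n

  root∈clusters : ∀ (t : Tree n) → rootCluster t ∈ˡ treeClusters t
  root∈clusters (leaf e)   = here refl
  root∈clusters (node l r) = here refl

  clusters-⊆ : ∀ t → D ∈ˡ treeClusters t → D ⊆ rootCluster t
  clusters-⊆ (leaf e)   (here refl) = id
  clusters-⊆ (node l r) (here refl) = id
  clusters-⊆ (node l r) (there D∈) with ∈-++⁻ (treeClusters l) D∈
  ... | inj₁ D∈l = p⊆p∪q (rootCluster r) ∘ clusters-⊆ l D∈l
  ... | inj₂ D∈r = q⊆p∪q (rootCluster l) (rootCluster r) ∘ clusters-⊆ r D∈r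

  rootCluster-nonempty : ∀ (t : Tree n) → Nonempty (rootCluster t)
  rootCluster-nonempty (leaf e)   = e , x∈⁅x⁆ e
  rootCluster-nonempty (node l r) = let e , e∈ = rootCluster-nonempty l in e , p⊆p∪q (rootCluster r) e∈

  clusters-nonempty : ∀ t → D ∈ˡ treeClusters t → Nonempty D
  clusters-nonempty (leaf e)   (here refl) = rootCluster-nonempty (leaf e)
  clusters-nonempty (node l r) (here refl) = rootCluster-nonempty (node l r)
  clusters-nonempty (node l r) (there D∈) with ∈-++⁻ (treeClusters l) D∈
  ... | inj₁ D∈l = clusters-nonempty l D∈l
  ... | inj₂ D∈r = clusters-nonempty r D∈r

  -- h and q are the two children of t, in either order.
  record Children (t h q : Tree n) : Set where
    field
      root≡    : rootCluster t ≡ rootCluster h ∪ rootCluster q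
      disjoint : Disjoint (rootCluster h) (rootCluster q)
      cases    : ∀ {D} → D ∈ˡ treeClusters t → D ≡ rootCluster t ⊎ D ∈ˡ treeClusters h ⊎ D ∈ˡ treeClusters q
      fst⊆     : treeClusters h ⊆ˡ treeClusters t
      snd⊆     : treeClusters q ⊆ˡ treeClusters t
      fst-dc   : DisjointChildren h
      snd-dc   : DisjointChildren q
      leaves≡  : leaves t ≡ leaves h + leaves q

  children : ∀ l r → DisjointChildren (node l r) → Children (node l r) l r
  children l r (dis , dˡ , dʳ) = record
    { root≡ = refl ; disjoint = dis
    ; cases = λ where
        (here D≡)  → inj₁ D≡
        (there D∈) → inj₂ (∈-++⁻ (treeClusters l) D∈)
    ; fst⊆ = λ D∈ → there (∈-++⁺ˡ D∈)
    ; snd⊆ = λ D∈ → there (∈-++⁺ʳ (treeClusters l) D∈)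
    ; fst-dc = dˡ ; snd-dc = dʳ ; leaves≡ = refl }

  children-swap : Children t h q → Children t q h
  children-swap {t} {h} {q} ch = record
    { root≡ = trans root≡ (∪-comm (rootCluster h) (rootCluster q))
    ; disjoint = disjoint-sym disjoint
    ; cases = λ D∈ → case cases D∈ of λ where
        (inj₁ D≡)        → inj₁ D≡
        (inj₂ (inj₁ D∈h)) → inj₂ (inj₂ D∈h)
        (inj₂ (inj₂ D∈q)) → inj₂ (inj₁ D∈q)
    ; fst⊆ = snd⊆ ; snd⊆ = fst⊆ ; fst-dc = snd-dc ; snd-dc = fst-dc
    ; leaves≡ = trans leaves≡ (+-comm (leaves h) (leaves q)) }
    where open Children ch

  module _ (ch : Children t h q) where
    open Children ch

    fst⊆root : rootCluster h ⊆ rootCluster t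
    fst⊆root e∈ = subst (_ ∈_) (sym root≡) (p⊆p∪q (rootCluster q) e∈)

    root─fst : rootCluster t ─ rootCluster h ≡ rootCluster q
    root─fst = trans (cong (_─ rootCluster h) root≡) (∪-─-cancel disjoint)

    root⊈fst : ¬ (rootCluster t ⊆ rootCluster h)
    root⊈fst t⊆h = let e , e∈q = rootCluster-nonempty q in
      disjoint⁻ disjoint (t⊆h (subst (e ∈_) (sym root≡) (q⊆p∪q (rootCluster h) (rootCluster q) e∈q))) e∈q

    fst⊂root : rootCluster h ⊂ rootCluster t
    fst⊂root with ⊆⇒≡⊎⊂ fst⊆root
    ... | inj₁ h≡t = ⊥-elim (root⊈fst (⊆-reflexive (sym h≡t)))
    ... | inj₂ h⊂t = h⊂t

    represents-fst : t Represents restrict (rootCluster t) 𝒞 → h Represents restrict (rootCluster h) 𝒞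
    represents-fst {𝒞} (_ , t∼) = fst-dc , ∼⁺
      (λ D∈h → ∈-filter⁺ (_⊆? rootCluster h)
        (proj₁ (∈-filter⁻ (_⊆? rootCluster t) {xs = 𝒞} (Equivalence.to t∼ (fst⊆ D∈h)))) (clusters-⊆ h D∈h))
      from
      where
      from : restrict (rootCluster h) 𝒞 ⊆ˡ treeClusters h
      from {D} D∈ with ∈-filter⁻ (_⊆? rootCluster h) {xs = 𝒞} D∈
      ... | D∈𝒞 , D⊆h with cases (Equivalence.from t∼ (∈-filter⁺ (_⊆? rootCluster t) D∈𝒞 (fst⊆root ∘ D⊆h)))
      ...   | inj₁ refl       = ⊥-elim (root⊈fst D⊆h)
      ...   | inj₂ (inj₁ D∈h) = D∈h
      ...   | inj₂ (inj₂ D∈q) = let e , e∈D = clusters-nonempty q D∈q in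
        ⊥-elim (disjoint⁻ disjoint (D⊆h e∈D) (clusters-⊆ q D∈q e∈D))

  same-root⇒same-leaves : ∀ (t t′ : Tree n) → DisjointChildren t → DisjointChildren t′ →
                          rootCluster t ≡ rootCluster t′ → leaves t ≡ leaves t′
  same-root⇒same-leaves t t′ d d′ eq =
    trans (leaves≡∣root∣ t d) (trans (cong ∣_∣ eq) (sym (leaves≡∣root∣ t′ d′)))

  -- With `K` equal to `10 * M` this is `potential`; larger constants also cover the work around
  -- `build`.
  budget : ℕ → List (Block n) → ℕ
  budget K bs = sum (map (λ b → 3 * M * λ₂ (leaves# b) + K) bs)

  budget-+ : ∀ K J bs → budget (K + J) bs ≡ budget K bs + J * length bs
  budget-+ K J []       = sym (*-zeroʳ J)
  budget-+ K J (b ∷ bs) = trans (cong (3 * M * λ₂ (leaves# b) + (K + J) +_) (budget-+ K J bs))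
    (lem (3 * M * λ₂ (leaves# b)) K J (budget K bs) (length bs))
    where
    lem : ∀ a K J B k → a + (K + J) + (B + J * k) ≡ a + K + B + J * suc k
    lem = solve-∀

-- `assembleCost` is the `10 * M` of `potential` plus `5 * M + 1` for preparing the array.
-- `slackCost` solves `2 * slackCost ≡ 2 * M + pushCost`: two blocks, the fewest that the heavy path
-- of a node can have, pay for two function bodies and for the one block that results. `leafCost` is
-- what a single leaf uses up when it is balanced and pushed as a block.
assembleCost pushCost slackCost leafCost : ℕ
assembleCost = 15 * M + 1
slackCost    = assembleCost + 2 * M
pushCost     = assembleCost + slackCost
leafCost     = pushCost + (3 * M + assembleCost)

module Assemble (W : ℕ) {n : ℕ} where
  open Semantics code W
  open Costs W

  record Assembled (bs : List (Block n)) : Set where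
    field
      {tree}     : Tree n
      {fam}      : Family n
      {cost}     : ℕ
      run        : Call assembleᶠ (blocksVal bs) (treeVal tree) cost
      completed  : Complete (toRooteds bs) fam
      represents : tree Represents fam
      root≡      : rootCluster tree ≡ unionOfRoots (toRooteds bs)
      pays       : cost + 2 * M * λ₂ (total bs) ≤ budget assembleCost bs
      paysHeavy  : All (λ b → 2 * leaves# b ≤ total bs) bs →
                   cost + 3 * M * λ₂ (total bs) ≤ budget assembleCost bs

  assemble-call : ∀ bs → bs ≢ [] → total bs ≤ W → All RepresentsBlock bs → AllPairs DisjointBlocks bs → Assembled bs
  assemble-call []         bs≢[] _  _   _    = ⊥-elim (bs≢[] refl)
  assemble-call bs@(b ∷ bs′) bs≢[] ≤W rep disj = record
    { run        = ⇓function assembleᶠ ≤-refl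
        (⇓call B.run (⇓cons (⇓array {vs = entryVals 0 bs} (⇓call (entries-call 0 bs ≤W) (⇓cons ⇓lit (⇓var _))))
          (⇓cons ⇓lit (⇓call (length-call bs (≤-trans (length≤total bs) ≤W)) (⇓var _)))))
    ; completed  = B.completed
    ; represents = B.represents
    ; root≡      = B.root≡
    ; pays       = overhead B.pays
    ; paysHeavy  = λ light → overhead (B.paysHeavy light)
    }
    where
    open Build W bs ≤W
    module B = Built (build-call [] bs [] bs≢[] (sym (++-identityʳ bs)) rep disj (<-wellFounded _))
    k = length bs′
    -- For `k + 1` blocks: `M` for the body, `M * (k + 2)` for each of the two list functions and
    -- `k + 1` for the array, in total at most `(5 * M + 1) * (k + 1)`.
    overhead : ∀ {c p} → c + p ≤ potential bs →
               M + (M * suc (suc k) + length (entryVals 0 bs) + M * suc (suc k) + c) + p ≤ budget assembleCost bs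
    overhead {c} {p} h = subst₂ (λ y z → M + (M * suc (suc k) + y + M * suc (suc k) + c) + p ≤ z)
      (sym (length-entryVals 0 bs)) (sym (trans (cong (λ K → budget K bs) K≡) (budget-+ (10 * M) (5 * M + 1) bs)))
      (certificate (3 * M * k) h (lem M k c p (potential bs)))
      where
      K≡ : assembleCost ≡ 10 * M + (5 * M + 1)
      K≡ = eq M
        where
        eq : ∀ M → 15 * M + 1 ≡ 10 * M + (5 * M + 1)
        eq = solve-∀
      lem : ∀ M k c p P → M + (M * suc (suc k) + suc k + M * suc (suc k) + c) + p + P + 3 * M * k ≡
                          P + (5 * M + 1) * suc k + (c + p)
      lem = solve-∀

-- The walk down a heavy path

module _ {n : ℕ} where

  root-of : Block n → Subset n
  root-of b = rootCluster (proj₁ b)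

  -- The walk down the heavy path has reached t: H lists the clusters above t and
  -- bs the balanced siblings hanging off them, both ending at the root cluster C.
  record State (C : Subset n) (𝒞 : Family n) (N : ℕ) (t : Tree n)
               (H : List (Subset n)) (bs : List (Block n)) : Set where
    field
      clusters   : All (_∈ˡ 𝒞) (rootCluster t ∷ H)
      ascending  : Linked _⊂_ (rootCluster t ∷ H)
      heavy      : Linked Heavy (rootCluster t ∷ H)
      top        : last (rootCluster t ∷ H) ≡ just C
      -- At a leaf this becomes the maximality of the chain: a cluster disjoint from the leaf is not
      -- comparable with it.
      remaining  : ∀ D → D ∈ˡ 𝒞 → D ∈ˡ H ⊎ D ∈ˡ treeClusters t ⊎ Disjoint D (rootCluster t)
      represents : t Represents restrict (rootCluster t) 𝒞
      balanced   : Pointwise (λ D 𝒟 → Balance D (restrict D 𝒞) 𝒟) (steps (rootCluster t) H) (map proj₂ bs)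
      roots      : map root-of bs ≡ steps (rootCluster t) H
      rep        : All RepresentsBlock bs
      apart      : All (λ b → Disjoint (rootCluster t) (root-of b)) bs
      disjoint   : AllPairs DisjointBlocks bs
      light      : All (λ b → 2 * leaves# b ≤ N) bs
      size≡      : leaves t + total bs ≡ N

  descend : ∀ {C 𝒞 N t h q H bs t′ 𝒟} → State C 𝒞 N t H bs → Children t h q →
            leaves q ≤ leaves h → t′ Represents 𝒟 → rootCluster t′ ≡ rootCluster q →
            Balance (rootCluster q) (restrict (rootCluster q) 𝒞) 𝒟 →
            State C 𝒞 N h (rootCluster t ∷ H) ((t′ , 𝒟) ∷ bs)
  descend {C} {𝒞} {N} {t} {h} {q} {H} {bs} {t′} {𝒟} st ch q≤h rep′ root≡ bal = record
    { clusters   = proj₁ (∈-filter⁻ (_⊆? rootCluster h) {xs = 𝒞} (Equivalence.to (proj₂ repʰ) (root∈clusters h))) ∷ S.clusters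
    ; ascending  = fst⊂root ch ∷ S.ascending
    ; heavy      = subst (_≤ ∣ rootCluster h ∣) (cong ∣_∣ (sym (root─fst ch)))
        (subst₂ _≤_ (leaves≡∣root∣ q Ch.snd-dc) (leaves≡∣root∣ h Ch.fst-dc) q≤h) ∷ S.heavy
    ; top        = S.top
    ; remaining  = remaining
    ; represents = repʰ
    ; balanced   = subst (λ D → Balance D (restrict D 𝒞) 𝒟) (sym (root─fst ch)) bal ∷ S.balanced
    ; roots      = cong₂ _∷_ (trans root≡ (sym (root─fst ch))) S.roots
    ; rep        = rep′ ∷ S.rep
    ; apart      = subst (Disjoint (rootCluster h)) (sym root≡) Ch.disjoint ∷
                   All.map (disjoint-⊆ (fst⊆root ch) id) S.apart
    ; disjoint   = All.map (λ d → disjoint-⊆ (λ e∈ → fst⊆root (children-swap ch) (subst (_ ∈_) root≡ e∈)) id d) S.apart ∷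
                   S.disjoint
    ; light      = light ∷ S.light
    ; size≡      = size≡
    }
    where
    module S = State st
    module Ch = Children ch
    repʰ = represents-fst ch {𝒞} S.represents
    leaves′ : leaves t′ ≡ leaves q
    leaves′ = same-root⇒same-leaves t′ q (proj₁ rep′) Ch.snd-dc root≡
    size≡ : leaves h + (leaves t′ + total bs) ≡ N
    size≡ = trans (cong (λ m → leaves h + (m + total bs)) leaves′)
      (trans (sym (+-assoc (leaves h) (leaves q) (total bs))) (trans (cong (_+ total bs) (sym Ch.leaves≡)) S.size≡))
    light : 2 * leaves t′ ≤ N
    light = subst (2 * leaves t′ ≤_) size≡
      (certificate (total bs) (subst (_≤ leaves h) (sym leaves′) q≤h) (lem (leaves t′) (leaves h) (total bs)))
      where
      lem : ∀ q h a → 2 * q + h + a ≡ h + (q + a) + q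
      lem = solve-∀
    remaining : ∀ D → D ∈ˡ 𝒞 → D ∈ˡ rootCluster t ∷ H ⊎ D ∈ˡ treeClusters h ⊎ Disjoint D (rootCluster h)
    remaining D D∈ with S.remaining D D∈
    ... | inj₁ D∈H        = inj₁ (there D∈H)
    ... | inj₂ (inj₂ dis) = inj₂ (inj₂ (disjoint-⊆ id (fst⊆root ch) dis))
    ... | inj₂ (inj₁ D∈t) with Ch.cases D∈t
    ...   | inj₁ D≡         = inj₁ (here D≡)
    ...   | inj₂ (inj₁ D∈h) = inj₂ (inj₁ D∈h)
    ...   | inj₂ (inj₂ D∈q) = inj₂ (inj₂ (disjoint-⊆ (clusters-⊆ q D∈q) id (disjoint-sym Ch.disjoint)))

  zip-blocks : ∀ (bs : List (Block n)) → zipWith rooted (map root-of bs) (map proj₂ bs) ≡ toRooteds bs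
  zip-blocks []       = refl
  zip-blocks (b ∷ bs) = cong (toRooted b ∷_) (zip-blocks bs)

  complete-singleton : ∀ {x : Rooted n} {𝒟} → Complete (x ∷ []) 𝒟 → 𝒟 ≡ family x
  complete-singleton (complete {ls = []}         refl _ j≡1 j≡k) = refl
  complete-singleton (complete {ls = _ ∷ []}     ()   _ _   _)
  complete-singleton (complete {ls = _ ∷ _ ∷ _}  ()   _ _   _)

  represents-itself : ∀ {t : Tree n} {𝒞} → t Represents 𝒞 → t Represents restrict (rootCluster t) 𝒞
  represents-itself {t} {𝒞} (d , t∼) = d , ∼⁺
    (λ D∈ → ∈-filter⁺ (_⊆? rootCluster t) (Equivalence.to t∼ D∈) (clusters-⊆ t D∈))
    (λ D∈ → Equivalence.from t∼ (proj₁ (∈-filter⁻ (_⊆? rootCluster t) {xs = 𝒞} D∈)))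

  start : ∀ {t : Tree n} {𝒞} → t Represents 𝒞 → State (rootCluster t) 𝒞 (leaves t) t [] []
  start {t} {𝒞} rep = record
    { clusters = Equivalence.to (proj₂ rep) (root∈clusters t) ∷ []
    ; ascending = [-] ; heavy = [-] ; top = refl
    ; remaining = λ D D∈ → inj₂ (inj₁ (Equivalence.from (proj₂ rep) D∈))
    ; represents = represents-itself rep
    ; balanced = [] ; roots = refl ; rep = [] ; apart = [] ; disjoint = [] ; light = []
    ; size≡ = +-identityʳ (leaves t) }

  arrive : ∀ {C 𝒞 N e H bs} → (∀ D → D ∈ˡ 𝒞 → Nonempty D) → State C 𝒞 N (leaf e) H bs →
           HeavyPath C 𝒞 (⁅ e ⁆ ∷ H)
  arrive {C} {𝒞} {e = e} {H} nonempty st = record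
    { clusters = S.clusters ; ascending = S.ascending ; maximal = maximal ; top = S.top ; heavy = S.heavy }
    where
    module S = State st
    maximal : ∀ D → D ∈ˡ 𝒞 → All (λ X → (D ⊆ X) ⊎ (X ⊆ D)) (⁅ e ⁆ ∷ H) → D ∈ˡ ⁅ e ⁆ ∷ H
    maximal D D∈ (cmp ∷ _) with S.remaining D D∈ | cmp
    ... | inj₁ D∈H                 | _        = there D∈H
    ... | inj₂ (inj₁ (here refl))  | _        = here refl
    ... | inj₂ (inj₂ dis)          | inj₁ D⊆e =
      let x , x∈D = nonempty D D∈ in ⊥-elim (disjoint⁻ dis x∈D (D⊆e x∈D))
    ... | inj₂ (inj₂ dis)          | inj₂ e⊆D = ⊥-elim (disjoint⁻ dis (e⊆D (x∈⁅x⁆ e)) (x∈⁅x⁆ e))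

-- Running `Balance`

module BalanceCalls (W : ℕ) {n : ℕ} where
  open Semantics code W
  open Costs W
  open Assemble W {n}

  -- In `pays`, `3 * M * λ₂ (leaves t) + pushCost` is the budget of the result as a block of the
  -- path above, and the remaining `M` is the body of the call of `path` that pushes it.
  record BalanceRun (t : Tree n) (𝒞 : Family n) : Set where
    field
      {tree}     : Tree n
      {fam}      : Family n
      {cost}     : ℕ
      run        : Call balanceᶠ (annotated t) (treeVal tree) cost
      represents : tree Represents fam
      root≡      : rootCluster tree ≡ rootCluster t
      balance    : Balance (rootCluster t) 𝒞 fam
      pays       : cost + 3 * M * λ₂ (leaves t) + (M + pushCost) ≤ leafCost * leaves t

  -- By `pays`, the leaves still below the walk cover its cost and the budgets of all blocks that it
  -- adds to `bs`.
  record PathRun (C : Subset n) (𝒞 : Family n) (N : ℕ) (t : Tree n) (bs : List (Block n)) : Set where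
    field
      {H}        : List (Subset n)
      {blocks}   : List (Block n)
      {cost}     : ℕ
      run        : Call pathᶠ (cell (annotated t) (blocksVal bs)) (blocksVal blocks) cost
      heavyPath  : HeavyPath C 𝒞 H
      nonempty   : blocks ≢ []
      balanced   : Pointwise (λ D 𝒟 → Balance D (restrict D 𝒞) 𝒟) (differences H) (map proj₂ blocks)
      roots      : map root-of blocks ≡ differences H
      rep        : All RepresentsBlock blocks
      disjoint   : AllPairs DisjointBlocks blocks
      light      : 2 ≤ N → All (λ b → 2 * leaves# b ≤ N) blocks
      size≡      : total blocks ≡ N
      pays       : cost + budget pushCost blocks ≤ budget pushCost bs + leafCost * leaves t

  leaf-path : ∀ {C 𝒞 N e H bs} → (∀ D → D ∈ˡ 𝒞 → Nonempty D) → State C 𝒞 N (leaf e) H bs → PathRun C 𝒞 N (leaf e) bs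
  leaf-path {C} {𝒞} {N} {e} {H} {bs} nonempty st = record
    { H         = ⁅ e ⁆ ∷ H
    ; blocks    = (leaf e , restrict ⁅ e ⁆ 𝒞) ∷ bs
    ; run       = ⇓function pathᶠ ≤-refl
        (⇓match-cell (⇓var _) (⇓match-cell (⇓var _) (⇓match-nat (⇓var _) (⇓cons (⇓var _) (⇓var _)))))
    ; heavyPath = arrive nonempty st
    ; nonempty  = λ ()
    ; balanced  = single (∣⁅x⁆∣≡1 e) ∷ S.balanced
    ; roots     = cong (⁅ e ⁆ ∷_) S.roots
    ; rep       = S.represents ∷ S.rep
    ; disjoint  = S.apart ∷ S.disjoint
    ; light     = λ 2≤N → 2≤N ∷ S.light
    ; size≡     = S.size≡
    ; pays      = certificate (2 * M + assembleCost) (z≤n {0}) (lem M assembleCost pushCost (budget pushCost bs))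
    }
    where
    module S = State st
    lem : ∀ M A P B → M + 0 + (3 * M * 0 + P + B) + 0 + (2 * M + A) ≡ B + (P + (3 * M + A)) * 1 + 0
    lem = solve-∀

  ⋃-differences : ∀ {C : Subset n} {𝒞 H} → HeavyPath C 𝒞 H → ⋃ (differences H) ≡ C
  ⋃-differences {H = []}    hp = case HeavyPath.top hp of λ ()
  ⋃-differences {H = _ ∷ _} hp = ⋃-steps (HeavyPath.ascending hp) (HeavyPath.top hp)

  -- A sole block would be the whole and hence more than half of it. Two blocks are what `slackCost`
  -- is calibrated to.
  2≤length : ∀ {N} (bs : List (Block n)) → bs ≢ [] → total bs ≡ N → All (λ b → 2 * leaves# b ≤ N) bs → 2 ≤ length bs
  2≤length []           bs≢[] _    _        = ⊥-elim (bs≢[] refl)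
  2≤length (b ∷ [])     _     refl (2b≤ ∷ _) =
    ⊥-elim (<⇒≱ (m<m+n (leaves# b + 0) (1≤leaves (proj₁ b)))
      (≤-trans (≤-reflexive (+-comm (leaves# b + 0) (leaves# b))) 2b≤))
  2≤length (_ ∷ _ ∷ _)  _     _    _        = s≤s (s≤s z≤n)

  push-pays : ∀ {a b c p x y B B₀} → c + x + (M + pushCost) ≤ leafCost * a →
              p + B ≤ (x + pushCost + B₀) + leafCost * b → y ≡ a + b →
              M + (c + 0 + p) + B ≤ B₀ + leafCost * y
  push-pays {a} {b} {c} {p} {x} {B = B} {B₀} h₁ h₂ refl =
    certificate 0 (+-mono-≤ h₁ h₂) (lem M pushCost leafCost a b c p x B B₀)
    where
    lem : ∀ M P Y a b c p x B B₀ →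
          M + (c + 0 + p) + B + (Y * a + (x + P + B₀ + Y * b)) + 0 ≡ B₀ + Y * (a + b) + (c + x + (M + P) + (p + B))
    lem = solve-∀

  -- The code has no special case for a single edge: it walks a path of length one and assembles one
  -- block. The outcome has to represent `𝒞` itself, as `single` demands, and `complete-singleton`
  -- provides this.
  balance-leaf : ∀ {e 𝒞} → 1 ≤ W → leaf e Represents 𝒞 → BalanceRun (leaf e) 𝒞
  balance-leaf {e} {𝒞} ≤W rep = record
    { run        = ⇓function balanceᶠ ≤-refl (⇓call A.run (⇓call p.run (⇓cons (⇓var _) ⇓lit)))
    ; represents = proj₁ A.represents , ∼⁺
        (λ D∈ → Equivalence.to (proj₂ rep) (Equivalence.from (proj₂ rep₀)
          (subst (_ ∈ˡ_) fam≡ (Equivalence.to (proj₂ A.represents) D∈))))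
        (λ D∈ → Equivalence.from (proj₂ A.represents)
          (subst (_ ∈ˡ_) (sym fam≡) (Equivalence.to (proj₂ rep₀) (Equivalence.from (proj₂ rep) D∈))))
    ; root≡      = trans A.root≡ (∪-identityʳ _)
    ; balance    = single (∣⁅x⁆∣≡1 e)
    ; pays       = certificate 0 A.pays (lem M A.cost pushCost assembleCost)
    }
    where
    rep₀ = represents-itself rep
    module p = PathRun (leaf-path {C = ⁅ e ⁆} (λ D D∈ → clusters-nonempty (leaf e) (Equivalence.from (proj₂ rep) D∈)) (start rep))
    module A = Assembled (assemble-call ((leaf e , restrict ⁅ e ⁆ 𝒞) ∷ []) (λ ()) ≤W (rep₀ ∷ []) ([] ∷ []))
    fam≡ : A.fam ≡ restrict ⁅ e ⁆ 𝒞
    fam≡ = complete-singleton A.completed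
    lem : ∀ M c P A → M + (M + 0 + c) + 3 * M * 0 + (M + P) + (3 * M * 0 + A + 0) + 0 ≡ (P + (3 * M + A)) * 1 + (c + 2 * M * 0)
    lem = solve-∀

  balance-node : ∀ {t 𝒞} → leaves t ≤ W → 2 ≤ leaves t → DisjointChildren t →
                 PathRun (rootCluster t) 𝒞 (leaves t) t [] → BalanceRun t 𝒞
  balance-node {t} {𝒞} ≤W 2≤N dc p = record
    { run        = ⇓function balanceᶠ ≤-refl (⇓call A.run (⇓call p.run (⇓cons (⇓var _) ⇓lit)))
    ; represents = A.represents
    ; root≡      = trans A.root≡ (trans (cong ⋃ (trans (sym (map-∘ p.blocks)) p.roots)) (⋃-differences p.heavyPath))
    ; balance    = split (λ ∣C∣≡1 → <⇒≢ 2≤N (trans (sym ∣C∣≡1) (sym (leaves≡∣root∣ t dc)))) p.heavyPath p.balanced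
        (subst (λ xs → Complete xs A.fam)
          (trans (sym (zip-blocks p.blocks)) (cong (λ Ds → zipWith rooted Ds (map proj₂ p.blocks)) p.roots)) A.completed)
    ; pays       = certificate 0
        (+-mono-≤ (+-mono-≤ (subst (λ m → A.cost + 3 * M * λ₂ m ≤ budget assembleCost p.blocks) p.size≡
                     (A.paysHeavy (subst (λ N → All (λ b → 2 * leaves# b ≤ N) p.blocks) (sym p.size≡) light)))
                   (subst (λ B → p.cost + B ≤ leafCost * leaves t) (budget-+ assembleCost slackCost p.blocks) p.pays))
          -- The assembly uses up `budget assembleCost`; of the `slackCost` left on each block, two
          -- copies are spent here.
          (*-monoʳ-≤ slackCost (2≤length p.blocks p.nonempty p.size≡ light)))
        (lem M p.cost A.cost (3 * M * λ₂ (leaves t)) assembleCost (budget assembleCost p.blocks)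
          (length p.blocks) (leafCost * leaves t))
    }
    where
    module p = PathRun p
    module A = Assembled (assemble-call p.blocks p.nonempty (subst (_≤ W) (sym p.size≡) ≤W) p.rep p.disjoint)
    light = p.light 2≤N
    lem : ∀ M p c x A B k y → M + (p + c) + x + (M + (A + (A + 2 * M))) + (B + y + (A + 2 * M) * k) + 0 ≡
                              y + (c + x + (p + (B + (A + 2 * M) * k)) + (A + 2 * M) * 2)
    lem = solve-∀

  module _ {C : Subset n} {𝒞 : Family n} {N : ℕ} {bs : List (Block n)} {l r : Tree n} (dc : DisjointChildren (node l r)) where

    private
      pushed : ∀ {t 𝒟} → BalanceRun t 𝒟 → List (Block n)
      pushed b = (BalanceRun.tree b , BalanceRun.fam b) ∷ bs

      step-pays : ∀ {t h 𝒟 y} → DisjointChildren t → (b : BalanceRun t 𝒟) (p : PathRun C 𝒞 N h (pushed b)) →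
                  y ≡ leaves t + leaves h →
                  M + (BalanceRun.cost b + 0 + PathRun.cost p) + budget pushCost (PathRun.blocks p) ≤
                  budget pushCost bs + leafCost * y
      step-pays {t} {h} dcᵗ b p = push-pays b.pays
        (subst (λ m → p.cost + budget pushCost p.blocks ≤ 3 * M * λ₂ m + pushCost + budget pushCost bs + leafCost * leaves h)
          (same-root⇒same-leaves b.tree t (proj₁ b.represents) dcᵗ b.root≡) p.pays)
        where
        module b = BalanceRun b
        module p = PathRun p

      leaves′ : ∀ {t 𝒟} → DisjointChildren t → (b : BalanceRun t 𝒟) → nat (leaves t) ≡ nat (leaves (BalanceRun.tree b))
      leaves′ dcᵗ b = cong nat (sym (same-root⇒same-leaves b.tree _ (proj₁ b.represents) dcᵗ b.root≡))
        where module b = BalanceRun b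

    path-right : ∀ {𝒟} → leaves l ≤ leaves r → (b : BalanceRun l 𝒟) → PathRun C 𝒞 N r (pushed b) → PathRun C 𝒞 N (node l r) bs
    path-right l≤r b p = record
      { run = ⇓function pathᶠ ≤-refl (⇓match-cell (⇓var _) (⇓match-cell (⇓var _) (⇓match-cell (⇓var _)
          (⇓match-cell (⇓var _) (⇓match-cell (⇓var _) (⇓if-yes l≤r (⇓var _) (⇓var _) (⇓call p.run
            (⇓cons (⇓var _) (⇓cons (⇓cons (⇓≡ (leaves′ (proj₁ (proj₂ dc)) b) (⇓var _)) (⇓call b.run (⇓var _))) (⇓var _))))))))))
      ; heavyPath = p.heavyPath ; nonempty = p.nonempty ; balanced = p.balanced ; roots = p.roots
      ; rep = p.rep ; disjoint = p.disjoint ; light = p.light ; size≡ = p.size≡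
      ; pays = step-pays (proj₁ (proj₂ dc)) b p refl
      }
      where
      module b = BalanceRun b
      module p = PathRun p

    path-left : ∀ {𝒟} → leaves r < leaves l → (b : BalanceRun r 𝒟) → PathRun C 𝒞 N l (pushed b) → PathRun C 𝒞 N (node l r) bs
    path-left r<l b p = record
      { run = ⇓function pathᶠ ≤-refl (⇓match-cell (⇓var _) (⇓match-cell (⇓var _) (⇓match-cell (⇓var _)
          (⇓match-cell (⇓var _) (⇓match-cell (⇓var _) (⇓if-no r<l (⇓var _) (⇓var _) (⇓call p.run
            (⇓cons (⇓var _) (⇓cons (⇓cons (⇓≡ (leaves′ (proj₂ (proj₂ dc)) b) (⇓var _)) (⇓call b.run (⇓var _))) (⇓var _))))))))))
      ; heavyPath = p.heavyPath ; nonempty = p.nonempty ; balanced = p.balanced ; roots = p.roots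
      ; rep = p.rep ; disjoint = p.disjoint ; light = p.light ; size≡ = p.size≡
      ; pays = step-pays (proj₂ (proj₂ dc)) b p (+-comm (leaves l) (leaves r))
      }
      where
      module b = BalanceRun b
      module p = PathRun p

  mutual
    balance-call : ∀ (t : Tree n) {𝒞} → leaves t ≤ W → t Represents 𝒞 → BalanceRun t 𝒞
    balance-call (leaf e)   ≤W rep = balance-leaf ≤W rep
    balance-call (node l r) ≤W rep = balance-node ≤W (+-mono-≤ (1≤leaves l) (1≤leaves r)) (proj₁ rep)
      (path-call (node l r) ≤W (λ D D∈ → clusters-nonempty (node l r) (Equivalence.from (proj₂ rep) D∈)) (start rep))

    path-call : ∀ {C 𝒞 N H bs} (t : Tree n) → leaves t ≤ W → (∀ D → D ∈ˡ 𝒞 → Nonempty D) →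
                State C 𝒞 N t H bs → PathRun C 𝒞 N t bs
    path-call (leaf e) _ nonempty st = leaf-path nonempty st
    path-call {𝒞 = 𝒞} (node l r) ≤W nonempty st with leaves l ≤? leaves r
    ... | yes l≤r =
      let dc = proj₁ (State.represents st)
          ch = children l r dc
          b  = balance-call l (≤-trans (m≤m+n (leaves l) (leaves r)) ≤W) (represents-fst ch {𝒞} (State.represents st))
          module b = BalanceRun b
      in path-right dc l≤r b (path-call r (≤-trans (m≤n+m (leaves r) (leaves l)) ≤W) nonempty
           (descend st (children-swap ch) l≤r b.represents b.root≡ b.balance))
    ... | no l≰r =
      let dc = proj₁ (State.represents st)
          ch = children l r dc
          b  = balance-call r (≤-trans (m≤n+m (leaves r) (leaves l)) ≤W) (represents-fst (children-swap ch) {𝒞} (State.represents st))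
          module b = BalanceRun b
      in path-left dc (≰⇒> l≰r) b (path-call l (≤-trans (m≤m+n (leaves l) (leaves r)) ≤W) nonempty
           (descend st ch (<⇒≤ (≰⇒> l≰r)) b.represents b.root≡ b.balance))

-- Linear time in the number of edges

λ₂-≤ : ∀ n → λ₂ n ≤ n
λ₂-≤ n = ≤-trans (⌈log₂⌉-mono-≤ (n≤2^n n)) (≤-reflexive (⌈log₂2^n⌉≡n n))
  where
  n≤2^n : ∀ n → n ≤ 2 ^ n
  n≤2^n zero    = z≤n
  n≤2^n (suc n) = ≤-trans (+-mono-≤ (m^n>0 2 n) (n≤2^n n)) (≤-reflexive (cong (2 ^ n +_) (sym (+-identityʳ (2 ^ n)))))

budget-≤ : ∀ {n} K (bs : List (Block n)) → budget K bs ≤ (3 * M + K) * total bs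
budget-≤ K []       = z≤n
budget-≤ K (b ∷ bs) with leaves# b | 1≤leaves (proj₁ b)
... | suc m | _ = certificate (K * m) (+-mono-≤ (budget-≤ K bs) (*-monoʳ-≤ (3 * M) (λ₂-≤ (suc m))))
        (lem M K m (λ₂ (suc m)) (budget K bs) (total bs))
  where
  lem : ∀ M K m l B T → 3 * M * l + K + B + ((3 * M + K) * T + 3 * M * suc m) + K * m ≡
                        (3 * M + K) * (suc m + T) + (B + 3 * M * l)
  lem = solve-∀

representing-root : ∀ {n} {C : Subset n} {𝒞 t} → BranchDecomposition C 𝒞 → t Represents 𝒞 → rootCluster t ≡ C
representing-root {t = t} bd (_ , t∼) = ⊆-antisym
  (BD.within bd _ (Equivalence.to t∼ (root∈clusters t)))
  (clusters-⊆ t (Equivalence.from t∼ (BD.root∈ bd)))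

balanceInLinearTime : BalanceInLinearTime
balanceInLinearTime = balanceProgram , K , λ {n} C 𝒞 t bd rep → run C 𝒞 t rep (representing-root bd rep)
  where
  -- Balancing takes `leafCost` per leaf; annotation together with the outermost call takes at most
  -- `2 * M` per leaf, as there are fewer nodes than twice the leaves. The summand 1 makes `K * m` a
  -- valid word bound whatever `M` is.
  K = leafCost + (3 * M + 1)
  run : ∀ {n} (C : Subset n) (𝒞 : Family n) (t : Tree n) → t Represents 𝒞 → rootCluster t ≡ C →
        ∃[ t′ ] ∃[ 𝒞′ ] ∃[ c ] (Run balanceProgram (K * ∣ C ∣) (treeVal t) (treeVal t′) c ×
          c ≤ K * ∣ C ∣ × t′ Represents 𝒞′ × Balance C 𝒞 𝒞′)
  run C 𝒞 t rep refl = B.tree , B.fam , _ , proj₁ (proj₂ total-run) ,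
    ≤-trans (proj₂ (proj₂ total-run)) cost≤ , B.represents , B.balance
    where
    W = K * ∣ rootCluster t ∣
    open Semantics code W
    open Costs W
    leaves≡ : leaves t ≡ ∣ rootCluster t ∣
    leaves≡ = leaves≡∣root∣ t (proj₁ rep)
    m≤Km : ∀ m → m ≤ K * m
    m≤Km m = certificate ((leafCost + 3 * M) * m) (z≤n {0}) (lem leafCost M m)
      where
      lem : ∀ Y M m → m + 0 + (Y + 3 * M) * m ≡ (Y + (3 * M + 1)) * m + 0
      lem = solve-∀
    ≤W : leaves t ≤ W
    ≤W = ≤-trans (≤-reflexive leaves≡) (m≤Km ∣ rootCluster t ∣)
    module B = BalanceCalls.BalanceRun (BalanceCalls.balance-call W t {𝒞} ≤W rep)
    total-run : Call balanceTreeᶠ (treeVal t) (treeVal B.tree) (M + (M * nodes t + B.cost))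
    total-run = ⇓function balanceTreeᶠ ≤-refl (⇓call B.run (⇓call (annotate-call t ≤W) (⇓var _)))
    cost≤ : M + (M * nodes t + B.cost) ≤ K * ∣ rootCluster t ∣
    cost≤ = subst (λ m → M + (M * nodes t + B.cost) ≤ K * m) leaves≡
      (certificate (M * leaves t + leaves t + 3 * M * λ₂ (leaves t) + (M + pushCost))
        (+-mono-≤ (*-monoʳ-≤ M (nodes≤2*leaves t)) B.pays)
        (lem M (nodes t) B.cost leafCost (leaves t) (3 * M * λ₂ (leaves t)) pushCost))
      where
      lem : ∀ M k c Y m x P → M + (M * k + c) + (M * (2 * m) + Y * m) + (M * m + m + x + (M + P)) ≡
                              (Y + (3 * M + 1)) * m + (M * suc k + (c + x + (M + P)))
      lem = solve-∀

module Sizes (W : ℕ) {n : ℕ} where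
  open Semantics code W
  open Costs W

  sizes-call : ∀ (bs : List (Block n)) → total bs ≤ W →
               Call sizesᶠ (listVal (map (treeVal ∘ proj₁) bs)) (blocksVal bs) (M * suc (2 * total bs))
  sizes-call []       _  = ⇓function sizesᶠ M+0≤M*1 (⇓match-nat (⇓var _) ⇓lit)
  sizes-call (b@(t , _) ∷ bs) ≤W = ⇓function sizesᶠ
    (certificate 0 (*-monoʳ-≤ M (nodes≤2*leaves t)) (lem M (nodes t) (leaves t) (total bs)))
    (⇓match-cell (⇓var _) (⇓match-cell (⇓call (annotate-call t (≤-trans (m≤m+n (leaves t) (total bs)) ≤W)) (⇓var _))
      (⇓cons (⇓cons (⇓var _) (⇓var _)) (⇓call (sizes-call bs (≤-trans (m≤n+m (total bs) (leaves t)) ≤W)) (⇓var _)))))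
    where
    lem : ∀ M k m T → M + (M * k + M * suc (2 * T)) + M * (2 * m) + 0 ≡ M * suc (2 * (m + T)) + M * suc k
    lem = solve-∀

module _ {n : ℕ} where

  blocks-of : List (Tree n) → List (Rooted n) → List (Block n)
  blocks-of = zipWith λ t x → t , family x

  record Represented (ts : List (Tree n)) (xs : List (Rooted n)) : Set where
    field
      trees≡   : map proj₁ (blocks-of ts xs) ≡ ts
      rooteds≡ : toRooteds (blocks-of ts xs) ≡ xs
      rep      : All RepresentsBlock (blocks-of ts xs)

  represented : ∀ {ts xs} → Pointwise (λ t x → t Represents family x) ts xs → All IsBD xs → Represented ts xs
  represented []           []         = record { trees≡ = refl ; rooteds≡ = refl ; rep = [] }
  represented {t ∷ _} {x ∷ _} (r ∷ rs) (bd ∷ bds) = record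
    { trees≡   = cong (t ∷_) trees≡
    ; rooteds≡ = cong₂ _∷_ (cong (λ X → rooted X (family x)) (representing-root bd r)) rooteds≡
    ; rep      = r ∷ rep }
    where open Represented (represented rs bds)

completeInLinearTime : CompleteInLinearTime
completeInLinearTime = completeProgram , K , λ xs ts xs≢[] bds disj reps → run xs ts xs≢[] disj (represented reps bds)
  where
  -- Per leaf: `2 * M` for annotating the inputs, `2 * M` for the constant overhead, and
  -- `3 * M + assembleCost` for the budgets, with each logarithm bounded by the size itself.
  K = 7 * M + assembleCost
  run : ∀ {n} (xs : List (Rooted n)) (ts : List (Tree n)) → xs ≢ [] → AllPairs DisjointRoots xs → Represented ts xs →
        ∃[ t′ ] ∃[ 𝒞′ ] ∃[ c ] (Run completeProgram (K * sum (map size xs)) (listVal (map treeVal ts)) (treeVal t′) c ×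
          c ≤ K * sum (map size xs) × t′ Represents 𝒞′ × Complete xs 𝒞′)
  run xs ts xs≢[] disj represented =
    A.tree , A.fam , _ , proj₁ (proj₂ total-run) , ≤-trans (proj₂ (proj₂ total-run)) cost≤ , A.represents ,
    subst (λ ys → Complete ys A.fam) rooteds≡ A.completed
    where
    open Represented represented
    W = K * sum (map size xs)
    open Semantics code W
    open Costs W
    bs = blocks-of ts xs
    total≡ : total bs ≡ sum (map size xs)
    total≡ = cong sum (trans (sym (sizes≡leaves rep)) (cong (map size) rooteds≡))
    ≤W : total bs ≤ W
    ≤W = ≤-trans (≤-reflexive total≡) (certificate (22 * M * sum (map size xs)) (z≤n {0}) (lem M (sum (map size xs))))
      where
      lem : ∀ M m → m + 0 + 22 * M * m ≡ (7 * M + (15 * M + 1)) * m + 0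
      lem = solve-∀
    bs≢[] : bs ≢ []
    bs≢[] bs≡[] = xs≢[] (trans (sym rooteds≡) (cong toRooteds bs≡[]))
    disjoint : AllPairs DisjointBlocks bs
    disjoint = AllPairs.map⁻ (subst (AllPairs DisjointRoots) (sym rooteds≡) disj)
    module A = Assemble.Assembled (Assemble.assemble-call W bs bs≢[] ≤W rep disjoint)
    total-run : Call completeᶠ (listVal (map treeVal ts)) (treeVal A.tree) (M + (M * suc (2 * total bs) + A.cost))
    total-run = subst (λ vs → Call completeᶠ (listVal vs) (treeVal A.tree) (M + (M * suc (2 * total bs) + A.cost)))
      (trans (map-∘ bs) (cong (map treeVal) trees≡))
      (⇓function completeᶠ ≤-refl (⇓call A.run (⇓call (Sizes.sizes-call W bs ≤W) (⇓var _))))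
    1≤total : 1 ≤ total bs
    1≤total = ≤-trans (nonempty-length bs bs≢[]) (length≤total bs)
      where
      nonempty-length : ∀ {a} {V : Set a} (vs : List V) → vs ≢ [] → 1 ≤ length vs
      nonempty-length []       vs≢[] = ⊥-elim (vs≢[] refl)
      nonempty-length (_ ∷ _) _     = s≤s z≤n
    cost≤ : M + (M * suc (2 * total bs) + A.cost) ≤ W
    cost≤ = subst (λ m → M + (M * suc (2 * total bs) + A.cost) ≤ K * m) total≡
      (certificate (2 * M * λ₂ (total bs))
        (+-mono-≤ (+-mono-≤ A.pays (budget-≤ assembleCost bs)) (*-monoʳ-≤ (2 * M) 1≤total))
        (lem M A.cost assembleCost (total bs) (budget assembleCost bs) (λ₂ (total bs))))
      where
      lem : ∀ M c A T B l → M + (M * suc (2 * T) + c) + (B + (3 * M + A) * T + 2 * M * T) + 2 * M * l ≡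
                            (7 * M + A) * T + (c + 2 * M * l + B + 2 * M * 1)
      lem = solve-∀

lemma4p1 : ( (G : Graph) (C : Subset (Graph.#edges G)) (𝒞 : Family (Graph.#edges G)) (w : ℕ) →
    BranchDecomposition C 𝒞 → width G 𝒞 ≤ w →
    (∃[ 𝒞′ ] Balance C 𝒞 𝒞′) ×
    (∀ 𝒞′ → Balance C 𝒞 𝒞′ →
    BranchDecomposition C 𝒞′ ×
    width G 𝒞′ ≤ 2 * w ×
    (∀ e → e ∈ C → #clustersContaining e 𝒞′ ≤3log₂ ∣ C ∣ +1)) ) ×
    BalanceInLinearTime ×
    CompleteInLinearTime
lemma4p1 = main , balanceInLinearTime , completeInLinearTime
  where
  main : (G : Graph) (C : Subset (Graph.#edges G)) (𝒞 : Family (Graph.#edges G)) (w : ℕ) →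
    BranchDecomposition C 𝒞 → width G 𝒞 ≤ w →
    (∃[ 𝒞′ ] Balance C 𝒞 𝒞′) ×
    (∀ 𝒞′ → Balance C 𝒞 𝒞′ →
    BranchDecomposition C 𝒞′ ×
    width G 𝒞′ ≤ 2 * w ×
    (∀ e → e ∈ C → #clustersContaining e 𝒞′ ≤3log₂ ∣ C ∣ +1))
  main G C 𝒞 w bd 𝒞≤w = exists , λ 𝒞′ bal →
    let module B = Balanced (balance-balanced bal bd)
    in  B.bd , width-differences G 𝒞 𝒞′ 𝒞≤w B.asDifference , shallow⇒3log₂ B.shallow
    where
    exists : ∃[ 𝒞′ ] Balance C 𝒞 𝒞′
    -- The program finds a heavy path for every cluster that it balances, so its run on a tree for
    -- `𝒞` exhibits an output.
    exists =
      let _ , _ , run = balanceInLinearTime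
          t , _ , rep = tree-of bd
          _ , 𝒞′ , _ , _ , _ , _ , bal = run C 𝒞 t bd rep
      in  𝒞′ , bal
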